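{- We have $$\sup\left\{\frac{\mathrm{HYP}(\mathcal I)}{\mathrm{BCR}(\mathcal I)}:\ \mathcal I\text{ instance of Steiner Tree}\right\}\;=\;\sup\left\{\frac{\mathrm{OPT}(\mathcal I)}{\mathrm{BCR}(\mathcal I)}:\ \mathcal I\text{ MST-optimal instance of Steiner Tree}\right\},$$ where both suprema range over instances with at least two terminals.
   Context: An instance $\mathcal{I}=(G,c,R)$ of the Steiner Tree problem consists of a finite connected undirected graph $G=(V,E)$, positive edge costs $c\colon E\to\mathbb{R}_{>0}$, and a nonempty set $R\subseteq V$ of terminals. A Steiner tree is a tree in $G$ containing all terminals; $\mathrm{OPT}(\mathcal{I})$ is the minimum cost of a Steiner tree. $\mathrm{TMST}$ is the cost of a minimum spanning tree of the complete graph on $R$ with edge costs given by shortest-path distances in $(G,c)$. The instance is MST-optimal if $\mathrm{TMST}=\mathrm{OPT}$. Fix an arbitrary root $r\in R$. $\mathrm{BCR}(\mathcal I)$: let $\vec E$ contain both orientations of every edge of $G$, each with the cost of the undirected edge, and $\delta^+(S)=\{(v,w)\in\vec E: v\in S,w\notin S\}$. $\mathrm{BCR}(\mathcal I)$ is the optimum value of $$\min \sum_{e\in\vec E}c(e)x_e\ \text{ s.t. }\ \sum_{e\in\delta^+(S)}x_e\ge 1\ \forall S\subseteq V\setminus\{r\}\text{ with }S\cap R\ne\emptyset,\quad x\ge 0,$$ which is independent of $r$. $\mathrm{HYP}(\mathcal I)$ (Hypergraphic Relaxation): let $\vec{\mathcal X}=\{(X,v):X\subseteq R, v\in X\}$,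 for $S\subseteq R$ let $\delta^+_{\vec{\mathcal X}}(S)=\{(X,v)\in\vec{\mathcal X}: X\cap S\neq\emptyset, v\notin S\}$, and let $\mathrm{cost}(X)$ be the minimum cost of an edge set $K\subseteq E$ such that all vertices of $X$ lie in the same connected component of $(V,K)$. $\mathrm{HYP}(\mathcal I)$ is the optimum value of $$\min\sum_{(X,v)\in\vec{\mathcal X}}\mathrm{cost}(X)\,x_{(X,v)}\ \text{ s.t. }\sum_{(X,v)\in\delta^+_{\vec{\mathcal X}}(S)}x_{(X,v)}\ge 1\ \ \forall\,\emptyset\ne S\subseteq R\setminus\{r\},\quad x\ge 0.$$ -}

module Defs where

open import Algebra.Bundles using (CommutativeRing)
open import Algebra.Structures using (IsCommutativeRing)
open import Data.Bool using (Bool; T; if_then_else_)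
open import Data.Fin using (Fin; _<?_)
open import Data.Fin.Subset
  using (Subset; inside; outside; _∈_; _∉_; _⊆_; _∩_; Nonempty; ∣_∣)
open import Data.Fin.Subset.Properties using (_∈?_; _⊆?_; nonempty?)
open import Data.List using (List; []; _∷_; length)
open import Data.List.Relation.Unary.Unique.Propositional using (Unique)
open import Data.Nat using (ℕ; zero; suc)
import Data.Nat as ℕ
open import Data.Product using (Σ; ∃; ∃-syntax; Σ-syntax; _×_; _,_)
open import Data.Vec using ([]; _∷_)
open import Level using (0ℓ)
open import Relation.Binary.Construct.Closure.ReflexiveTransitive using (Star; ε; _◅_)
open import Relation.Binary.Core using (Rel)
open import Relation.Binary.Structures using (IsDecTotalOrder)
import Relation.Binary.Construct.Add.Supremum.NonStrict as AddSup
import Relation.Binary.Construct.NonStrictToStrict as ToStrict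
open import Relation.Nullary using (¬_; Dec; does)
open import Relation.Nullary.Construct.Add.Supremum using (_⁺; [_])
open import Relation.Nullary.Decidable using (T?; _×-dec_; ¬?)

-- The axioms characterising ℝ up to isomorphism.  The order is decidable, as
-- it is in classical mathematics.
record CompleteOrderedField : Set₁ where
  infix  8 _⁻¹
  infixl 7 _*_
  infixl 6 _+_
  infix  4 _≈_ _≤_
  field
    Carrier           : Set
    _≈_ _≤_           : Rel Carrier 0ℓ
    _+_ _*_           : Carrier → Carrier → Carrier
    -_                : Carrier → Carrier
    0# 1#             : Carrier
    -- The value of 0# ⁻¹ is unspecified.
    _⁻¹               : Carrier → Carrier
    isCommutativeRing : IsCommutativeRing _≈_ _+_ _*_ -_ 0# 1#
    isDecTotalOrder   : IsDecTotalOrder _≈_ _≤_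
    1≉0               : ¬ 1# ≈ 0#
    *-inverseʳ        : ∀ x → ¬ x ≈ 0# → x * x ⁻¹ ≈ 1#
    +-monoˡ-≤         : ∀ z {x y} → x ≤ y → x + z ≤ y + z
    *-nonNegative     : ∀ {x y} → 0# ≤ x → 0# ≤ y → 0# ≤ x * y
    complete          : (P : Carrier → Set) →
                        ∃ P →
                        (∃[ u ] ∀ x → P x → x ≤ u) →
                        ∃[ s ] (∀ x → P x → x ≤ s) ×
                               (∀ u → (∀ x → P x → x ≤ u) → s ≤ u)

  commutativeRing : CommutativeRing 0ℓ 0ℓ
  commutativeRing = record { isCommutativeRing = isCommutativeRing }

  open ToStrict _≈_ _≤_ public using (_<_)

-- A set of two-element subsets of Fin n, given by its adjacency relation.
record EdgeSet (n : ℕ) : Set where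
  field
    adj    : Fin n → Fin n → Bool
    sym    : ∀ u v → T (adj u v) → T (adj v u)
    irrefl : ∀ v → ¬ T (adj v v)

  Adj : Rel (Fin n) 0ℓ
  Adj u v = T (adj u v)

  Walk : Rel (Fin n) 0ℓ
  Walk = Star Adj

  vertices : ∀ {u v} → Walk u v → List (Fin n)
  vertices {u} ε       = u ∷ []
  vertices {u} (_ ◅ p) = u ∷ vertices p

  IsPath : ∀ {u v} → Walk u v → Set
  IsPath p = Unique (vertices p)

  -- A path on at least three vertices together with an edge joining its ends.
  Cycle : Set
  Cycle = ∃[ u ] ∃[ v ] Σ[ p ∈ Walk u v ]
            IsPath p × 3 ℕ.≤ length (vertices p) × Adj v u

open EdgeSet using (adj; Adj; Walk; IsPath; Cycle)

_⊆ᴱ_ : ∀ {n} → EdgeSet n → EdgeSet n → Set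
K ⊆ᴱ L = ∀ u v → Adj K u v → Adj L u v

record IsTree {n} (W : Subset n) (K : EdgeSet n) : Set where
  field
    nonempty  : Nonempty W
    within    : ∀ u v → Adj K u v → u ∈ W × v ∈ W
    connected : ∀ u v → u ∈ W → v ∈ W → Walk K u v
    acyclic   : ¬ Cycle K

module SteinerTree (ℝ : CompleteOrderedField) where

  open CompleteOrderedField ℝ
  open CommutativeRing commutativeRing using (+-commutativeMonoid)
  open import Algebra.Properties.CommutativeMonoid.Sum +-commutativeMonoid
    using (sum-syntax)
  open AddSup _≤_ using (_≤⁺_)

  -- The supremum in the reals extended by a top element.
  IsSup : (Carrier → Set) → Carrier ⁺ → Set
  IsSup P s = (∀ x → P x → [ x ] ≤⁺ s) ×
              (∀ u → (∀ x → P x → [ x ] ≤⁺ u) → s ≤⁺ u)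

  IsMinimum : {A : Set} → (A → Set) → (A → Carrier) → Carrier → Set
  IsMinimum Feasible objective m =
    (∃[ a ] Feasible a × m ≈ objective a) ×
    (∀ a → Feasible a → m ≤ objective a)

  when : {P : Set} → Dec P → Carrier → Carrier
  when P? a = if does P? then a else 0#

  ∑-subsets : ∀ n → (Subset n → Carrier) → Carrier
  ∑-subsets zero    f = f []
  ∑-subsets (suc n) f = ∑-subsets n (λ X → f (outside ∷ X)) +
                        ∑-subsets n (λ X → f (inside ∷ X))

  -- Only the entries w u v with u < v are used, so that each edge counts once.
  weight : ∀ {n} → (Fin n → Fin n → Carrier) → EdgeSet n → Carrier
  weight {n} w K =
    ∑[ u < n ] ∑[ v < n ] when ((u <? v) ×-dec T? (adj K u v)) (w u v)

  walkCost : ∀ {n} (w : Fin n → Fin n → Carrier) (K : EdgeSet n) {u v : Fin n} →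
             Walk K u v → Carrier
  walkCost w K {u} ε               = 0#
  walkCost w K {u} (_◅_ {j = v} _ p) = w u v + walkCost w K p

  -- The values of c at pairs that are not edges are irrelevant.
  record Instance : Set where
    field
      n         : ℕ
      E         : EdgeSet n
      connected : ∀ u v → Walk E u v
      c         : Fin n → Fin n → Carrier
      c-sym     : ∀ u v → Adj E u v → c u v ≈ c v u
      c-pos     : ∀ u v → Adj E u v → 0# < c u v
      R         : Subset n
      R-nonempty : Nonempty R

  module _ (I : Instance) where
    open Instance I

    SteinerTreeEdges : EdgeSet n → Set
    SteinerTreeEdges K = K ⊆ᴱ E × (∃[ W ] R ⊆ W × IsTree W K)

    IsOPT : Carrier → Set
    IsOPT = IsMinimum SteinerTreeEdges (weight c)

    IsDistance : Fin n → Fin n → Carrier → Set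
    IsDistance u v = IsMinimum {A = Walk E u v} (IsPath E) (walkCost c E)

    -- Trees with vertex set R are the spanning trees of the complete graph on R.
    IsTMST : Carrier → Set
    IsTMST t = Σ[ d ∈ (Fin n → Fin n → Carrier) ]
      (∀ u v → u ∈ R → v ∈ R → IsDistance u v (d u v)) ×
      IsMinimum (IsTree R) (weight d) t

    MSTOptimal : Set
    MSTOptimal = ∃[ t ] ∃[ o ] IsTMST t × IsOPT o × t ≈ o

    -- In both relaxations a variable is present for every pair, but those at
    -- pairs outside the index set occur in no constraint and not in the
    -- objective.

    record BCRFeasible (r : Fin n) (x : Fin n → Fin n → Carrier) : Set where
      field
        nonneg : ∀ v w → Adj E v w → 0# ≤ x v w
        cut    : ∀ S → r ∉ S → Nonempty (S ∩ R) →
                 1# ≤ ∑[ v < n ] ∑[ w < n ]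
                        when (T? (adj E v w) ×-dec (v ∈? S) ×-dec ¬? (w ∈? S))
                             (x v w)

    BCRCost : (Fin n → Fin n → Carrier) → Carrier
    BCRCost x = ∑[ v < n ] ∑[ w < n ] when (T? (adj E v w)) (c v w * x v w)

    IsBCR : Fin n → Carrier → Set
    IsBCR r = IsMinimum (BCRFeasible r) BCRCost

    IsConnectionCost : Subset n → Carrier → Set
    IsConnectionCost X =
      IsMinimum (λ K → K ⊆ᴱ E × (∀ u v → u ∈ X → v ∈ X → Walk K u v)) (weight c)

    record HYPFeasible (r : Fin n) (x : Subset n → Fin n → Carrier) : Set where
      field
        nonneg : ∀ X v → X ⊆ R → v ∈ X → 0# ≤ x X v
        cut    : ∀ S → Nonempty S → S ⊆ R → r ∉ S →
                 1# ≤ ∑-subsets n λ X → ∑[ v < n ]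
                        when (((X ⊆? R) ×-dec (v ∈? X)) ×-dec
                              (nonempty? (X ∩ S) ×-dec ¬? (v ∈? S)))
                             (x X v)

    HYPCost : (Subset n → Carrier) → (Subset n → Fin n → Carrier) → Carrier
    HYPCost cost x = ∑-subsets n λ X → ∑[ v < n ]
      when ((X ⊆? R) ×-dec (v ∈? X)) (cost X * x X v)

    IsHYP : Fin n → Carrier → Set
    IsHYP r h = Σ[ cost ∈ (Subset n → Carrier) ]
      (∀ X → X ⊆ R → IsConnectionCost X (cost X)) ×
      IsMinimum (HYPFeasible r) (HYPCost cost) h

  open Instance using (R)

  -- BCR is positive whenever there are at least two terminals, so the
  -- unspecified value 0# ⁻¹ never enters the ratios.

  HYP/BCR : Carrier → Set
  HYP/BCR q = Σ[ I ∈ Instance ] 2 ℕ.≤ ∣ R I ∣ ×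
    (∃[ r ] r ∈ R I × (∃[ h ] ∃[ b ]
      IsHYP I r h × IsBCR I r b × q ≈ h * b ⁻¹))

  OPT/BCR : Carrier → Set
  OPT/BCR q = Σ[ I ∈ Instance ] 2 ℕ.≤ ∣ R I ∣ × MSTOptimal I ×
    (∃[ r ] r ∈ R I × (∃[ o ] ∃[ b ]
      IsOPT I o × IsBCR I r b × q ≈ o * b ⁻¹))

{-# OPTIONS --safe #-}
module Submission where

-- On an MST-optimal instance HYP = OPT.  Contracting a terminal set X saves at most
-- cost X on a minimum terminal spanning tree, as otherwise OPT < TMST.  Running
-- Kruskal's algorithm, the cut constraints show that these savings, weighted with
-- any feasible x, add up to at least TMST, so that x costs at least TMST = OPT.
--
-- Conversely, given any instance, let y be a dual solution of HYP that is optimal for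
-- a slightly perturbed objective; by uncrossing, its support is laminar.  Let f X be
-- the maximum over v ∈ X of the sum of y S over the S that meet X but avoid v, and
-- join every two terminals u, v by an edge of cost f {u, v}.  Feasibility of y says
-- f ≤ cost, so BCR does not increase.  As f is subadditive on intersecting sets, each
-- Steiner tree of the new instance costs at least f R = Σ y.  By laminarity some
-- terminal spanning tree costs at most Σ y.  Hence the new instance is MST-optimal,
-- and its optimum Σ y is arbitrarily close to HYP.
--
-- The order is decidable and hence stable under double negation, so minima over
-- finite sets are needed only up to double negation.

open import Defs
open import Algebra.Bundles using (CommutativeRing; RawRing)
open import Algebra.Solver.Ring.AlmostCommutativeRing
  using ( _-Raw-AlmostCommutative⟶_; fromCommutativeRing )
open import Data.Bool using (if_then_else_) renaming (_≟_ to _≟ᵇ_)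
open import Data.Empty using (⊥-elim)
open import Data.Fin using (Fin; zero; suc; _<?_)
import Data.Fin as Fin
import Data.Fin.Properties as Fin
open import Data.Fin.Subset
  using ( Subset; inside; outside; _∈_; _∉_; _⊆_; _∩_; _∪_; ⊥; Nonempty; ⁅_⁆; ∣_∣ )
import Data.Fin.Subset as Subset
open import Data.Fin.Subset.Properties
  using ( _∈?_; _⊆?_; nonempty?; ∉⊥; ⊆-antisym; x∈p∪q⁺; x∈p∪q⁻; x∈p∩q⁺; x∈p∩q⁻
        ; Empty-unique; p∩q⊆p; x∈⁅x⁆; x∈⁅y⁆⇒x≡y; ∣⁅x⁆∣≡1; p⊆q⇒∣p∣≤∣q∣; ∪-comm; ∩-zeroʳ
        ; ∈⊤ )
open import Data.List
  using ( List; []; _∷_; _++_; map; filter; allFin; tabulate; cartesianProduct; length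
        ; lookup; cartesianProductWith )
open import Data.List.Membership.Propositional using (find) renaming (_∈_ to _∈ᴸ_; _∉_ to _∉ᴸ_)
open import Data.List.Membership.Propositional.Properties
  using ( ∈-allFin; ∈-map⁺; ∈-map⁻; ∈-++⁺ˡ; ∈-++⁺ʳ; ∈-cartesianProduct⁺; ∈-filter⁺
        ; ∈-filter⁻; ∈-++⁻; ∈-lookup; ∈-cartesianProductWith⁺ )
open import Data.List.Properties using (filter-notAll)
open import Data.List.Relation.Binary.Permutation.Propositional using (_↭_; ↭-sym)
import Data.List.Relation.Binary.Permutation.Propositional as ↭
open import Data.List.Relation.Binary.Permutation.Propositional.Properties
  using ( ∈-resp-↭ )
open import Data.List.Relation.Unary.All using ([]; _∷_)
import Data.List.Relation.Unary.All as All
import Data.List.Relation.Unary.All.Properties as All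
open import Data.List.Relation.Unary.AllPairs using ([]; _∷_; AllPairs)
open import Data.List.Relation.Unary.Any using (here; there)
import Data.List.Relation.Unary.Any as Any
import Data.List.Relation.Unary.Sorted.TotalOrder.Properties as Sorted
open import Data.List.Relation.Unary.Unique.Propositional using (Unique)
import Data.List.Relation.Unary.Unique.Propositional.Properties as Unique
import Data.List.Sort
open import Data.Maybe using (Maybe; just; nothing)
open import Data.Nat using (ℕ; zero; suc)
import Data.Nat as ℕ
open import Data.Nat.Induction using (<-wellFounded)
import Data.Nat.Properties as ℕ
open import Data.Product
  using ( _×_; _,_; proj₁; proj₂; Σ-syntax; ∃; ∃-syntax; uncurry; swap; _,′_ )
import Data.Product as ×
import Data.Product.Properties as ×
open import Data.Sum using (inj₁; inj₂; _⊎_; [_,_]′)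
import Data.Sum as ⊎
import Data.Sum.Properties as ⊎
open import Data.Unit using (⊤; tt)
open import Data.Vec using (_∷_; [])
import Data.Vec as Vec
import Data.Vec.Properties as Vec
open import Function using (_∘_; id; case_of_; _⟨_⟩_)
open import Induction.WellFounded using (Acc; acc)
open import Level using (0ℓ)
open import Relation.Binary.Bundles using (DecTotalOrder)
import Relation.Binary.Construct.Add.Supremum.NonStrict as AddSup
open import Relation.Binary.Construct.Closure.ReflexiveTransitive
  using ( ε; _◅_; _◅◅_; reverse; gmap )
import Relation.Binary.Construct.On as On
open import Relation.Binary.Definitions using (DecidableEquality; tri<; tri≈; tri>)
open import Relation.Binary.PropositionalEquality using (_≡_; _≢_)
import Relation.Binary.PropositionalEquality as ≡
import Relation.Binary.Reasoning.Setoid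
open import Relation.Binary.Structures using (IsDecTotalOrder; IsEquivalence)
open import Relation.Nullary using (¬_; yes; no; Dec; does)
open import Relation.Nullary.Construct.Add.Supremum using ([_]; ⊤⁺)
open import Relation.Nullary.Decidable
  using ( decidable-stable; ¬?; _×-dec_; T?; _⊎-dec_; ⌊_⌋; toWitness; fromWitness
        ; ¬¬-excluded-middle; dec-true; dec-false )
open import Relation.Unary using (Decidable)

-- The two inequalities differ in strength. An MST-optimal instance has the same ratio on both
-- sides: the single connector spanning all of `R` gives HYP ≤ OPT, and the savings argument gives
-- the converse. For an arbitrary instance its HYP ratio is only approximated by ratios of
-- MST-optimal instances, for two reasons. First, a dual optimum need not be laminar, and uncrossing
-- it step by step would call for a termination argument. Adding a small multiple of the squared
-- cardinality to the objective makes every uncrossing strictly profitable, so that an optimum of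
-- the new objective is laminar at once. Second, an instance must have positive edge costs, whereas
-- `f {u, v}` may vanish. A small weight on every singleton repairs this without spoiling
-- laminarity, but it overloads the connectors slightly, so that the old costs have to be scaled up.
-- Each of the two changes loses a factor of at most 1 + γ, the first in the dual value and the
-- second in BCR, and γ is arbitrary.

module _ (ℝ : CompleteOrderedField) where

  -- Ring identities: a solver with integer coefficients

  open CompleteOrderedField ℝ
  open CommutativeRing commutativeRing
    using ( refl; sym; trans; reflexive; setoid; _-_
          ; +-cong; +-congˡ; +-congʳ; +-comm; +-assoc; +-identityˡ; +-identityʳ
          ; *-cong; *-congˡ; *-congʳ; *-comm; *-assoc; *-identityˡ; *-identityʳ
          ; zeroˡ; zeroʳ; distribˡ; distribʳ; -‿inverseʳ; -‿cong
          ; +-commutativeMonoid; ring; semiring; commutativeSemiring )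

  -- A formal difference (a , b) stands for a · 1# - b · 1#.
  module DifferenceCoefficients where
    open import Algebra.Properties.Monoid.Mult
      (CommutativeRing.+-monoid commutativeRing) using (×-homo-+)
      renaming (_×_ to _·_; ×-congˡ to ×-cong≡)
    open import Algebra.Properties.Semiring.Mult semiring using (×1-homo-*)
    open import Algebra.Properties.Ring ring
      using (-‿distribˡ-*; -‿distribʳ-*; -‿+-comm; -‿involutive; -0#≈0#)
    open import Relation.Binary.Reasoning.Setoid setoid
    open import Algebra.Solver.Ring.NaturalCoefficients.Default commutativeSemiring
      using (solve; _:=_; _:+_; _:*_)

    Difference : Set
    Difference = ℕ × ℕ

    -- Calls of the solver end with `refl` between normal forms, so coefficients that are equal as
    -- integers have to reduce to the same pair.
    normalise : ℕ → ℕ → Difference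
    normalise (ℕ.suc a) (ℕ.suc b) = normalise a b
    normalise a         b         = a , b

    differences : RawRing 0ℓ 0ℓ
    differences = record
      { Carrier = Difference
      ; _≈_     = _≡_
      ; _+_     = λ (a , b) (c , d) → normalise (a ℕ.+ c) (b ℕ.+ d)
      ; _*_     = λ (a , b) (c , d) → normalise (a ℕ.* c ℕ.+ b ℕ.* d) (a ℕ.* d ℕ.+ b ℕ.* c)
      ; -_      = λ (a , b) → b , a
      ; 0#      = 0 , 0
      ; 1#      = 1 , 0
      }

    -- The values at 0 and 1 are special so that they compute to 0# and 1#.
    ⟦_⟧ : Difference → Carrier
    ⟦ 0 , 0 ⟧ = 0#
    ⟦ 1 , 0 ⟧ = 1#
    ⟦ a , b ⟧ = a · 1# - b · 1#

    ⟦⟧-def : ∀ d → ⟦ d ⟧ ≈ proj₁ d · 1# - proj₂ d · 1#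
    ⟦⟧-def (0 , 0)               = sym (-‿inverseʳ 0#)
    ⟦⟧-def (1 , 0)               = sym (trans (+-congˡ -0#≈0#)
                                     (trans (+-identityʳ _) (+-identityʳ _)))
    ⟦⟧-def (0 , ℕ.suc b)           = refl
    ⟦⟧-def (1 , ℕ.suc b)           = refl
    ⟦⟧-def (ℕ.suc (ℕ.suc a) , 0)     = refl
    ⟦⟧-def (ℕ.suc (ℕ.suc a) , ℕ.suc b) = refl

    private
      minus-distrib : ∀ x y → - (x + y) ≈ - x + - y
      minus-distrib x y = sym (-‿+-comm x y)

      minus-* : ∀ x y → - x * - y ≈ x * y
      minus-* x y = begin
        - x * - y     ≈⟨ -‿distribˡ-* x (- y) ⟨
        - (x * - y)   ≈⟨ -‿cong (-‿distribʳ-* x y) ⟨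
        - - (x * y)   ≈⟨ -‿involutive _ ⟩
        x * y         ∎

      homo-+* : ∀ a c b d → (a ℕ.* c ℕ.+ b ℕ.* d) · 1# ≈
                (a · 1#) * (c · 1#) + (b · 1#) * (d · 1#)
      homo-+* a c b d = trans (×-homo-+ 1# (a ℕ.* c) (b ℕ.* d))
                              (+-cong (×1-homo-* a c) (×1-homo-* b d))

      ⟦normalise⟧ : ∀ a b → ⟦ normalise a b ⟧ ≈ a · 1# - b · 1#
      ⟦normalise⟧ ℕ.zero    b         = ⟦⟧-def (0 , b)
      ⟦normalise⟧ (ℕ.suc a) ℕ.zero    = ⟦⟧-def (ℕ.suc a , 0)
      ⟦normalise⟧ (ℕ.suc a) (ℕ.suc b) = begin
        ⟦ normalise a b ⟧                       ≈⟨ ⟦normalise⟧ a b ⟩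
        a · 1# - b · 1#                         ≈⟨ +-identityˡ _ ⟨
        0# + (a · 1# - b · 1#)                  ≈⟨ +-congʳ (-‿inverseʳ 1#) ⟨
        1# - 1# + (a · 1# - b · 1#)
          ≈⟨ solve 4 (λ p q r s → p :+ q :+ (r :+ s) := (p :+ r) :+ (q :+ s)) refl _ _ _ _ ⟩
        (1# + a · 1#) + (- 1# - b · 1#)         ≈⟨ +-congˡ (minus-distrib _ _) ⟨
        ℕ.suc a · 1# - ℕ.suc b · 1#             ∎

    morphism : differences -Raw-AlmostCommutative⟶ fromCommutativeRing commutativeRing
    morphism = record
      { ⟦_⟧    = ⟦_⟧
      ; +-homo = λ (a , b) (c , d) → begin
          ⟦ normalise (a ℕ.+ c) (b ℕ.+ d) ⟧ ≈⟨ ⟦normalise⟧ (a ℕ.+ c) (b ℕ.+ d) ⟩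
          (a ℕ.+ c) · 1# - (b ℕ.+ d) · 1#
            ≈⟨ +-cong (×-homo-+ 1# a c) (-‿cong (×-homo-+ 1# b d)) ⟩
          (a · 1# + c · 1#) - (b · 1# + d · 1#)
            ≈⟨ +-congˡ (minus-distrib _ _) ⟩
          (a · 1# + c · 1#) + (- (b · 1#) + - (d · 1#))
            ≈⟨ solve 4 (λ p q r s → (p :+ q) :+ (r :+ s) := (p :+ r) :+ (q :+ s))
                 refl _ _ _ _ ⟩
          (a · 1# - b · 1#) + (c · 1# - d · 1#)
            ≈⟨ +-cong (⟦⟧-def (a , b)) (⟦⟧-def (c , d)) ⟨
          ⟦ a , b ⟧ + ⟦ c , d ⟧ ∎
      ; *-homo = λ (a , b) (c , d) → begin
          ⟦ normalise (a ℕ.* c ℕ.+ b ℕ.* d) (a ℕ.* d ℕ.+ b ℕ.* c) ⟧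
            ≈⟨ ⟦normalise⟧ (a ℕ.* c ℕ.+ b ℕ.* d) (a ℕ.* d ℕ.+ b ℕ.* c) ⟩
          (a ℕ.* c ℕ.+ b ℕ.* d) · 1# - (a ℕ.* d ℕ.+ b ℕ.* c) · 1#
            ≈⟨ +-cong (homo-+* a c b d) (-‿cong (homo-+* a d b c)) ⟩
          (a · 1#) * (c · 1#) + (b · 1#) * (d · 1#)
            - ((a · 1#) * (d · 1#) + (b · 1#) * (c · 1#))
            ≈⟨ +-cong (+-congˡ (sym (minus-* _ _))) (trans (minus-distrib _ _)
                 (+-cong (-‿distribʳ-* _ _) (-‿distribˡ-* _ _))) ⟩
          (a · 1#) * (c · 1#) + - (b · 1#) * - (d · 1#)
            + ((a · 1#) * - (d · 1#) + - (b · 1#) * (c · 1#))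
            ≈⟨ solve 4 (λ p q r s → p :* q :+ r :* s :+ (p :* s :+ r :* q)
                 := (p :+ r) :* (q :+ s)) refl _ _ _ _ ⟩
          (a · 1# - b · 1#) * (c · 1# - d · 1#)
            ≈⟨ *-cong (⟦⟧-def (a , b)) (⟦⟧-def (c , d)) ⟨
          ⟦ a , b ⟧ * ⟦ c , d ⟧ ∎
      ; -‿homo = λ (a , b) → begin
          ⟦ b , a ⟧                ≈⟨ ⟦⟧-def (b , a) ⟩
          b · 1# - a · 1#          ≈⟨ +-comm _ _ ⟩
          - (a · 1#) + b · 1#      ≈⟨ +-congˡ (-‿involutive _) ⟨
          - (a · 1#) + - - (b · 1#) ≈⟨ minus-distrib _ _ ⟨
          - (a · 1# - b · 1#)      ≈⟨ -‿cong (⟦⟧-def (a , b)) ⟨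
          - ⟦ a , b ⟧              ∎
      ; 0-homo = refl
      ; 1-homo = refl
      }

    _≟_ : ∀ x y → Maybe (⟦ x ⟧ ≈ ⟦ y ⟧)
    (a , b) ≟ (c , d) with (a ℕ.+ d) ℕ.≟ (c ℕ.+ b)
    ... | no _  = nothing
    ... | yes e = just (begin
      ⟦ a , b ⟧                                ≈⟨ ⟦⟧-def (a , b) ⟩
      a · 1# - b · 1#                          ≈⟨ move _ _ _ ⟩
      (a · 1# + d · 1#) + (- (b · 1#) - d · 1#) ≈⟨ +-congʳ a+d≈c+b ⟩
      (c · 1# + b · 1#) + (- (b · 1#) - d · 1#) ≈⟨ +-congˡ (+-comm _ _) ⟩
      (c · 1# + b · 1#) + (- (d · 1#) - b · 1#) ≈⟨ move _ _ _ ⟨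
      c · 1# - d · 1#                          ≈⟨ ⟦⟧-def (c , d) ⟨
      ⟦ c , d ⟧                                ∎)
      where
      a+d≈c+b : a · 1# + d · 1# ≈ c · 1# + b · 1#
      a+d≈c+b = trans (sym (×-homo-+ 1# a d))
                      (trans (×-cong≡ e) (×-homo-+ 1# c b))

      move : ∀ x y z → x - y ≈ (x + z) + (- y - z)
      move x y z = begin
        x - y                 ≈⟨ +-identityʳ _ ⟨
        x - y + 0#            ≈⟨ +-congˡ (-‿inverseʳ z) ⟨
        x - y + (z - z)       ≈⟨ solve 4 (λ p q r s → p :+ q :+ (r :+ s)
                                   := (p :+ r) :+ (q :+ s)) refl x (- y) z (- z) ⟩
        (x + z) + (- y - z)   ∎

  module Solver where
    open import Algebra.Solver.Ring DifferenceCoefficients.differences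
      (fromCommutativeRing commutativeRing) DifferenceCoefficients.morphism
      DifferenceCoefficients._≟_ public
      using (Polynomial; solve; _:=_; _:+_; _:*_; _:-_; :-_; con)

    :0 :1 : ∀ {n} → Polynomial n
    :0 = con (0 , 0)
    :1 = con (1 , 0)

  -- Ordered fields

  open IsDecTotalOrder isDecTotalOrder
    using (antisym; total; _≤?_)
    renaming ( refl to ≤-refl; reflexive to ≤-reflexive; trans to ≤-trans
             ; ≤-respˡ-≈ to ≤-respˡ; ≤-respʳ-≈ to ≤-respʳ; _≟_ to _≈?_ )
  open Solver

  ≤-stable : ∀ {x y} → ¬ ¬ x ≤ y → x ≤ y
  ≤-stable {x} {y} = decidable-stable (x ≤? y)

  ≰⇒≥ : ∀ {x y} → ¬ x ≤ y → y ≤ x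
  ≰⇒≥ {x} {y} x≰y with total x y
  ... | inj₁ x≤y = ⊥-elim (x≰y x≤y)
  ... | inj₂ y≤x = y≤x

  +-mono-≤ : ∀ {x y u v} → x ≤ y → u ≤ v → x + u ≤ y + v
  +-mono-≤ {x} {y} {u} {v} x≤y u≤v = ≤-trans (+-monoˡ-≤ u x≤y)
    (≤-respˡ (+-comm u y) (≤-respʳ (+-comm v y) (+-monoˡ-≤ y u≤v)))

  +-monoʳ-≤ : ∀ x {u v} → u ≤ v → x + u ≤ x + v
  +-monoʳ-≤ x = +-mono-≤ ≤-refl

  -- In use, s ≤ t is a sum of known inequalities and x + t ≈ y + s a ring identity.
  ≤-by : ∀ {x y s t} → s ≤ t → x + t ≈ y + s → x ≤ y
  ≤-by {x} {y} {s} {t} s≤t eq =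
    ≤-respʳ (solve 2 (λ y t → y :+ t :+ :- t := y) refl y t)
      (≤-respˡ (trans (+-congʳ (sym eq))
                      (solve 2 (λ x t → x :+ t :+ :- t := x) refl x t))
        (+-monoˡ-≤ (- t) (+-monoʳ-≤ y s≤t)))

  0≤y-x : ∀ {x y} → x ≤ y → 0# ≤ y - x
  0≤y-x {x} {y} x≤y =
    ≤-by x≤y (solve 2 (λ x y → :0 :+ y := y :- x :+ x) refl x y)

  *-monoˡ-≤ : ∀ {z x y} → 0# ≤ z → x ≤ y → z * x ≤ z * y
  *-monoˡ-≤ {z} {x} {y} 0≤z x≤y = ≤-by (*-nonNegative 0≤z (0≤y-x x≤y))
    (solve 3 (λ x y z → z :* x :+ z :* (y :- x) := z :* y :+ :0) refl x y z)

  *-monoʳ-≤ : ∀ {z x y} → 0# ≤ z → x ≤ y → x * z ≤ y * z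
  *-monoʳ-≤ {z} {x} {y} 0≤z x≤y =
    ≤-respˡ (*-comm z x) (≤-respʳ (*-comm z y) (*-monoˡ-≤ 0≤z x≤y))

  +-nonneg : ∀ {x y} → 0# ≤ x → 0# ≤ y → 0# ≤ x + y
  +-nonneg p q = ≤-respˡ (+-identityˡ 0#) (+-mono-≤ p q)

  x≤x+ : ∀ {x y} → 0# ≤ y → x ≤ x + y
  x≤x+ {x} {y} 0≤y =
    ≤-by 0≤y (solve 2 (λ x y → x :+ y := x :+ y :+ :0) refl x y)

  x≤+x : ∀ {x y} → 0# ≤ y → x ≤ y + x
  x≤+x {x} {y} 0≤y = ≤-respʳ (+-comm x y) (x≤x+ 0≤y)

  0≤1 : 0# ≤ 1#
  0≤1 with total 0# 1#
  ... | inj₁ p = p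
  -- In this case `0# - 1#` is nonnegative, and `1#` is its square.
  ... | inj₂ p = ≤-respʳ (solve 0 ((:0 :- :1) :* (:0 :- :1) := :1) refl)
                   (*-nonNegative (0≤y-x p) (0≤y-x p))

  -- The negated form is exactly what the `no` branch of `_≤?_` delivers.
  Positive : Carrier → Set
  Positive x = ¬ x ≤ 0#

  Positive⇒0≤ : ∀ {x} → Positive x → 0# ≤ x
  Positive⇒0≤ = ≰⇒≥

  Positive⇒≉0 : ∀ {x} → Positive x → ¬ x ≈ 0#
  Positive⇒≉0 px e = px (≤-reflexive e)

  Positive⇒0< : ∀ {x} → Positive x → 0# < x
  Positive⇒0< px = Positive⇒0≤ px , λ e → px (≤-reflexive (sym e))

  0<⇒Positive : ∀ {x} → 0# < x → Positive x
  0<⇒Positive (0≤x , 0≉x) x≤0 = 0≉x (antisym 0≤x x≤0)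

  Positive-mono : ∀ {x y} → x ≤ y → Positive x → Positive y
  Positive-mono x≤y px y≤0 = px (≤-trans x≤y y≤0)

  1-positive : Positive 1#
  1-positive 1≤0 = 1≉0 (antisym 1≤0 0≤1)

  ⁻¹-positive : ∀ {x} → Positive x → Positive (x ⁻¹)
  ⁻¹-positive {x} px x⁻¹≤0 = 1-positive
    (≤-respˡ (*-inverseʳ x (Positive⇒≉0 px))
      (≤-respʳ (zeroʳ x) (*-monoˡ-≤ (Positive⇒0≤ px) x⁻¹≤0)))

  ⁻¹-cancelˡ : ∀ {z} x → Positive z → z ⁻¹ * (z * x) ≈ x
  ⁻¹-cancelˡ {z} x pz = trans (sym (*-assoc _ _ _))
    (trans (*-congʳ (trans (*-comm _ _) (*-inverseʳ z (Positive⇒≉0 pz))))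
           (*-identityˡ x))

  ⁻¹-cancelʳ : ∀ {z} x → Positive z → x * z ⁻¹ * z ≈ x
  ⁻¹-cancelʳ {z} x pz = trans
    (trans (*-congʳ (*-comm _ _)) (trans (*-assoc _ _ _) (*-congˡ (*-comm _ _))))
    (⁻¹-cancelˡ x pz)

  *-cancelˡ-≤ : ∀ {z x y} → Positive z → z * x ≤ z * y → x ≤ y
  *-cancelˡ-≤ {z} {x} {y} pz le =
    ≤-respˡ (⁻¹-cancelˡ x pz) (≤-respʳ (⁻¹-cancelˡ y pz)
      (*-monoˡ-≤ (Positive⇒0≤ (⁻¹-positive pz)) le))

  *-positive : ∀ {x y} → Positive x → Positive y → Positive (x * y)
  *-positive {x} {y} px py xy≤0 = py (*-cancelˡ-≤ px (≤-respʳ (sym (zeroʳ x)) xy≤0))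

  +-positive : ∀ {x y} → Positive x → 0# ≤ y → Positive (x + y)
  +-positive px 0≤y = Positive-mono (x≤x+ 0≤y) px

  open SteinerTree ℝ
    using ( when; ∑-subsets; weight; walkCost; IsMinimum; Instance; SteinerTreeEdges
          ; IsOPT; IsDistance; IsTMST; IsConnectionCost; MSTOptimal; HYPFeasible; HYPCost
          ; IsHYP; module HYPFeasible; BCRFeasible; BCRCost; IsBCR; module BCRFeasible
          ; HYP/BCR; OPT/BCR; IsSup )

  -- Indicators and finite sums

  private variable
    A B P Q : Set

  when-yes : (P? : Dec P) → P → ∀ a → when P? a ≈ a
  when-yes (yes _) _ a = refl
  when-yes (no ¬p) p a = ⊥-elim (¬p p)

  when-no : (P? : Dec P) → ¬ P → ∀ a → when P? a ≈ 0#
  when-no (yes p) ¬p a = ⊥-elim (¬p p)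
  when-no (no _)  _  a = refl

  when-cong : (P? : Dec P) (Q? : Dec Q) → (P → Q) → (Q → P) → ∀ {a b} →
              (P → a ≈ b) → when P? a ≈ when Q? b
  when-cong (yes p) Q? to from a≈b = trans (a≈b p) (sym (when-yes Q? (to p) _))
  when-cong (no ¬p) Q? to from a≈b = sym (when-no Q? (¬p ∘ from) _)

  when-mono : (P? : Dec P) (Q? : Dec Q) → (P → Q) → ∀ {a b} →
              (P → a ≤ b) → (Q → 0# ≤ b) → when P? a ≤ when Q? b
  when-mono (yes p) Q? to a≤b _ = ≤-respʳ (sym (when-yes Q? (to p) _)) (a≤b p)
  when-mono (no ¬p) (yes q) to _ 0≤b = 0≤b q
  when-mono (no ¬p) (no _)  to _ _   = ≤-refl

  when-nonneg : (P? : Dec P) → ∀ {a} → (P → 0# ≤ a) → 0# ≤ when P? a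
  when-nonneg (yes p) 0≤a = 0≤a p
  when-nonneg (no _)  _   = ≤-refl

  when-≤ : (P? : Dec P) → ∀ {a} → 0# ≤ a → when P? a ≤ a
  when-≤ (yes _) _   = ≤-refl
  when-≤ (no _)  0≤a = 0≤a

  when-bound : (P? : Dec P) → ∀ {a b} → (P → a ≤ b) → 0# ≤ b → when P? a ≤ b
  when-bound (yes p) a≤b _   = a≤b p
  when-bound (no _)  _   0≤b = 0≤b

  when-*ˡ : (P? : Dec P) → ∀ a b → when P? (a * b) ≈ a * when P? b
  when-*ˡ (yes _) a b = refl
  when-*ˡ (no _)  a b = sym (zeroʳ a)

  when-*ʳ : (P? : Dec P) → ∀ a b → when P? (a * b) ≈ when P? a * b
  when-*ʳ (yes _) a b = refl
  when-*ʳ (no _)  a b = sym (zeroˡ b)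

  when-×-dec : (P? : Dec P) (Q? : Dec Q) → ∀ a → when (P? ×-dec Q?) a ≈ when P? a * when Q? 1#
  when-×-dec (yes _) (yes _) a = sym (*-identityʳ a)
  when-×-dec (yes _) (no _)  a = sym (zeroʳ a)
  when-×-dec (no _)  _       a = sym (zeroˡ _)

  when-*-mono : (P? : Dec P) → ∀ {a x y} → (P → 0# ≤ a) → (P → x ≤ y) →
    when P? a * x ≤ when P? a * y
  when-*-mono (yes p) 0≤a x≤y = *-monoˡ-≤ (0≤a p) (x≤y p)
  when-*-mono (no _)  _   _   = ≤-reflexive (trans (zeroˡ _) (sym (zeroˡ _)))

  when-congʳ : (P? : Dec P) → ∀ {a b} → (P → a ≈ b) → when P? a ≈ when P? b
  when-congʳ P? = when-cong P? P? (λ p → p) (λ p → p)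

  when-zero : (P? : Dec P) → ∀ {a} → (P → a ≈ 0#) → when P? a ≈ 0#
  when-zero (yes p) a≈0 = a≈0 p
  when-zero (no _)  _   = refl

  indicator : Dec P → Carrier
  indicator P? = when P? 1#

  indicator-yes : (P? : Dec P) → P → indicator P? ≈ 1#
  indicator-yes P? p = when-yes P? p 1#

  indicator-no : (P? : Dec P) → ¬ P → indicator P? ≈ 0#
  indicator-no P? ¬p = when-no P? ¬p 1#

  indicator-nonneg : (P? : Dec P) → 0# ≤ indicator P?
  indicator-nonneg P? = when-nonneg P? λ _ → 0≤1

  indicator≤1 : (P? : Dec P) → indicator P? ≤ 1#
  indicator≤1 P? = when-≤ P? 0≤1

  indicator-≤-+ : (P? : Dec P) (Q? : Dec Q) (A? : Dec A) → (P → Q ⊎ A) →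
                  indicator P? ≤ indicator Q? + indicator A?
  indicator-≤-+ (no _)  Q? A? _  = +-nonneg (indicator-nonneg Q?) (indicator-nonneg A?)
  indicator-≤-+ (yes p) Q? A? to with to p
  ... | inj₁ q = ≤-respˡ (indicator-yes Q? q) (x≤x+ (indicator-nonneg A?))
  ... | inj₂ a = ≤-respˡ (indicator-yes A? a) (x≤+x (indicator-nonneg Q?))

  -- The hypotheses say that at least as many of `A`, `B` hold as of `P`, `Q`. Submodularity and
  -- supermodularity of sums over sets reduce to this pointwise comparison.
  indicator-+-mono : (P? : Dec P) (Q? : Dec Q) (A? : Dec A) (B? : Dec B) →
    (P → A ⊎ B) → (Q → A ⊎ B) → (P → Q → A × B) →
    indicator P? + indicator Q? ≤ indicator A? + indicator B?
  indicator-+-mono (no _)  Q?      A? B? _ g _ =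
    ≤-respˡ (sym (+-identityˡ _)) (indicator-≤-+ Q? A? B? g)
  indicator-+-mono (yes p) (no ¬q) A? B? f _ _ =
    ≤-respˡ (sym (+-identityʳ _)) (indicator-≤-+ (yes p) A? B? f)
  indicator-+-mono (yes p) (yes q) A? B? _ _ h =
    ≤-reflexive (sym (+-cong (indicator-yes A? (proj₁ (h p q)))
      (indicator-yes B? (proj₂ (h p q)))))

  indicator-disjoint : (P? : Dec P) (Q? : Dec Q) (A? : Dec A) → (P → A) → (Q → A) → (P → ¬ Q) →
                       indicator P? + indicator Q? ≤ indicator A?
  indicator-disjoint P? Q? A? f g h = ≤-respʳ (+-identityʳ _)
    (indicator-+-mono P? Q? A? (no id) (inj₁ ∘ f) (inj₁ ∘ g) λ p q → ⊥-elim (h p q))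

  ∑ : List A → (A → Carrier) → Carrier
  ∑ []       f = 0#
  ∑ (x ∷ xs) f = f x + ∑ xs f

  ∑-cong∈ : ∀ (xs : List A) {f g} → (∀ x → x ∈ᴸ xs → f x ≈ g x) → ∑ xs f ≈ ∑ xs g
  ∑-cong∈ []       f≈g = refl
  ∑-cong∈ (x ∷ xs) f≈g = +-cong (f≈g x (here ≡.refl)) (∑-cong∈ xs λ y y∈ → f≈g y (there y∈))

  ∑-cong : ∀ (xs : List A) {f g} → (∀ x → f x ≈ g x) → ∑ xs f ≈ ∑ xs g
  ∑-cong xs f≈g = ∑-cong∈ xs λ x _ → f≈g x

  ∑-mono∈ : ∀ (xs : List A) {f g} → (∀ x → x ∈ᴸ xs → f x ≤ g x) → ∑ xs f ≤ ∑ xs g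
  ∑-mono∈ []       f≤g = ≤-refl
  ∑-mono∈ (x ∷ xs) f≤g = +-mono-≤ (f≤g x (here ≡.refl)) (∑-mono∈ xs λ y y∈ → f≤g y (there y∈))

  ∑-mono : ∀ (xs : List A) {f g} → (∀ x → f x ≤ g x) → ∑ xs f ≤ ∑ xs g
  ∑-mono xs f≤g = ∑-mono∈ xs λ x _ → f≤g x

  ∑-zero : ∀ (xs : List A) → ∑ xs (λ _ → 0#) ≈ 0#
  ∑-zero []       = refl
  ∑-zero (x ∷ xs) = trans (+-identityˡ _) (∑-zero xs)

  ∑-zero′ : ∀ (xs : List A) {f} → (∀ x → f x ≈ 0#) → ∑ xs f ≈ 0#
  ∑-zero′ xs f≈0 = trans (∑-cong xs f≈0) (∑-zero xs)

  ∑-nonneg : ∀ (xs : List A) {f} → (∀ x → 0# ≤ f x) → 0# ≤ ∑ xs f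
  ∑-nonneg xs 0≤f = ≤-respˡ (∑-zero xs) (∑-mono xs 0≤f)

  ∑-+ : ∀ (xs : List A) f g → ∑ xs (λ x → f x + g x) ≈ ∑ xs f + ∑ xs g
  ∑-+ []       f g = sym (+-identityˡ 0#)
  ∑-+ (x ∷ xs) f g = trans (+-congˡ (∑-+ xs f g))
    (solve 4 (λ a b c d → a :+ b :+ (c :+ d) := a :+ c :+ (b :+ d)) refl _ _ _ _)

  ∑-*ˡ : ∀ (xs : List A) c f → ∑ xs (λ x → c * f x) ≈ c * ∑ xs f
  ∑-*ˡ []       c f = sym (zeroʳ c)
  ∑-*ˡ (x ∷ xs) c f = trans (+-congˡ (∑-*ˡ xs c f)) (sym (distribˡ c _ _))

  ∑-*ʳ : ∀ (xs : List A) c f → ∑ xs (λ x → f x * c) ≈ ∑ xs f * c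
  ∑-*ʳ xs c f = trans (∑-cong xs λ x → *-comm _ c) (trans (∑-*ˡ xs c f) (*-comm c _))

  ∑-- : ∀ (xs : List A) f g → ∑ xs (λ x → f x - g x) ≈ ∑ xs f - ∑ xs g
  ∑-- []       f g = solve 0 (:0 := :0 :- :0) refl
  ∑-- (x ∷ xs) f g = trans (+-congˡ (∑-- xs f g))
    (solve 4 (λ a b c d → a :- b :+ (c :- d) := a :+ c :- (b :+ d)) refl _ _ _ _)

  ∑-swap : ∀ (xs : List A) (ys : List B) (f : A → B → Carrier) →
           ∑ xs (λ x → ∑ ys (f x)) ≈ ∑ ys (λ y → ∑ xs (λ x → f x y))
  ∑-swap []       ys f = sym (∑-zero ys)
  ∑-swap (x ∷ xs) ys f = trans (+-congˡ (∑-swap xs ys f)) (sym (∑-+ ys _ _))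

  ∑-++ : ∀ (xs ys : List A) f → ∑ (xs ++ ys) f ≈ ∑ xs f + ∑ ys f
  ∑-++ []       ys f = sym (+-identityˡ _)
  ∑-++ (x ∷ xs) ys f = trans (+-congˡ (∑-++ xs ys f)) (sym (+-assoc _ _ _))

  ∑-map : ∀ (g : A → B) xs f → ∑ (map g xs) f ≡ ∑ xs (f ∘ g)
  ∑-map g []       f = ≡.refl
  ∑-map g (x ∷ xs) f = ≡.cong (f (g x) +_) (∑-map g xs f)

  ∑-filter : ∀ {P : A → Set} (P? : Decidable P) xs f →
             ∑ (filter P? xs) f ≈ ∑ xs (λ x → when (P? x) (f x))
  ∑-filter P? []       f = refl
  ∑-filter P? (x ∷ xs) f with P? x
  ... | yes _ = +-congˡ (∑-filter P? xs f)
  ... | no _  = trans (∑-filter P? xs f) (sym (+-identityˡ _))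

  when-split : (P? : Dec P) → ∀ a → when P? a + when (¬? P?) a ≈ a
  when-split (yes _) a = +-identityʳ a
  when-split (no _)  a = +-identityˡ a

  ∑-filter-split : ∀ {P : A → Set} (P? : Decidable P) xs f →
                   ∑ (filter P? xs) f + ∑ (filter (¬? ∘ P?) xs) f ≈ ∑ xs f
  ∑-filter-split P? xs f = trans
    (+-cong (∑-filter P? xs f) (∑-filter (¬? ∘ P?) xs f))
    (trans (sym (∑-+ xs _ _)) (∑-cong xs λ x → when-split (P? x) (f x)))

  term≤∑∈ : ∀ {xs : List A} {f x} → x ∈ᴸ xs → (∀ y → y ∈ᴸ xs → 0# ≤ f y) → f x ≤ ∑ xs f
  term≤∑∈ {xs = _ ∷ xs} (here ≡.refl) 0≤f =
    x≤x+ (≤-respˡ (∑-zero xs) (∑-mono∈ xs λ y y∈ → 0≤f y (there y∈)))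
  term≤∑∈ {xs = x ∷ xs} (there x∈)    0≤f =
    ≤-trans (term≤∑∈ x∈ λ y y∈ → 0≤f y (there y∈)) (x≤+x (0≤f x (here ≡.refl)))

  term≤∑ : ∀ {xs : List A} {f x} → x ∈ᴸ xs → (∀ y → 0# ≤ f y) → f x ≤ ∑ xs f
  term≤∑ x∈ 0≤f = term≤∑∈ x∈ λ y _ → 0≤f y

  ∑-single : ∀ {xs : List A} {f x} → Unique xs → x ∈ᴸ xs →
             (∀ y → y ≢ x → f y ≈ 0#) → ∑ xs f ≈ f x
  ∑-single {xs = x ∷ xs} {f} (x∉ ∷ _) (here ≡.refl) off = trans
    (+-congˡ (trans (∑-cong∈ xs λ y y∈ → off y λ y≡x → All.lookup x∉ y∈ (≡.sym y≡x))
                    (∑-zero xs)))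
    (+-identityʳ _)
  ∑-single {xs = z ∷ xs} (z∉ ∷ u) (there x∈) off = trans
    (+-cong (off z (All.lookup z∉ x∈)) (∑-single u x∈ off)) (+-identityˡ _)

  open import Algebra.Properties.CommutativeMonoid.Sum +-commutativeMonoid using (sum)

  sum≡∑ : ∀ {n} (f : Fin n → Carrier) → sum f ≡ ∑ (allFin n) f
  sum≡∑ f = go f (λ i → i)
    where
    go : ∀ {m} {A : Set} (f : A → Carrier) (g : Fin m → A) → sum (f ∘ g) ≡ ∑ (tabulate g) f
    go {zero}  f g = ≡.refl
    go {suc m} f g = ≡.cong (f (g zero) +_) (go f (g ∘ suc))

  subsets : ∀ n → List (Subset n)
  subsets zero    = [] ∷ []
  subsets (suc n) = map (outside ∷_) (subsets n) ++ map (inside ∷_) (subsets n)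

  ∑-subsets≈∑ : ∀ n f → ∑-subsets n f ≈ ∑ (subsets n) f
  ∑-subsets≈∑ zero    f = sym (+-identityʳ _)
  ∑-subsets≈∑ (suc n) f = sym (trans (∑-++ (map (outside ∷_) (subsets n)) _ f)
    (+-cong (trans (reflexive (∑-map (outside ∷_) (subsets n) f)) (sym (∑-subsets≈∑ n _)))
            (trans (reflexive (∑-map (inside ∷_) (subsets n) f)) (sym (∑-subsets≈∑ n _)))))

  -- Finite types and the lemma of Farkas

  module ≈-Reasoning = Relation.Binary.Reasoning.Setoid setoid

  record Finite (A : Set) : Set where
    field
      _≟_      : DecidableEquality A
      elements : List A
      unique   : Unique elements
      ∈-elements : ∀ x → x ∈ᴸ elements

    ∑-δ : ∀ x (f : A → Carrier) → ∑ elements (λ y → when (y ≟ x) (f y)) ≈ f x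
    ∑-δ x f = trans (∑-single unique (∈-elements x) λ y y≢x → when-no (y ≟ x) y≢x _)
                    (when-yes (x ≟ x) ≡.refl _)

  open Finite using (elements; ∈-elements; ∑-δ)

  fin : ∀ n → Finite (Fin n)
  fin n = record { _≟_ = Fin._≟_ ; elements = allFin n
                 ; unique = Unique.allFin⁺ n ; ∈-elements = ∈-allFin }

  _≟ˢ_ : ∀ {n} → DecidableEquality (Subset n)
  _≟ˢ_ = Vec.≡-dec _≟ᵇ_

  subset : ∀ n → Finite (Subset n)
  subset n = record { _≟_ = _≟ˢ_ ; elements = subsets n
                    ; unique = subsets-unique n ; ∈-elements = ∈-subsets }
    where
    subsets-unique : ∀ n → Unique (subsets n)
    subsets-unique zero    = [] ∷ []
    subsets-unique (suc n) = Unique.++⁺ (Unique.map⁺ Vec.∷-injectiveʳ (subsets-unique n))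
      (Unique.map⁺ Vec.∷-injectiveʳ (subsets-unique n))
      λ (o∈ , i∈) → let _ , _ , p = ∈-map⁻ _ o∈ ; _ , _ , q = ∈-map⁻ _ i∈ in
        case Vec.∷-injectiveˡ (≡.trans (≡.sym p) q) of λ ()

    ∈-subsets : ∀ {n} (X : Subset n) → X ∈ᴸ subsets n
    ∈-subsets []            = here ≡.refl
    ∈-subsets (outside ∷ X) = ∈-++⁺ˡ (∈-map⁺ _ (∈-subsets X))
    ∈-subsets (inside ∷ X)  = ∈-++⁺ʳ _ (∈-map⁺ _ (∈-subsets X))

  _×ᶠ_ : Finite A → Finite B → Finite (A × B)
  F ×ᶠ G = record
    { _≟_      = ×.≡-dec F._≟_ G._≟_
    ; elements = cartesianProduct F.elements G.elements
    ; unique   = Unique.cartesianProduct⁺ F.unique G.unique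
    ; ∈-elements = λ (x , y) → ∈-cartesianProduct⁺ (F.∈-elements x) (G.∈-elements y)
    }
    where
    module F = Finite F
    module G = Finite G

  _⊎ᶠ_ : Finite A → Finite B → Finite (A ⊎ B)
  F ⊎ᶠ G = record
    { _≟_      = ⊎.≡-dec F._≟_ G._≟_
    ; elements = map inj₁ F.elements ++ map inj₂ G.elements
    ; unique   = Unique.++⁺ (Unique.map⁺ ⊎.inj₁-injective F.unique)
        (Unique.map⁺ ⊎.inj₂-injective G.unique)
        λ (l∈ , r∈) → let _ , _ , p = ∈-map⁻ _ l∈ ; _ , _ , q = ∈-map⁻ _ r∈ in
          case ≡.trans (≡.sym p) q of λ ()
    ; ∈-elements = λ where
        (inj₁ x) → ∈-++⁺ˡ (∈-map⁺ _ (F.∈-elements x))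
        (inj₂ y) → ∈-++⁺ʳ _ (∈-map⁺ _ (G.∈-elements y))
    }
    where
    module F = Finite F
    module G = Finite G

  ⊤ᶠ : Finite ⊤
  ⊤ᶠ = record { _≟_ = λ _ _ → yes ≡.refl ; elements = tt ∷ []
              ; unique = [] ∷ [] ; ∈-elements = λ _ → here ≡.refl }

  ∑-× : ∀ (F : Finite A) (G : Finite B) f →
        ∑ (elements (F ×ᶠ G)) f ≈ ∑ (elements F) (λ x → ∑ (elements G) (λ y → f (x , y)))
  ∑-× F G f = go (elements F)
    where
    go : ∀ xs → ∑ (cartesianProduct xs (elements G)) f ≈
                ∑ xs (λ x → ∑ (elements G) (λ y → f (x , y)))
    go []       = refl
    go (x ∷ xs) = trans (∑-++ (map (x ,_) (elements G)) _ f)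
      (+-cong (reflexive (∑-map (x ,_) (elements G) f)) (go xs))

  sum-sum≈∑ : ∀ {m n} (f : Fin m → Fin n → Carrier) →
              sum (λ u → sum (f u)) ≈ ∑ (elements (fin m ×ᶠ fin n)) (uncurry f)
  sum-sum≈∑ {m} {n} f = trans (reflexive (sum≡∑ (λ u → sum (f u))))
    (trans (∑-cong (allFin m) λ u → reflexive (sum≡∑ (f u)))
      (sym (∑-× (fin m) (fin n) (uncurry f))))

  ∑-subsets-sum≈∑ : ∀ {n} (f : Subset n → Fin n → Carrier) →
                    ∑-subsets n (λ X → sum (f X)) ≈ ∑ (elements (subset n ×ᶠ fin n)) (uncurry f)
  ∑-subsets-sum≈∑ {n} f = trans (∑-subsets≈∑ n (λ X → sum (f X)))
    (trans (∑-cong (subsets n) λ X → reflexive (sum≡∑ (f X)))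
      (sym (∑-× (subset n) (fin n) (uncurry f))))

  ∑-⊎ : ∀ (F : Finite A) (G : Finite B) f →
        ∑ (elements (F ⊎ᶠ G)) f ≈ ∑ (elements F) (f ∘ inj₁) + ∑ (elements G) (f ∘ inj₂)
  ∑-⊎ F G f = trans (∑-++ (map inj₁ (elements F)) _ f)
    (+-cong (reflexive (∑-map inj₁ (elements F) f)) (reflexive (∑-map inj₂ (elements G) f)))

  module _ (F : Finite P) where
    open ≈-Reasoning

    dot : (P → Carrier) → (P → Carrier) → Carrier
    dot x y = ∑ (elements F) λ p → x p * y p

    dot-comm : ∀ x y → dot x y ≈ dot y x
    dot-comm x y = ∑-cong (elements F) λ p → *-comm _ _

    dot-combˡ : ∀ α β x y w →
                dot (λ p → α * x p - β * y p) w ≈ α * dot x w - β * dot y w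
    dot-combˡ α β x y w = begin
      dot (λ p → α * x p - β * y p) w
        ≈⟨ ∑-cong (elements F) (λ p → solve 5 (λ α β x y w →
             (α :* x :- β :* y) :* w := α :* (x :* w) :- β :* (y :* w)) refl α β _ _ _) ⟩
      ∑ (elements F) (λ p → α * (x p * w p) - β * (y p * w p))
        ≈⟨ ∑-- (elements F) _ _ ⟩
      ∑ (elements F) (λ p → α * (x p * w p)) - ∑ (elements F) (λ p → β * (y p * w p))
        ≈⟨ +-cong (∑-*ˡ (elements F) α _) (-‿cong (∑-*ˡ (elements F) β _)) ⟩
      α * dot x w - β * dot y w ∎

    dot-combʳ : ∀ α β w x y →
                dot w (λ p → α * x p - β * y p) ≈ α * dot w x - β * dot w y
    dot-combʳ α β w x y = begin
      dot w (λ p → α * x p - β * y p)   ≈⟨ dot-comm _ _ ⟩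
      dot (λ p → α * x p - β * y p) w   ≈⟨ dot-combˡ α β x y w ⟩
      α * dot x w - β * dot y w         ≈⟨ +-cong (*-congˡ (dot-comm x w))
                                             (-‿cong (*-congˡ (dot-comm y w))) ⟩
      α * dot w x - β * dot w y         ∎

    square-positive : ∀ {x} → ¬ x ≈ 0# → Positive (x * x)
    square-positive {x} x≉0 with x ≤? 0#
    ... | no x≰0  = *-positive x≰0 x≰0
    ... | yes x≤0 = Positive-mono
      (≤-reflexive (solve 1 (λ x → (:0 :- x) :* (:0 :- x) := x :* x) refl x))
      (*-positive px px)
      where
      px : Positive (0# - x)
      px le = x≉0 (antisym x≤0 (≤-by le (solve 1 (λ x → :0 :+ :0 := x :+ (:0 :- x)) refl x)))

    InCone : List Q → (Q → P → Carrier) → (P → Carrier) → Set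
    InCone {Q} qs a c = Σ[ z ∈ (Q → Carrier) ] (∀ q → 0# ≤ z q) ×
      (∀ p → c p ≈ ∑ qs λ q → z q * a q p)

    Separated : List Q → (Q → P → Carrier) → (P → Carrier) → Set
    Separated qs a c = Σ[ w ∈ (P → Carrier) ] (∀ q → q ∈ᴸ qs → dot (a q) w ≤ 0#) ×
      Positive (dot c w)

    zero-or-not : ∀ (c : P → Carrier) → (∀ p → c p ≈ 0#) ⊎ (∃[ p ] ¬ c p ≈ 0#)
    zero-or-not c = go (elements F) λ p → inj₁ (Finite.∈-elements F p)
      where
      go : ∀ xs → (∀ p → p ∈ᴸ xs ⊎ c p ≈ 0#) → (∀ p → c p ≈ 0#) ⊎ (∃[ p ] ¬ c p ≈ 0#)
      go [] h = inj₁ λ p → [ (λ ()) , (λ e → e) ]′ (h p)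
      go (x ∷ xs) h with c x ≈? 0#
      ... | no c≉0  = inj₂ (x , c≉0)
      ... | yes c≈0 = go xs λ p →
        [ (λ { (here ≡.refl) → inj₂ c≈0 ; (there p∈) → inj₁ p∈ }) , inj₂ ]′ (h p)

    -- Bartl's induction: if w separates c from all generators but a₀, eliminate
    -- a₀ by passing to the combinations of a₀ and each vector that vanish on w.
    farkas-cone : DecidableEquality Q → ∀ {qs} → Unique qs →
      ∀ (a : Q → P → Carrier) (c : P → Carrier) →
                  InCone qs a c ⊎ Separated qs a c
    farkas-cone _≟_ [] a c with zero-or-not c
    ... | inj₁ c≈0 = inj₁ ((λ _ → 0#) , (λ _ → ≤-refl) , c≈0)
    ... | inj₂ (p , cp≉0) = inj₂
      -- Without generators, `c` restricted to a coordinate where it is nonzero separates: its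
      -- product with `c` is the square `c p * c p`.
      ( (λ p′ → when (Finite._≟_ F p′ p) (c p′)) , (λ _ ())
      , Positive-mono (≤-reflexive (sym (trans
          (∑-cong (elements F) λ p′ → sym (when-*ˡ (Finite._≟_ F p′ p) (c p′) (c p′)))
          (∑-δ F p λ p′ → c p′ * c p′))))
        (square-positive cp≉0))
    farkas-cone _≟_ {q₀ ∷ qs} (q₀∉ ∷ u) a c with farkas-cone _≟_ u a c
    ... | inj₁ (z , 0≤z , c≈) = inj₁
      -- `z` is a function on all of `Q`, so its value at the new generator has to be reset to zero.
      ( (λ q → when (¬? (q ≟ q₀)) (z q)) , (λ q → when-nonneg (¬? (q ≟ q₀)) λ _ → 0≤z q)
      , λ p → begin
          c p                          ≈⟨ c≈ p ⟩
          ∑ qs (λ q → z q * a q p)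
            ≈⟨ ∑-cong∈ qs (λ q q∈ → *-congʳ (when-yes (¬? (q ≟ q₀))
                 (λ q≡q₀ → All.lookup q₀∉ q∈ (≡.sym q≡q₀)) (z q))) ⟨
          ∑ qs (λ q → when (¬? (q ≟ q₀)) (z q) * a q p) ≈⟨ +-identityˡ _ ⟨
          0# + ∑ qs (λ q → when (¬? (q ≟ q₀)) (z q) * a q p)
            ≈⟨ +-congʳ (trans (*-congʳ (when-no (¬? (q₀ ≟ q₀)) (λ ne → ne ≡.refl) _)) (zeroˡ _)) ⟨
          _ ∎ )
    ... | inj₂ (w , w≤ , c·w>0) with dot (a q₀) w ≤? 0#
    ...   | yes a₀·w≤0 = inj₂
      (w , (λ { q (here ≡.refl) → a₀·w≤0 ; q (there q∈) → w≤ q q∈ }) , c·w>0)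
    ...   | no s>0 with farkas-cone _≟_ u
                          (λ q p → dot (a q₀) w * a q p - dot (a q) w * a q₀ p)
                          (λ p → dot (a q₀) w * c p - dot c w * a q₀ p)
    ...     | inj₂ (w′ , w′≤ , c·w′>0) = inj₂
      ( w″
      , (λ { q (here ≡.refl) → ≤-reflexive (trans (expand (a q))
               (solve 2 (λ s t → s :* t :- t :* s := :0) refl _ _))
           ; q (there q∈) → ≤-respˡ (same (a q)) (w′≤ q q∈) })
      , Positive-mono (≤-reflexive (same c)) c·w′>0 )
      where
      s = dot (a q₀) w
      -- The multiple of `w` is chosen to make `w″` orthogonal to `a q₀`.
      w″ = λ p → s * w′ p - dot (a q₀) w′ * w p

      expand : ∀ x → dot x w″ ≈ s * dot x w′ - dot (a q₀) w′ * dot x w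
      expand x = dot-combʳ s (dot (a q₀) w′) x w′ w

      same : ∀ x → dot (λ p → s * x p - dot x w * a q₀ p) w′ ≈ dot x w″
      same x = trans (dot-combˡ s (dot x w) x (a q₀) w′)
                     (trans (+-congˡ (-‿cong (*-comm _ _))) (sym (expand x)))
    ...     | inj₁ (z , 0≤z , c≈) = inj₁ (z′ , 0≤z′ , combination)
      where
      s = dot (a q₀) w
      -- Solving the eliminated combination for `c` leaves `a q₀` with the coefficient `s ⁻¹ * t`.
      -- It is nonnegative because `w` is positive on `c` and nonpositive on the generators in `qs`.
      t = dot c w - ∑ qs (λ q → z q * dot (a q) w)
      z′ : _ → Carrier
      z′ q with q ≟ q₀
      ... | yes _ = s ⁻¹ * t
      ... | no _  = z q

      0≤t : 0# ≤ t
      0≤t = 0≤y-x (≤-trans (≤-respʳ (∑-zero qs) (∑-mono∈ qs λ q q∈ →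
              ≤-respʳ (zeroʳ _) (*-monoˡ-≤ (0≤z q) (w≤ q q∈)))) (≰⇒≥ c·w>0))

      0≤z′ : ∀ q → 0# ≤ z′ q
      0≤z′ q with q ≟ q₀
      ... | yes _ = *-nonNegative (Positive⇒0≤ (⁻¹-positive s>0)) 0≤t
      ... | no _  = 0≤z q

      z′-head : z′ q₀ ≈ s ⁻¹ * t
      z′-head with q₀ ≟ q₀
      ... | yes _ = refl
      ... | no ne = ⊥-elim (ne ≡.refl)

      z′-tail : ∀ q → q ∈ᴸ qs → z′ q ≈ z q
      z′-tail q q∈ with q ≟ q₀
      ... | yes ≡.refl = ⊥-elim (All.lookup q₀∉ q∈ ≡.refl)
      ... | no _       = refl

      scaled : ∀ p → s * c p ≈ t * a q₀ p + s * ∑ qs (λ q → z q * a q p)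
      scaled p = begin
        s * c p
          ≈⟨ solve 4 (λ s c d a → s :* c := (s :* c :- d :* a) :+ d :* a) refl s (c p)
            (dot c w) (a q₀ p) ⟩
        (s * c p - dot c w * a q₀ p) + dot c w * a q₀ p
          ≈⟨ +-congʳ (c≈ p) ⟩
        ∑ qs (λ q → z q * (s * a q p - dot (a q) w * a q₀ p)) + dot c w * a q₀ p
          ≈⟨ +-congʳ (∑-cong qs λ q → solve 5 (λ z s x d y →
               z :* (s :* x :- d :* y) := s :* (z :* x) :- z :* d :* y) refl _ _ _ _ _) ⟩
        ∑ qs (λ q → s * (z q * a q p) - z q * dot (a q) w * a q₀ p) + dot c w * a q₀ p
          ≈⟨ +-congʳ (trans (∑-- qs _ _) (+-cong (∑-*ˡ qs s _) (-‿cong (∑-*ʳ qs (a q₀ p) _)))) ⟩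
        (s * ∑ qs (λ q → z q * a q p) - ∑ qs (λ q → z q * dot (a q) w) * a q₀ p) +
          dot c w * a q₀ p
          ≈⟨ solve 4 (λ S T d a → S :- T :* a :+ d :* a := (d :- T) :* a :+ S) refl _ _ _ _ ⟩
        t * a q₀ p + s * ∑ qs (λ q → z q * a q p) ∎

      combination : ∀ p → c p ≈ ∑ (q₀ ∷ qs) (λ q → z′ q * a q p)
      combination p = begin
        c p                                      ≈⟨ ⁻¹-cancelˡ (c p) s>0 ⟨
        s ⁻¹ * (s * c p)                         ≈⟨ *-congˡ (scaled p) ⟩
        s ⁻¹ * (t * a q₀ p + s * ∑ qs (λ q → z q * a q p))
          ≈⟨ trans (distribˡ _ _ _) (+-cong (sym (*-assoc _ _ _)) (⁻¹-cancelˡ _ s>0)) ⟩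
        s ⁻¹ * t * a q₀ p + ∑ qs (λ q → z q * a q p)
          ≈⟨ +-cong (*-congʳ z′-head) (∑-cong∈ qs λ q q∈ → *-congʳ (z′-tail q q∈)) ⟨
        ∑ (q₀ ∷ qs) (λ q → z′ q * a q p) ∎

  -- Linear programming duality

  ≤0⇒0≤- : ∀ {x} → - x ≤ 0# → 0# ≤ x
  ≤0⇒0≤- {x} -x≤0 = ≤-by -x≤0 (solve 1 (λ x → :0 :+ :0 := x :+ :- x) refl x)

  -- The negative unit vectors are added as generators. In a combination they act as slack, turning
  -- equality into `≤`; in a separation they force `w` to be nonnegative.
  farkas : (F : Finite P) (G : Finite Q) (M : P → Q → Carrier) (b : P → Carrier) →
    (Σ[ z ∈ (Q → Carrier) ] (∀ q → 0# ≤ z q) ×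
       (∀ p → b p ≤ ∑ (elements G) λ q → M p q * z q)) ⊎
    (Σ[ w ∈ (P → Carrier) ] (∀ p → 0# ≤ w p) ×
       (∀ q → ∑ (elements F) (λ p → w p * M p q) ≤ 0#) ×
       Positive (∑ (elements F) λ p → b p * w p))
  farkas {P} {Q} F G M b
    with farkas-cone F (Finite._≟_ (G ⊎ᶠ F)) (Finite.unique (G ⊎ᶠ F))
           [ (λ q p → M p q) , (λ i p → - indicator (Finite._≟_ F p i)) ]′ b
  ... | inj₁ (z , 0≤z , b≈) = inj₁ (z ∘ inj₁ , 0≤z ∘ inj₁ , λ p →
    ≤-respˡ (sym (trans (b≈ p) (∑-⊎ G F _)))
      (≤-respʳ (+-identityʳ _) (+-mono-≤
        (≤-reflexive (∑-cong (elements G) λ q → *-comm _ _))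
        (≤-respʳ (∑-zero (elements F)) (∑-mono (elements F) λ i →
          ≤-by (*-nonNegative (0≤z (inj₂ i)) (indicator-nonneg (Finite._≟_ F p i)))
            (solve 2 (λ z d → z :* :- d :+ z :* d := :0 :+ :0) refl (z (inj₂ i)) _))))))
  ... | inj₂ (w , w≤ , b·w>0) = inj₂
    ( w
    , (λ i → ≤0⇒0≤- (≤-respˡ (begin
        ∑ (elements F) (λ p → - indicator (Finite._≟_ F p i) * w p)
          ≈⟨ ∑-cong (elements F) (λ p → trans
               (solve 2 (λ d w → :- d :* w := (:- w) :* d) refl _ _)
               (trans (sym (when-*ˡ (Finite._≟_ F p i) (- w p) 1#))
                      (when-congʳ (Finite._≟_ F p i) λ _ → *-identityʳ _))) ⟩
        ∑ (elements F) (λ p → when (Finite._≟_ F p i) (- w p))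
          ≈⟨ ∑-δ F i (λ p → - w p) ⟩
        - w i ∎) (w≤ (inj₂ i) (∈-elements (G ⊎ᶠ F) (inj₂ i)))))
    , (λ q → ≤-respˡ (∑-cong (elements F) λ p → *-comm _ _)
               (w≤ (inj₁ q) (∈-elements (G ⊎ᶠ F) (inj₁ q))))
    , b·w>0 )
    where open ≈-Reasoning

  module LinearProgram {Row Col : Set} (F : Finite Row) (G : Finite Col)
      (A : Row → Col → Carrier) where

    Primal : (Row → Carrier) → (Col → Carrier) → Set
    Primal b x = (∀ j → 0# ≤ x j) × (∀ i → b i ≤ ∑ (elements G) λ j → A i j * x j)

    Dual : (Col → Carrier) → (Row → Carrier) → Set
    Dual c y = (∀ i → 0# ≤ y i) × (∀ j → ∑ (elements F) (λ i → y i * A i j) ≤ c j)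

    weak-duality : ∀ {b c x y} → Primal b x → Dual c y →
                   ∑ (elements F) (λ i → b i * y i) ≤ ∑ (elements G) λ j → c j * x j
    weak-duality {b} {c} {x} {y} (0≤x , b≤) (0≤y , ≤c) = ≤-trans
      (∑-mono (elements F) λ i → *-monoʳ-≤ (0≤y i) (b≤ i))
      (≤-respˡ (sym (begin
        ∑ (elements F) (λ i → ∑ (elements G) (λ j → A i j * x j) * y i)
          ≈⟨ ∑-cong (elements F) (λ i → ∑-*ʳ (elements G) (y i) _) ⟨
        ∑ (elements F) (λ i → ∑ (elements G) λ j → A i j * x j * y i)
          ≈⟨ ∑-swap (elements F) (elements G) _ ⟩
        ∑ (elements G) (λ j → ∑ (elements F) λ i → A i j * x j * y i)
          ≈⟨ ∑-cong (elements G) (λ j → trans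
               (∑-cong (elements F) λ i →
                 solve 3 (λ a x y → a :* x :* y := y :* a :* x) refl _ _ _)
               (∑-*ʳ (elements F) (x j) _)) ⟩
        ∑ (elements G) (λ j → ∑ (elements F) (λ i → y i * A i j) * x j) ∎))
        (∑-mono (elements G) λ j → *-monoʳ-≤ (0≤x j) (≤c j)))
      where open ≈-Reasoning

    -- Primal feasibility, dual feasibility and the absence of a duality gap form one
    -- system of inequalities; a Farkas certificate against it violates weak duality.
    strong-duality : ∀ {b c x₀ y₀} → Primal b x₀ → Dual c y₀ →
      Σ[ x ∈ (Col → Carrier) ] Σ[ y ∈ (Row → Carrier) ] Primal b x × Dual c y ×
        ∑ (elements G) (λ j → c j * x j) ≤ ∑ (elements F) (λ i → b i * y i)
    strong-duality {b} {c} {x₀} {y₀} px₀ dy₀ = conclude (farkas (F ⊎ᶠ (G ⊎ᶠ ⊤ᶠ)) (G ⊎ᶠ F) M q)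
      where
      open ≈-Reasoning

      M : Row ⊎ (Col ⊎ ⊤) → Col ⊎ Row → Carrier
      M (inj₁ i)        (inj₁ j) = A i j
      M (inj₁ i)        (inj₂ _) = 0#
      M (inj₂ (inj₁ j)) (inj₁ _) = 0#
      M (inj₂ (inj₁ j)) (inj₂ i) = - A i j
      M (inj₂ (inj₂ _)) (inj₁ j) = - c j
      M (inj₂ (inj₂ _)) (inj₂ i) = b i

      q : Row ⊎ (Col ⊎ ⊤) → Carrier
      q (inj₁ i)        = b i
      q (inj₂ (inj₁ j)) = - c j
      q (inj₂ (inj₂ _)) = 0#

      M·z : ∀ p (z : Col ⊎ Row → Carrier) → ∑ (elements (G ⊎ᶠ F)) (λ k → M p k * z k) ≈
            ∑ (elements G) (λ j → M p (inj₁ j) * z (inj₁ j)) +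
            ∑ (elements F) (λ i → M p (inj₂ i) * z (inj₂ i))
      M·z p z = ∑-⊎ G F _

      split : ∀ (f : Row ⊎ (Col ⊎ ⊤) → Carrier) → ∑ (elements (F ⊎ᶠ (G ⊎ᶠ ⊤ᶠ))) f ≈
              ∑ (elements F) (f ∘ inj₁) +
              (∑ (elements G) (f ∘ inj₂ ∘ inj₁) + (f (inj₂ (inj₂ tt)) + 0#))
      split f = trans (∑-⊎ F (G ⊎ᶠ ⊤ᶠ) f) (+-congˡ (∑-⊎ G ⊤ᶠ (f ∘ inj₂)))

      ∑-minus : ∀ {A : Set} (H : Finite A) (f g : A → Carrier) →
                ∑ (elements H) (λ a → - f a * g a) ≈ - ∑ (elements H) (λ a → f a * g a)
      ∑-minus H f g = begin
        ∑ (elements H) (λ a → - f a * g a)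
          ≈⟨ ∑-cong (elements H) (λ a →
            solve 2 (λ f g → :- f :* g := (:- :1) :* (f :* g)) refl (f a) (g a)) ⟩
        ∑ (elements H) (λ a → - 1# * (f a * g a)) ≈⟨ ∑-*ˡ (elements H) (- 1#) _ ⟩
        - 1# * ∑ (elements H) (λ a → f a * g a)
          ≈⟨ solve 1 (λ s → (:- :1) :* s := :- s) refl _ ⟩
        - ∑ (elements H) (λ a → f a * g a) ∎

      conclude : _ → Σ[ x ∈ (Col → Carrier) ] Σ[ y ∈ (Row → Carrier) ] Primal b x × Dual c y ×
        ∑ (elements G) (λ j → c j * x j) ≤ ∑ (elements F) (λ i → b i * y i)
      conclude (inj₁ (z , 0≤z , q≤)) =
        z ∘ inj₁ , z ∘ inj₂
        , (0≤z ∘ inj₁ , λ i → ≤-respʳ (trans (M·z (inj₁ i) z)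
            (trans (+-congˡ (∑-zero′ (elements F) λ _ → zeroˡ _)) (+-identityʳ _))) (q≤ (inj₁ i)))
        , (0≤z ∘ inj₂ , λ j → ≤-by (q≤ (inj₂ (inj₁ j)))
          (trans (+-congˡ (trans (M·z (inj₂ (inj₁ j)) z)
            (+-cong (∑-zero′ (elements G) λ _ → zeroˡ _) (∑-minus F (λ i → A i j) _))))
            (trans (+-congʳ (∑-cong (elements F) λ _ → *-comm _ _))
              (solve 2 (λ s c → s :+ (:0 :+ :- s) := c :+ :- c) refl _ (c j)))))
        , ≤-by (q≤ (inj₂ (inj₂ tt))) (trans (+-congˡ (trans (M·z (inj₂ (inj₂ tt)) z)
            (+-congʳ (∑-minus G c _)))) (solve 2 (λ s t → s :+ (:- s :+ t) := t :+ :0) refl _ _))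
      conclude (inj₂ (w , 0≤w , M≤0 , q·w>0)) = ⊥-elim (q·w>0 (≤-by b·u≤c·v
          (trans (+-congʳ (trans (split _) (+-congˡ (+-congʳ (∑-minus G c v)))))
            (solve 3 (λ L R t → L :+ (:- R :+ (:0 :* t :+ :0)) :+ R := :0 :+ L) refl _ _ t))))
        where
        u = w ∘ inj₁
        v = w ∘ inj₂ ∘ inj₁
        t = w (inj₂ (inj₂ tt))
        0≤t = 0≤w (inj₂ (inj₂ tt))

        ≤tc : ∀ j → ∑ (elements F) (λ i → u i * A i j) ≤ t * c j
        ≤tc j = ≤-by (M≤0 (inj₁ j))
          (trans (solve 2 (λ s d → s :+ :0 := d :+ (s :+ (:0 :+ (:- d :+ :0)))) refl _ (t * c j))
          (+-congˡ (sym (trans (split _) (+-congˡ (+-cong (∑-zero′ (elements G) λ _ → zeroʳ _)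
            (+-congʳ (solve 2 (λ t c → t :* :- c := :- (t :* c)) refl t (c j)))))))))

        tb≤ : ∀ i → t * b i ≤ ∑ (elements G) (λ j → A i j * v j)
        tb≤ i = ≤-by (M≤0 (inj₂ i))
          (trans (solve 2 (λ s d → d :+ :0 := s :+ (:0 :+ (:- s :+ (d :+ :0)))) refl _ (t * b i))
          (+-congˡ (sym (trans (split _) (+-cong (∑-zero′ (elements F) λ _ → zeroʳ _)
            (+-congʳ (trans (∑-cong (elements G) λ j → *-comm _ _) (∑-minus G (A i) v))))))))

        b·u≤c·v : ∑ (elements F) (λ i → b i * u i) ≤ ∑ (elements G) (λ j → c j * v j)
        b·u≤c·v with t ≤? 0#
        -- With a positive multiplier of the gap row, `v` and `u` are feasible for the data scaled
        -- by `t`, and weak duality applies to them.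
        ... | no t>0 = *-cancelˡ-≤ t>0 (≤-respˡ (scale F b u) (≤-respʳ (scale G c v)
          (weak-duality (0≤w ∘ inj₂ ∘ inj₁ , tb≤) (0≤w ∘ inj₁ , ≤tc))))
          where
          scale : ∀ {A : Set} (H : Finite A) (f g : A → Carrier) →
            ∑ (elements H) (λ a → t * f a * g a) ≈ t * ∑ (elements H) (λ a → f a * g a)
          scale H f g = trans (∑-cong (elements H) λ _ → *-assoc _ _ _) (∑-*ˡ (elements H) t _)
        -- With `t` zero, `u` and `v` are rays. Pairing them with the given feasible `x₀` and `y₀`
        -- puts `0#` between the two sides.
        ... | yes t≤0 = ≤-trans
          (≤-respʳ (∑-zero′ (elements G) λ _ → zeroˡ _)
            (weak-duality {c = λ _ → 0#} px₀ (0≤w ∘ inj₁ , λ j → ≤-respʳ (t*≈0 (c j)) (≤tc j))))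
          (≤-respˡ (∑-zero′ (elements F) λ _ → zeroˡ _)
            (weak-duality {b = λ _ → 0#}
              (0≤w ∘ inj₂ ∘ inj₁ , λ i → ≤-respˡ (t*≈0 (b i)) (tb≤ i)) dy₀))
          where
          t*≈0 : ∀ x → t * x ≈ 0#
          t*≈0 x = trans (*-congʳ (antisym t≤0 0≤t)) (zeroˡ x)

  -- Connected components and spanning trees

  open EdgeSet using (Adj; adj; Walk; vertices; IsPath; Cycle)

  Edges : ℕ → Set
  Edges n = List (Fin n × Fin n)

  -- A partition of the vertices: two vertices share a class when their labels agree. This makes
  -- connectivity decidable without a search for walks.
  Labelling : ℕ → Set
  Labelling n = Fin n → Fin n

  pairs : ∀ n → Edges n
  pairs n = elements (fin n ×ᶠ fin n)

  module _ {n : ℕ} where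

    relabel : Fin n → Fin n → Fin n → Fin n
    relabel a b c = if does (c Fin.≟ a) then b else c

    merge : Labelling n → Fin n → Fin n → Labelling n
    merge ℓ u v w = relabel (ℓ u) (ℓ v) (ℓ w)

    components : Labelling n → Edges n → Labelling n
    components ℓ []            = ℓ
    components ℓ ((u , v) ∷ L) = components (merge ℓ u v) L

    relabel-≡ : ∀ a b → relabel a b a ≡ b
    relabel-≡ a b with a Fin.≟ a
    ... | yes _ = ≡.refl
    ... | no ne = ⊥-elim (ne ≡.refl)

    relabel-target : ∀ a b → relabel a b b ≡ b
    relabel-target a b with b Fin.≟ a
    ... | yes _ = ≡.refl
    ... | no _  = ≡.refl

    merge-joins : ∀ ℓ u v → merge ℓ u v u ≡ merge ℓ u v v
    merge-joins ℓ u v = ≡.trans (relabel-≡ (ℓ u) (ℓ v)) (≡.sym (relabel-target (ℓ u) (ℓ v)))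

    components-mono : ∀ ℓ L {x y} → ℓ x ≡ ℓ y → components ℓ L x ≡ components ℓ L y
    components-mono ℓ []            e = e
    components-mono ℓ ((u , v) ∷ L) e =
      components-mono _ L (≡.cong (relabel (ℓ u) (ℓ v)) e)

    components-joins : ∀ ℓ {L u v} → (u , v) ∈ᴸ L → components ℓ L u ≡ components ℓ L v
    components-joins ℓ {L = (u , v) ∷ L} (here ≡.refl) = components-mono _ L (merge-joins ℓ u v)
    components-joins ℓ (there e∈) = components-joins _ e∈

    module _ {_~_ : Fin n → Fin n → Set} (~-equiv : IsEquivalence _~_) where
      private module ~ = IsEquivalence ~-equiv

      merge-sound : ∀ {ℓ u v} → (∀ {x y} → ℓ x ≡ ℓ y → x ~ y) → u ~ v →
                    ∀ {x y} → merge ℓ u v x ≡ merge ℓ u v y → x ~ y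
      merge-sound {ℓ} {u} {v} ℓ⇒~ u~v {x} {y} e with ℓ x Fin.≟ ℓ u | ℓ y Fin.≟ ℓ u
      ... | yes p | yes q = ℓ⇒~ (≡.trans p (≡.sym q))
      ... | yes p | no _  = ~.trans (ℓ⇒~ p) (~.trans u~v (ℓ⇒~ e))
      ... | no _  | yes q = ~.trans (ℓ⇒~ e) (~.sym (~.trans (ℓ⇒~ q) u~v))
      ... | no _  | no _  = ℓ⇒~ e

      components-sound : ∀ {ℓ} L → (∀ {x y} → ℓ x ≡ ℓ y → x ~ y) →
                         (∀ {u v} → (u , v) ∈ᴸ L → u ~ v) →
                         ∀ {x y} → components ℓ L x ≡ components ℓ L y → x ~ y
      components-sound []            ℓ⇒~ L⇒~ e = ℓ⇒~ e
      components-sound ((u , v) ∷ L) ℓ⇒~ L⇒~ e =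
        components-sound L (merge-sound ℓ⇒~ (L⇒~ (here ≡.refl))) (L⇒~ ∘ there) e

    component : Edges n → Labelling n
    component = components id

    Connected : Edges n → Fin n → Fin n → Set
    Connected L u v = component L u ≡ component L v

    Connected-equiv : ∀ L → IsEquivalence (Connected L)
    Connected-equiv L = record { refl = ≡.refl ; sym = ≡.sym ; trans = ≡.trans }

    -- The induction principle of connectivity: `Connected L` is the least equivalence relation
    -- containing the edges of `L`.
    Connected-sound : ∀ {_~_ : Fin n → Fin n → Set} → IsEquivalence _~_ → ∀ L →
                      (∀ {u v} → (u , v) ∈ᴸ L → u ~ v) → ∀ {x y} → Connected L x y → x ~ y
    Connected-sound eq L = components-sound eq L (λ e → IsEquivalence.reflexive eq e)

    Connected-∈ : ∀ {L u v} → (u , v) ∈ᴸ L → Connected L u v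
    Connected-∈ = components-joins id

    Connected-⊆ : ∀ L L′ → (∀ {u v} → (u , v) ∈ᴸ L → Connected L′ u v) →
                  ∀ {x y} → Connected L x y → Connected L′ x y
    Connected-⊆ L L′ = Connected-sound (Connected-equiv L′) L

    class-edges : Edges n → Fin n → Edges n
    class-edges L a = filter (λ (u , _) → component L u Fin.≟ a) L

    class-connected : ∀ L a {x y} → component L x ≡ a → component L y ≡ a →
                      Connected (class-edges L a) x y
    class-connected L a {x} {y} x∈ y∈ =
      -- The first component transports membership in the class; without it the conditional second
      -- one would be neither symmetric nor transitive.
      proj₂ (Connected-sound {_~_ =
        λ x y → Connected L x y × (component L x ≡ a → Connected (class-edges L a) x y)}
        record
          { refl  = ≡.refl , λ _ → ≡.refl
          ; sym   = λ (e , f) → ≡.sym e , λ p → ≡.sym (f (≡.trans e p))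
          ; trans = λ (e , f) (e′ , f′) → ≡.trans e e′ ,
                      λ p → ≡.trans (f p) (f′ (≡.trans (≡.sym e) p)) }
        L
        (λ uv∈ → Connected-∈ uv∈ , λ p →
          Connected-∈ (∈-filter⁺ (λ (u , _) → component L u Fin.≟ a) uv∈ p))
        (≡.trans x∈ (≡.sym y∈))) x∈

    walk-equiv : ∀ (K : EdgeSet n) → IsEquivalence (Walk K)
    walk-equiv K = record { refl = ε ; sym =
      reverse (λ {u} {v} → EdgeSet.sym K u v) ; trans = _◅◅_ }

    Occurs : Edges n → Fin n → Fin n → Set
    Occurs L u v = u ≢ v × ((u , v) ∈ᴸ L ⊎ (v , u) ∈ᴸ L)

    _≟²_ = Finite._≟_ (fin n ×ᶠ fin n)

    occurs? : ∀ L u v → Dec (Occurs L u v)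
    occurs? L u v = ¬? (u Fin.≟ v) ×-dec
      (Any.any? ((u , v) ≟²_) L ⊎-dec Any.any? ((v , u) ≟²_) L)

    fromEdges : Edges n → EdgeSet n
    fromEdges L = record
      { adj    = λ u v → ⌊ occurs? L u v ⌋
      ; sym    = λ u v a → fromWitness (×.map (λ ne → ne ∘ ≡.sym) ⊎.swap (toWitness a))
      ; irrefl = λ v a → proj₁ (toWitness a) ≡.refl
      }

    edges : EdgeSet n → Edges n
    edges K = filter (λ (u , v) → (u <? v) ×-dec T? (adj K u v)) (pairs n)

    ∈-edges⁻ : ∀ K {u v} → (u , v) ∈ᴸ edges K → Adj K u v
    ∈-edges⁻ K e∈ = proj₂ (proj₂
      (∈-filter⁻ (λ (u , v) → (u <? v) ×-dec T? (adj K u v)) {xs = pairs n} e∈))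

    ∈-edges⁺ : ∀ K {u v} → Adj K u v → (u , v) ∈ᴸ edges K ⊎ (v , u) ∈ᴸ edges K
    ∈-edges⁺ K {u} {v} a with Fin.<-cmp u v
    ... | tri< u<v _ _ = inj₁ (∈-filter⁺ (λ (u , v) → (u <? v) ×-dec T? (adj K u v))
                           (∈-elements (fin n ×ᶠ fin n) (u , v)) (u<v , a))
    ... | tri≈ _ ≡.refl _ = ⊥-elim (EdgeSet.irrefl K u a)
    ... | tri> _ _ v<u = inj₂ (∈-filter⁺ (λ (u , v) → (u <? v) ×-dec T? (adj K u v))
                           (∈-elements (fin n ×ᶠ fin n) (v , u)) (v<u , EdgeSet.sym K u v a))

    Connected-adj : ∀ K {u v} → Adj K u v → Connected (edges K) u v
    Connected-adj K a = [ Connected-∈ , ≡.sym ∘ Connected-∈ ]′ (∈-edges⁺ K a)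

    walk⇒Connected : ∀ K L → (∀ {u v} → Adj K u v → Connected L u v) →
                     ∀ {u v} → Walk K u v → Connected L u v
    walk⇒Connected K L h ε       = ≡.refl
    walk⇒Connected K L h (a ◅ p) = ≡.trans (h a) (walk⇒Connected K L h p)

    Connected⇒walk : ∀ L {u v} → Connected L u v → Walk (fromEdges L) u v
    Connected⇒walk L = Connected-sound (walk-equiv (fromEdges L)) L step
      where
      step : ∀ {u v} → (u , v) ∈ᴸ L → Walk (fromEdges L) u v
      step {u} {v} uv∈ with u Fin.≟ v
      ... | yes ≡.refl = ε
      ... | no u≢v     = fromWitness (u≢v , inj₁ uv∈) ◅ ε

    weight≈∑ : ∀ w K → weight w K ≈ ∑ (edges K) (uncurry w)
    weight≈∑ w K = begin
      weight w K
        ≈⟨ sum-sum≈∑ (λ u v → when ((u <? v) ×-dec T? (adj K u v)) (w u v)) ⟩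
      ∑ (pairs n) (λ (u , v) → when ((u <? v) ×-dec T? (adj K u v)) (w u v))
        ≈⟨ ∑-filter _ (pairs n) _ ⟨
      ∑ (edges K) (uncurry w) ∎
      where open ≈-Reasoning

    -- Only an inequality, because the edge set forgets loops, repetitions and orientations of the
    -- list. Symmetry of `w` matters since `weight` reads only the entries with `u < v`.
    weight-fromEdges : ∀ w L → (∀ {u v} → (u , v) ∈ᴸ L → 0# ≤ w u v × w u v ≈ w v u) →
                       weight w (fromEdges L) ≤ ∑ L (uncurry w)
    weight-fromEdges w L hyp = ≤-respˡ
      (sym (trans (weight≈∑ w (fromEdges L)) (∑-filter _ (pairs n) _)))
      (≤-trans (∑-mono (pairs n) λ (u , v) → bound u v)
        (≤-reflexive (trans (∑-swap (pairs n) L _)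
          (∑-cong L λ l → ∑-δ (fin n ×ᶠ fin n) (normal l) (λ _ → uncurry w l)))))
      where
      normal : Fin n × Fin n → Fin n × Fin n
      normal (u , v) with u <? v
      ... | yes _ = u , v
      ... | no _  = v , u

      term : ∀ {u v x} → (u , v) ∈ᴸ L → normal (u , v) ≡ x →
             w u v ≤ ∑ L (λ l → when (x ≟² normal l) (uncurry w l))
      term {u} {v} {x} uv∈ e = ≤-respˡ (when-yes (x ≟² normal (u , v)) (≡.sym e) _)
        (term≤∑∈ uv∈ λ l l∈ → when-nonneg (x ≟² normal l) λ _ → proj₁ (hyp l∈))

      normal-< : ∀ {u v} → u Fin.< v → normal (u , v) ≡ (u , v)
      normal-< {u} {v} u<v with u <? v
      ... | yes _ = ≡.refl
      ... | no ≮  = ⊥-elim (≮ u<v)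

      normal-> : ∀ {u v} → u Fin.< v → normal (v , u) ≡ (u , v)
      normal-> {u} {v} u<v with v <? u
      ... | yes v<u = ⊥-elim (Fin.<-asym u<v v<u)
      ... | no _    = ≡.refl

      bound : ∀ u v → when ((u <? v) ×-dec T? (adj (fromEdges L) u v)) (w u v) ≤
                      ∑ L (λ l → when ((u , v) ≟² normal l) (uncurry w l))
      bound u v = when-bound ((u <? v) ×-dec T? (adj (fromEdges L) u v)) ≤-edge
        (≤-respˡ (∑-zero L) (∑-mono∈ L λ l l∈ →
          when-nonneg ((u , v) ≟² normal l) λ _ → proj₁ (hyp l∈)))
        where
        ≤-edge : u Fin.< v × Adj (fromEdges L) u v → _
        ≤-edge (u<v , a) with toWitness a
        ... | _ , inj₁ uv∈ = term uv∈ (normal-< u<v)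
        ... | _ , inj₂ vu∈ = ≤-respˡ (proj₂ (hyp vu∈)) (term vu∈ (normal-> u<v))

    last∈vertices : ∀ (K : EdgeSet n) {u v} (p : Walk K u v) → v ∈ᴸ vertices K p
    last∈vertices K ε       = here ≡.refl
    last∈vertices K (_ ◅ p) = there (last∈vertices K p)

    Without : Fin n → Fin n → Fin n × Fin n → Set
    Without u v e = e ≢ (u , v) × e ≢ (v , u)

    without? : ∀ u v e → Dec (Without u v e)
    without? u v e = ¬? (e ≟² (u , v)) ×-dec ¬? (e ≟² (v , u))

    -- A path on at least three vertices does not use the edge joining its ends.
    cycle-redundant : ∀ L ((u , v , _) : Cycle (fromEdges L)) →
                      Connected (filter (without? u v) L) u v
    cycle-redundant L (u , v , ε , _ , ℕ.s≤s () , _)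
    cycle-redundant L (u , v , (_◅_ {j = x} a p) , u∉ ∷ path , 3≤ , _) =
      ≡.trans (step a (inj₂ x≢v)) (rest p (λ u∈ → All.lookup u∉ u∈ ≡.refl))
      where
      L′ = filter (without? u v) L
      K = fromEdges L

      step : ∀ {a b} → Adj K a b → (a ≢ u × b ≢ u) ⊎ b ≢ v × a ≢ v → Connected L′ a b
      step {a} {b} ab h with toWitness ab
      ... | a≢b , inj₁ ab∈ = Connected-∈ (∈-filter⁺ (without? u v) ab∈ (ok h))
        where
        ok : (a ≢ u × b ≢ u) ⊎ b ≢ v × a ≢ v → Without u v (a , b)
        ok (inj₁ (a≢u , b≢u)) = (λ { ≡.refl → a≢u ≡.refl }) , λ { ≡.refl → b≢u ≡.refl }
        ok (inj₂ (b≢v , a≢v)) = (λ { ≡.refl → b≢v ≡.refl }) , λ { ≡.refl → a≢v ≡.refl }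
      ... | a≢b , inj₂ ba∈ = ≡.sym (Connected-∈ (∈-filter⁺ (without? u v) ba∈ (ok h)))
        where
        ok : (a ≢ u × b ≢ u) ⊎ b ≢ v × a ≢ v → Without u v (b , a)
        ok (inj₁ (a≢u , b≢u)) = (λ { ≡.refl → b≢u ≡.refl }) , λ { ≡.refl → a≢u ≡.refl }
        ok (inj₂ (b≢v , a≢v)) = (λ { ≡.refl → a≢v ≡.refl }) , λ { ≡.refl → b≢v ≡.refl }

      x≢v : x ≢ v × u ≢ v
      x≢v = go p path 3≤ , λ { ≡.refl → All.lookup u∉ (last∈vertices K p) ≡.refl }
        where
        go : ∀ {x} (p : Walk K x v) → IsPath K p → 3 ℕ.≤ ℕ.suc (length (vertices K p)) → x ≢ v
        go ε       _        (ℕ.s≤s (ℕ.s≤s ())) _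
        go (_ ◅ p) (x∉ ∷ _) _ ≡.refl = All.lookup x∉ (last∈vertices K p) ≡.refl

      rest : ∀ {x} (p : Walk K x v) → u ∉ᴸ vertices K p → Connected L′ x v
      rest ε       _  = ≡.refl
      rest (_◅_ {j = y} a p) u∉ = ≡.trans
        (step a (inj₁ ((λ { ≡.refl → u∉ (here ≡.refl) }) , λ { ≡.refl → u∉ (there (first∈ p)) })))
        (rest p (u∉ ∘ there))
        where
        first∈ : ∀ {y} (p : Walk K y v) → y ∈ᴸ vertices K p
        first∈ ε       = here ≡.refl
        first∈ (_ ◅ _) = here ≡.refl

    cycle-edges-connected : ∀ L ((u , v , _) : Cycle (fromEdges L)) {a b : Fin n} → (a , b) ∈ᴸ L →
                            Connected (filter (without? u v) L) a b
    cycle-edges-connected L cyc@(u , v , _) {a} {b} ab∈ with without? u v (a , b)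
    ... | yes ok = Connected-∈ (∈-filter⁺ (without? u v) ab∈ ok)
    ... | no ¬ok with (a , b) ≟² (u , v) | (a , b) ≟² (v , u)
    ...   | yes ≡.refl | _          = cycle-redundant L cyc
    ...   | no _       | yes ≡.refl = ≡.sym (cycle-redundant L cyc)
    ...   | no p       | no q       = ⊥-elim (¬ok (p , q))

    ∑-filter≤ : ∀ {P : Fin n × Fin n → Set} (P? : ∀ e → Dec (P e)) L
      (w : Fin n × Fin n → Carrier) →
                (∀ {e} → e ∈ᴸ L → 0# ≤ w e) → ∑ (filter P? L) w ≤ ∑ L w
    ∑-filter≤ P? L w 0≤w = ≤-respˡ (sym (∑-filter P? L w))
      (∑-mono∈ L λ e e∈ → when-≤ (P? e) (0≤w e∈))

    Spans : Subset n → Edges n → Set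
    Spans W L = (∀ {u v} → (u , v) ∈ᴸ L → u ∈ W × v ∈ W) ×
                (∀ {u v} → u ∈ W → v ∈ W → Connected L u v)

    -- As long as there is a cycle, deleting its closing edge preserves all connections and shortens
    -- the list. Whether a cycle exists is not decided but assumed under the double negation.
    spanning-tree : ∀ {W r} → r ∈ W → ∀ {L} → Spans W L → (w : Fin n × Fin n → Carrier) →
                    (∀ {e} → e ∈ᴸ L → 0# ≤ w e) →
                    ¬ ¬ (∃[ L′ ] (∀ {e} → e ∈ᴸ L′ → e ∈ᴸ L) ×
                      IsTree W (fromEdges L′) × ∑ L′ w ≤ ∑ L w)
    spanning-tree {W} {r} r∈W {L} = go L (<-wellFounded (length L))
      where
      go : ∀ L → Acc ℕ._<_ (length L) → Spans W L → (w : Fin n × Fin n → Carrier) →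
           (∀ {e} → e ∈ᴸ L → 0# ≤ w e) →
           ¬ ¬ (∃[ L′ ] (∀ {e} → e ∈ᴸ L′ → e ∈ᴸ L) × IsTree W (fromEdges L′) × ∑ L′ w ≤ ∑ L w)
      go L (acc smaller) (inW , conn) w 0≤w k = ¬¬-excluded-middle λ where
        (no acyc) → k (L , id , record
          { nonempty  = r , r∈W
          ; within    = λ u v a → [ inW , swap ∘ inW ]′ (proj₂ (toWitness a))
          ; connected = λ u v u∈ v∈ → Connected⇒walk L (conn u∈ v∈)
          ; acyclic   = acyc } , ≤-refl)
        (yes cyc@(u , v , _ , _ , _ , vu)) →
          let L′ = filter (without? u v) L
              ⊆L : ∀ {e} → e ∈ᴸ L′ → e ∈ᴸ L
              ⊆L e∈ = proj₁ (∈-filter⁻ (without? u v) e∈)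
              removed : Any.Any (λ e → ¬ Without u v e) L
              removed = [ Any.map (λ { ≡.refl (_ , ne) → ne ≡.refl })
                        , Any.map (λ { ≡.refl (ne , _) → ne ≡.refl }) ]′ (proj₂ (toWitness vu))
          in go L′ (smaller (filter-notAll (without? u v) L removed))
               ( inW ∘ ⊆L , λ u∈ v∈ → Connected-⊆ L L′
                 (cycle-edges-connected L cyc) (conn u∈ v∈) )
               w (0≤w ∘ ⊆L)
               λ (L″ , L″⊆ , tree , le) → k (L″ , ⊆L ∘ L″⊆ , tree ,
                 ≤-trans le (∑-filter≤ (without? u v) L w 0≤w))

    comprehension : ∀ {P : Fin n → Set} → (∀ x → Dec (P x)) → Subset n
    comprehension P? = Vec.tabulate λ x → does (P? x)

    ∈-comprehension⁺ : ∀ {P : Fin n → Set} (P? : ∀ x → Dec (P x)) {x} → P x → x ∈ comprehension P?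
    ∈-comprehension⁺ P? {x} px =
      Vec.lookup⇒[]= x _ (≡.trans (Vec.lookup∘tabulate _ x) (dec-true (P? x) px))

    ∈-comprehension⁻ : ∀ {P : Fin n → Set} (P? : ∀ x → Dec (P x)) {x} → x ∈ comprehension P? → P x
    ∈-comprehension⁻ P? {x} x∈ with P? x | ≡.trans
      (≡.sym (Vec.lookup∘tabulate (λ x → does (P? x)) x)) (Vec.[]=⇒lookup x∈)
    ... | yes px | _  = px
    ... | no _   | ()

  -- Minima over trees and paths

  finite-minimum : ∀ (xs : List B) (P : B → Set) (f : B → Carrier) → ∀ {x} → x ∈ᴸ xs → P x →
                   ¬ ¬ (∃[ y ] P y × ∀ z → z ∈ᴸ xs → P z → f y ≤ f z)
  finite-minimum {B} xs P f {x} x∈ px k = go xs λ where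
      (inj₁ none) → none x x∈ px
      (inj₂ min)  → k min
    where
    go : ∀ xs → ¬ ¬ ((∀ z → z ∈ᴸ xs → ¬ P z) ⊎ (∃[ y ] P y × ∀ z → z ∈ᴸ xs → P z → f y ≤ f z))
    go []       k = k (inj₁ λ _ ())
    go (x ∷ xs) k = ¬¬-excluded-middle {A = P x} λ px? → go xs λ rest → k (combine px? rest)
      where
      combine : Dec (P x) → _ → _
      combine (no ¬px) (inj₁ none) = inj₁ λ { z (here ≡.refl) → ¬px ; z (there z∈) → none z z∈ }
      combine (no ¬px) (inj₂ (y , py , y≤)) = inj₂ (y , py ,
        λ { z (here ≡.refl) pz → ⊥-elim (¬px pz) ; z (there z∈) → y≤ z z∈ })
      combine (yes px) (inj₁ none) = inj₂ (x , px ,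
        λ { z (here ≡.refl) _ → ≤-refl ; z (there z∈) pz → ⊥-elim (none z z∈ pz) })
      combine (yes px) (inj₂ (y , py , y≤)) with total (f x) (f y)
      ... | inj₁ x≤y = inj₂ (x , px ,
        λ { z (here ≡.refl) _ → ≤-refl ; z (there z∈) pz → ≤-trans x≤y (y≤ z z∈ pz) })
      ... | inj₂ y≤x = inj₂ (y , py ,
        λ { z (here ≡.refl) _ → y≤x ; z (there z∈) → y≤ z z∈ })

  -- Edge sets and walks contain functions and proofs and are awkward to enumerate. It suffices that
  -- the objective factors through codes from a finite list.
  minimum-exists : ∀ {Feasible : A → Set} {objective : A → Carrier} (code : A →
    B) (codes : List B) →
    (∀ {a} → Feasible a → code a ∈ᴸ codes) → (f : B → Carrier) →
      (∀ a → objective a ≈ f (code a)) →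
    ∃ Feasible → ¬ ¬ ∃ (IsMinimum Feasible objective)
  minimum-exists {Feasible = Feasible} code codes code∈ f obj≈ (a , feas) k =
    finite-minimum codes (λ b → ∃[ a ] Feasible a × code a ≡ b) f (code∈ feas) (a , feas , ≡.refl)
      λ { (_ , (a , feas , ≡.refl) , a≤) → k (f (code a) , (a , feas , sym (obj≈ a)) ,
          λ a′ feas′ → ≤-respʳ (sym (obj≈ a′))
            (a≤ (code a′) (code∈ feas′) (a′ , feas′ , ≡.refl))) }

  ¬¬-Π : ∀ {m} {P : Fin m → Set} → (∀ i → ¬ ¬ P i) → ¬ ¬ (∀ i → P i)
  ¬¬-Π {zero}  h k = k λ ()
  ¬¬-Π {suc m} h k = h Fin.zero λ p → ¬¬-Π (h ∘ Fin.suc) λ ps →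
    k λ { Fin.zero → p ; (Fin.suc i) → ps i }

  sublists : List A → List (List A)
  sublists []       = [] ∷ []
  sublists (x ∷ xs) = map (x ∷_) (sublists xs) ++ sublists xs

  filter∈sublists : ∀ {P : A → Set} (P? : ∀ x → Dec (P x)) xs → filter P? xs ∈ᴸ sublists xs
  filter∈sublists P? []       = here ≡.refl
  filter∈sublists P? (x ∷ xs) with P? x
  ... | yes _ = ∈-++⁺ˡ (∈-map⁺ (x ∷_) (filter∈sublists P? xs))
  ... | no _  = ∈-++⁺ʳ (map (x ∷_) (sublists xs)) (filter∈sublists P? xs)

  module _ {n : ℕ} where

    weight-minimum-exists : ∀ w {Feasible : EdgeSet n → Set} → ∃ Feasible →
                            ¬ ¬ ∃ (IsMinimum Feasible (weight w))
    weight-minimum-exists w = minimum-exists edges (sublists (pairs n))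
      (λ {K} _ → filter∈sublists (λ (u , v) → (u <? v) ×-dec T? (adj K u v)) (pairs n))
      (λ L → ∑ L (uncurry w)) (weight≈∑ w)

    lists≤ : ℕ → List (List (Fin n))
    lists≤ zero    = [] ∷ []
    lists≤ (suc k) = [] ∷ cartesianProductWith _∷_ (allFin n) (lists≤ k)

    ∈-lists≤ : ∀ {k} xs → length xs ℕ.≤ k → xs ∈ᴸ lists≤ k
    ∈-lists≤ {zero}  []       _ = here ≡.refl
    ∈-lists≤ {suc k} []       _ = here ≡.refl
    ∈-lists≤ {suc k} (x ∷ xs) (ℕ.s≤s le) =
      there (∈-cartesianProductWith⁺ _∷_ (∈-allFin x) (∈-lists≤ xs le))

    Unique⇒length≤ : ∀ {xs : List (Fin n)} → Unique xs → length xs ℕ.≤ n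
    Unique⇒length≤ u = Fin.injective⇒≤ (inj u)
      where
      inj : ∀ {xs : List (Fin n)} → Unique xs → ∀ {i j} → lookup xs i ≡ lookup xs j → i ≡ j
      inj (x∉ ∷ u) {Fin.zero}  {Fin.zero}  _ = ≡.refl
      inj (x∉ ∷ u) {Fin.zero}  {Fin.suc j} e = ⊥-elim (All.lookup x∉ (∈-lookup j) e)
      inj (x∉ ∷ u) {Fin.suc i} {Fin.zero}  e = ⊥-elim (All.lookup x∉ (∈-lookup i) (≡.sym e))
      inj (x∉ ∷ u) {Fin.suc i} {Fin.suc j} e = ≡.cong Fin.suc (inj u e)

    module _ (K : EdgeSet n) where

      shortcut : ∀ {u x v} (p : Walk K x v) → IsPath K p → u ∈ᴸ vertices K p →
                 Σ[ q ∈ Walk K u v ] IsPath K q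
      shortcut ε       path       (here ≡.refl) = ε , path
      shortcut (a ◅ p) path       (here ≡.refl) = a ◅ p , path
      shortcut (a ◅ p) (_ ∷ path) (there u∈)    = shortcut p path u∈

      walk⇒path : ∀ {u v} → Walk K u v → Σ[ q ∈ Walk K u v ] IsPath K q
      walk⇒path ε = ε , All.[] ∷ []
      walk⇒path {u} (a ◅ p) with walk⇒path p
      ... | q , path with Any.any? (u Fin.≟_) (vertices K q)
      ...   | yes u∈ = shortcut q path u∈
      ...   | no u∉  = a ◅ q , All.¬Any⇒All¬ _ u∉ ∷ path

      walkEdges : ∀ {u v} → Walk K u v → Edges n
      walkEdges ε = []
      walkEdges {u} (_◅_ {j = v} _ p) = (u , v) ∷ walkEdges p

      walkEdges⊆ : ∀ {u v} (p : Walk K u v) {a b} → (a , b) ∈ᴸ walkEdges p → Adj K a b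
      walkEdges⊆ (a ◅ p) (here ≡.refl) = a
      walkEdges⊆ (_ ◅ p) (there e∈)    = walkEdges⊆ p e∈

      walkEdges-connected : ∀ {u v} (p : Walk K u v) L → (∀ {e} → e ∈ᴸ walkEdges p → e ∈ᴸ L) →
                            Connected L u v
      walkEdges-connected ε       L _  = ≡.refl
      walkEdges-connected (_ ◅ p) L ⊆L =
        ≡.trans (Connected-∈ (⊆L (here ≡.refl))) (walkEdges-connected p L (⊆L ∘ there))

      walkCost≈∑ : ∀ w {u v} (p : Walk K u v) → walkCost w K p ≈ ∑ (walkEdges p) (uncurry w)
      walkCost≈∑ w ε       = refl
      walkCost≈∑ w (_ ◅ p) = +-congˡ (walkCost≈∑ w p)

      shortest-path-exists : ∀ w {u v} → Walk K u v →
                             ¬ ¬ ∃ (IsMinimum {A = Walk K u v} (IsPath K) (walkCost w K))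
      shortest-path-exists w p = minimum-exists (vertices K) (lists≤ n)
        (λ {q} path → ∈-lists≤ (vertices K q) (Unique⇒length≤ path)) listCost
          listCost≈ (walk⇒path p)
        where
        listCost : List (Fin n) → Carrier
        listCost []           = 0#
        listCost (u ∷ [])     = 0#
        listCost (u ∷ v ∷ vs) = w u v + listCost (v ∷ vs)

        listCost≈ : ∀ {u v} (p : Walk K u v) → walkCost w K p ≈ listCost (vertices K p)
        listCost≈ ε           = refl
        listCost≈ (_ ◅ ε)     = refl
        listCost≈ (_ ◅ b ◅ p) = +-congˡ (listCost≈ (b ◅ p))

    ∑-edges-nonneg : ∀ {w} (L : Edges n) → (∀ {u v} → (u , v) ∈ᴸ L → 0# ≤ w u v) →
      0# ≤ ∑ L (uncurry w)
    ∑-edges-nonneg L 0≤w = ≤-respˡ (∑-zero L) (∑-mono∈ L λ _ → 0≤w)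

    tree-minimum≤ : ∀ {W : Subset n} {r d t w L} → IsMinimum (IsTree W) (weight d) t →
      r ∈ W → Spans W L →
      (∀ {u v} → (u , v) ∈ᴸ L → 0# ≤ w u v × w u v ≈ w v u) →
      (∀ {u v} → u ∈ W → v ∈ W → u ≢ v → d u v ≤ w u v) → t ≤ ∑ L (uncurry w)
    tree-minimum≤ {W} {d = d} {w = w} {L = L} (_ , t≤) r∈W spans w-ok d≤w = ≤-stable λ k →
      spanning-tree r∈W spans (uncurry w) (proj₁ ∘ w-ok)
        λ (L′ , L′⊆L , tree , le) → let K = fromEdges L′ in
          k (≤-trans (t≤ K tree) (≤-trans
            (≤-respˡ (sym (weight≈∑ d K)) (≤-respʳ (sym (weight≈∑ w K)) (∑-mono∈ (edges K)
              λ (u , v) e∈ → let a = ∈-edges⁻ K e∈ ; u∈ , v∈ = IsTree.within tree u v a in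
                d≤w u∈ v∈ λ { ≡.refl → EdgeSet.irrefl K u a })))
            (≤-trans (weight-fromEdges w L′ (w-ok ∘ L′⊆L)) le)))

    tree-exists : ∀ {W : Subset n} {r} → r ∈ W → ¬ ¬ ∃ (IsTree W)
    tree-exists {W} r∈W k =
      spanning-tree r∈W {filter within? (pairs n)}
        ( (λ e∈ → proj₂ (∈-filter⁻ within? {xs = pairs n} e∈))
        , λ {u} {v} u∈ v∈ → Connected-∈ (∈-filter⁺ within?
            (∈-elements (fin n ×ᶠ fin n) (u , v)) (u∈ , v∈)) )
        (λ _ → 0#) (λ _ → ≤-refl)
        λ (L′ , _ , tree , _) → k (fromEdges L′ , tree)
      where
      within? : ∀ ((u , v) : Fin n × Fin n) → Dec (u ∈ W × v ∈ W)
      within? (u , v) = (u ∈? W) ×-dec (v ∈? W)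

  -- Optimal Steiner trees, connection costs and terminal distances

  module _ (I : Instance) where
    open Instance I

    c-nonneg : ∀ {u v} → Adj E u v → 0# ≤ c u v
    c-nonneg {u} {v} a = proj₁ (c-pos u v a)

    E-edges : Edges n → Set
    E-edges L = ∀ {u v} → (u , v) ∈ᴸ L → Adj E u v

    JoinedBy : Edges n → Subset n → Set
    JoinedBy L X = ∀ {u v} → u ∈ X → v ∈ X → Connected L u v

    private
      cost-ok : ∀ {L} → E-edges L → ∀ {u v} → (u , v) ∈ᴸ L → 0# ≤ c u v × c u v ≈ c v u
      cost-ok L⊆E uv∈ = c-nonneg (L⊆E uv∈) , c-sym _ _ (L⊆E uv∈)

    fromEdges⊆E : ∀ {L} → E-edges L → fromEdges L ⊆ᴱ E
    fromEdges⊆E L⊆E u v a = [ L⊆E , EdgeSet.sym E v u ∘ L⊆E ]′ (proj₂ (toWitness a))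

    -- A list that merely connects the terminals becomes a Steiner tree by discarding the edges
    -- outside their common component and then pruning cycles, neither of which adds cost.
    IsOPT⇒≤ : ∀ {o L} → IsOPT I o → E-edges L → JoinedBy L R → o ≤ ∑ L (uncurry c)
    IsOPT⇒≤ {o} {L} (_ , o≤) L⊆E joined = ≤-stable λ k →
      spanning-tree {W = W} (∈W ≡.refl) {class-edges L a} ((λ e∈ → ends e∈) , λ u∈ v∈ →
          class-connected L a (W∈ u∈) (W∈ v∈)) (uncurry c)
        (λ e∈ → c-nonneg (L⊆E (⊆L e∈)))
        λ (L′ , L′⊆ , tree , le) → k (≤-trans
          (o≤ (fromEdges L′) (fromEdges⊆E (L⊆E ∘ ⊆L ∘ L′⊆) , W ,
            (λ {_} x∈R → ∈W (joined x∈R r∈R)) , tree))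
          (≤-trans (weight-fromEdges c L′ (cost-ok (L⊆E ∘ ⊆L ∘ L′⊆)))
            (≤-trans le (∑-filter≤ (λ (u , _) → component L u Fin.≟ a) L (uncurry c)
              (c-nonneg ∘ L⊆E)))))
      where
      r = proj₁ R-nonempty
      r∈R = proj₂ R-nonempty
      a = component L r

      W : Subset n
      W = comprehension λ x → component L x Fin.≟ a

      ∈W : ∀ {x} → component L x ≡ a → x ∈ W
      ∈W = ∈-comprehension⁺ λ x → component L x Fin.≟ a

      W∈ : ∀ {x} → x ∈ W → component L x ≡ a
      W∈ = ∈-comprehension⁻ λ x → component L x Fin.≟ a

      ⊆L : ∀ {e} → e ∈ᴸ class-edges L a → e ∈ᴸ L
      ⊆L e∈ = proj₁ (∈-filter⁻ (λ (u , _) → component L u Fin.≟ a) e∈)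

      ends : ∀ {u v} → (u , v) ∈ᴸ class-edges L a → u ∈ W × v ∈ W
      ends e∈ with ∈-filter⁻ (λ (u , _) → component L u Fin.≟ a) {xs = L} e∈
      ... | uv∈L , u∈ = ∈W u∈ , ∈W (≡.trans (≡.sym (Connected-∈ uv∈L)) u∈)

    IsConnectionCost⇒≤ : ∀ {X k L} → IsConnectionCost I X k → E-edges L → JoinedBy L X →
      k ≤ ∑ L (uncurry c)
    IsConnectionCost⇒≤ {L = L} (_ , k≤) L⊆E joined = ≤-trans
      (k≤ (fromEdges L) (fromEdges⊆E L⊆E , λ u v u∈ v∈ → Connected⇒walk L (joined u∈ v∈)))
      (weight-fromEdges c L (cost-ok L⊆E))

    IsConnectionCost⇒edges : ∀ {X k} → IsConnectionCost I X k →
      ∃[ L ] E-edges L × JoinedBy L X × k ≈ ∑ L (uncurry c)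
    IsConnectionCost⇒edges ((K , (K⊆E , joined) , k≈) , _) =
      edges K , (λ e∈ → K⊆E _ _ (∈-edges⁻ K e∈))
      , (λ u∈ v∈ → walk⇒Connected K (edges K) (Connected-adj K) (joined _ _ u∈ v∈))
      , trans k≈ (weight≈∑ c K)

    IsConnectionCost⇒nonneg : ∀ {X k} → IsConnectionCost I X k → 0# ≤ k
    IsConnectionCost⇒nonneg cc with IsConnectionCost⇒edges cc
    ... | L , L⊆E , _ , k≈ = ≤-respʳ (sym k≈) (∑-edges-nonneg L (c-nonneg ∘ L⊆E))

    IsConnectionCost-exists : ∀ X → ¬ ¬ ∃ (IsConnectionCost I X)
    IsConnectionCost-exists X =
      weight-minimum-exists c (E , (λ _ _ a → a) , λ u v _ _ → connected u v)

    IsOPT-exists : ¬ ¬ ∃ (IsOPT I)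
    IsOPT-exists k =
      spanning-tree {W = Subset.⊤} {r} ∈⊤ {edges E} ((λ _ → ∈⊤ , ∈⊤) , λ {u} {v} _ _ →
          walk⇒Connected E (edges E) (Connected-adj E) (connected u v))
        (λ _ → 0#) (λ _ → ≤-refl)
        λ (L′ , L′⊆ , tree , _) → weight-minimum-exists c
          (fromEdges L′ , fromEdges⊆E (∈-edges⁻ E ∘ L′⊆) , Subset.⊤ , (λ {_} _ → ∈⊤) , tree) k
      where
      open import Data.Fin.Subset.Properties using (∈⊤)
      r = proj₁ R-nonempty

    Distances : (Fin n → Fin n → Carrier) → Set
    Distances d = ∀ u v → u ∈ R → v ∈ R → IsDistance I u v (d u v)

    InR : Edges n → Set
    InR L = ∀ {u v} → (u , v) ∈ᴸ L → u ∈ R × v ∈ R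

    distance-nonneg : ∀ {u v δ} → IsDistance I u v δ → 0# ≤ δ
    distance-nonneg ((p , _ , δ≈) , _) = ≤-respʳ (sym (trans δ≈ (walkCost≈∑ E c p)))
      (∑-edges-nonneg (walkEdges E p) (c-nonneg ∘ walkEdges⊆ E p))

    distance≤edge : ∀ {u v δ} → IsDistance I u v δ → Adj E u v → δ ≤ c u v
    distance≤edge {u} {v} (_ , δ≤) a = ≤-respʳ (+-identityʳ _)
      (δ≤ (a ◅ ε) (((λ { ≡.refl → EdgeSet.irrefl E u a }) All.∷ All.[]) ∷ All.[] ∷ []))

    -- Every terminal edge is replaced by a shortest path. Since `M` is a list, edges shared by
    -- several paths are repeated and the costs agree exactly.
    expand : ∀ {d} → Distances d → ∀ L → InR L →
             ∃[ M ] E-edges M × (∀ {u v} → (u , v) ∈ᴸ L → Connected M u v) ×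
               ∑ M (uncurry c) ≈ ∑ L (uncurry d)
    expand dist []            _   = [] , (λ ()) , (λ ()) , refl
    expand dist ((u , v) ∷ L) inR
      with expand dist L (inR ∘ there) | uncurry (dist u v) (inR (here ≡.refl))
    ... | M , M⊆E , L⇒M , M≈ | (p , _ , δ≈) , _ =
      walkEdges E p ++ M
      , (λ e∈ → [ walkEdges⊆ E p , M⊆E ]′ (∈-++⁻ (walkEdges E p) e∈))
      , (λ { (here ≡.refl) → walkEdges-connected E p _ ∈-++⁺ˡ
           ; (there e∈)    → Connected-⊆ M (walkEdges E p ++ M)
             (Connected-∈ ∘ ∈-++⁺ʳ (walkEdges E p)) (L⇒M e∈) })
      , trans (∑-++ (walkEdges E p) M _) (+-cong (sym (trans δ≈ (walkCost≈∑ E c p))) M≈)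

    tree⇒edges : ∀ {T} → IsTree R T → InR (edges T) × JoinedBy (edges T) R
    tree⇒edges {T} tree =
      (λ e∈ → IsTree.within tree _ _ (∈-edges⁻ T e∈)) ,
      λ u∈ v∈ → walk⇒Connected T (edges T) (Connected-adj T) (IsTree.connected tree _ _ u∈ v∈)

    OPT≤TMST : ∀ {o t} → IsOPT I o → IsTMST I t → o ≤ t
    OPT≤TMST opt (d , dist , (T , tree , t≈) , _) with expand dist (edges T)
      (proj₁ (tree⇒edges tree))
    ... | M , M⊆E , T⇒M , M≈ = ≤-respʳ (trans M≈ (sym (trans t≈ (weight≈∑ d T))))
      (IsOPT⇒≤ opt M⊆E λ u∈ v∈ → Connected-⊆ (edges T) M T⇒M (proj₂ (tree⇒edges tree) u∈ v∈))

    IsTMST-exists : ¬ ¬ ∃ (IsTMST I)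
    IsTMST-exists k = ¬¬-Π (λ u → ¬¬-Π λ v → shortest-path-exists E c (connected u v)) λ dist →
      tree-exists (proj₂ R-nonempty) λ tree →
        weight-minimum-exists (λ u v → proj₁ (dist u v)) tree
          λ (t , min) → k (t , (λ u v → proj₁ (dist u v)) , (λ u v _ _ → proj₂ (dist u v)) , min)

  -- Kruskal's algorithm

  ∑-↭ : ∀ {xs ys : List A} (f : A → Carrier) → xs ↭ ys → ∑ xs f ≈ ∑ ys f
  ∑-↭ f ↭.refl          = refl
  ∑-↭ f (↭.prep x p)    = +-congˡ (∑-↭ f p)
  ∑-↭ f (↭.swap x y p)  = trans (+-congˡ (+-congˡ (∑-↭ f p)))
    (solve 3 (λ a b s → a :+ (b :+ s) := b :+ (a :+ s)) refl (f x) (f y) _)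
  ∑-↭ f (↭.trans p q)   = trans (∑-↭ f p) (∑-↭ f q)

  sort-by : ∀ (f : A → Carrier) xs → ∃[ ys ] ys ↭ xs × AllPairs (λ x y → f x ≤ f y) ys
  sort-by f xs = sort xs , sort-↭ xs , Sorted.Sorted⇒AllPairs
    (DecTotalOrder.totalOrder order) (sort-↗ xs)
    where
    order : DecTotalOrder _ _ _
    order = On.decTotalOrder (record { isDecTotalOrder = isDecTotalOrder }) f
    open Data.List.Sort order

  module _ {n : ℕ} where

    Meets : Subset n → Subset n → Set
    Meets X S = Nonempty (X ∩ S)

    meets? : ∀ X S → Dec (Meets X S)
    meets? X S = nonempty? (X ∩ S)

    meets : ∀ {X S x} → x ∈ X → x ∈ S → Meets X S
    meets x∈X x∈S = _ , x∈p∩q⁺ (x∈X , x∈S)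

    meets⁻ : ∀ X S → Meets X S → ∃[ x ] x ∈ X × x ∈ S
    meets⁻ X S (x , x∈) = x , x∈p∩q⁻ X S x∈

    class : Labelling n → Fin n → Subset n
    class ℓ a = comprehension λ x → ℓ x Fin.≟ a

    ∈-class⁺ : ∀ ℓ {a x} → ℓ x ≡ a → x ∈ class ℓ a
    ∈-class⁺ ℓ {a} = ∈-comprehension⁺ λ x → ℓ x Fin.≟ a

    ∈-class⁻ : ∀ ℓ {a x} → x ∈ class ℓ a → ℓ x ≡ a
    ∈-class⁻ ℓ {a} = ∈-comprehension⁻ λ x → ℓ x Fin.≟ a

    class-∅ : ∀ {ℓ a} → (∀ x → ℓ x ≢ a) → class ℓ a ≡ ⊥
    class-∅ {ℓ} none = Empty-unique λ (x , x∈) → none x (∈-class⁻ ℓ x∈)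

    relabel-≢ : ∀ (a b : Fin n) {c} → c ≢ a → relabel a b c ≡ c
    relabel-≢ a b {c} c≢a with c Fin.≟ a
    ... | yes e = ⊥-elim (c≢a e)
    ... | no _  = ≡.refl

    relabel-same : ∀ (a c : Fin n) → relabel a a c ≡ c
    relabel-same a c with c Fin.≟ a
    ... | yes e = ≡.sym e
    ... | no _  = ≡.refl

    relabel≡target : ∀ {a b : Fin n} c → relabel a b c ≡ b → c ≡ a ⊎ c ≡ b
    relabel≡target {a} c e with c Fin.≟ a
    ... | yes p = inj₁ p
    ... | no _  = inj₂ e

    relabel≢source : ∀ {a b : Fin n} c → a ≢ b → relabel a b c ≢ a
    relabel≢source {a} c a≢b e with c Fin.≟ a
    ... | yes _  = a≢b (≡.sym e)
    ... | no c≢a = c≢a e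

    relabel≡other : ∀ {a b d : Fin n} c → d ≢ a → d ≢ b → relabel a b c ≡ d → c ≡ d
    relabel≡other {a} c d≢a d≢b e with c Fin.≟ a
    ... | yes _ = ⊥-elim (d≢b (≡.sym e))
    ... | no _  = e

    class-merge-source : ∀ ℓ u v → ℓ u ≢ ℓ v → class (merge ℓ u v) (ℓ u) ≡ ⊥
    class-merge-source ℓ u v ne = class-∅ {merge ℓ u v} λ x → relabel≢source (ℓ x) ne

    class-merge-target : ∀ ℓ u v → class (merge ℓ u v) (ℓ v) ≡ class ℓ (ℓ u) ∪ class ℓ (ℓ v)
    class-merge-target ℓ u v = ⊆-antisym
      (λ {x} x∈ → x∈p∪q⁺ ([ inj₁ ∘ ∈-class⁺ ℓ , inj₂ ∘ ∈-class⁺ ℓ ]′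
        (relabel≡target (ℓ x) (∈-class⁻ (merge ℓ u v) x∈))))
      (λ {x} x∈ → ∈-class⁺ (merge ℓ u v)
        ([ (λ x∈u → ≡.trans (≡.cong (relabel (ℓ u) (ℓ v)) (∈-class⁻ ℓ x∈u))
        (relabel-≡ (ℓ u) (ℓ v)))
        , (λ x∈v → ≡.trans (≡.cong (relabel (ℓ u) (ℓ v)) (∈-class⁻ ℓ x∈v))
          (relabel-target (ℓ u) (ℓ v))) ]′ (x∈p∪q⁻ _ _ x∈)))

    class-merge-other : ∀ ℓ u v {a} → a ≢ ℓ u → a ≢ ℓ v → class (merge ℓ u v) a ≡ class ℓ a
    class-merge-other ℓ u v {a} a≢u a≢v = ⊆-antisym
      (λ {x} x∈ → ∈-class⁺ ℓ (relabel≡other (ℓ x) a≢u a≢v (∈-class⁻ (merge ℓ u v) x∈)))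
      (λ {x} x∈ → ∈-class⁺ (merge ℓ u v)
        (≡.trans (≡.cong (relabel (ℓ u) (ℓ v)) (∈-class⁻ ℓ x∈)) (relabel-≢ (ℓ u) (ℓ v) a≢u)))

    -- A label that no vertex carries contributes `φ ⊥`, hence the condition `φ ⊥ ≈ 0#` when merging
    -- abandons a label.
    ∑-classes : Labelling n → (Subset n → Carrier) → Carrier
    ∑-classes ℓ φ = ∑ (allFin n) λ a → φ (class ℓ a)

    ∑-classes-cong : ∀ {ℓ ℓ′} φ → (∀ x → ℓ x ≡ ℓ′ x) → ∑-classes ℓ φ ≈ ∑-classes ℓ′ φ
    ∑-classes-cong {ℓ} {ℓ′} φ eq = ∑-cong (allFin n) λ a → reflexive (≡.cong φ (⊆-antisym
      (λ {x} x∈ → ∈-class⁺ ℓ′ (≡.trans (≡.sym (eq x)) (∈-class⁻ ℓ x∈)))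
      (λ {x} x∈ → ∈-class⁺ ℓ (≡.trans (eq x) (∈-class⁻ ℓ′ x∈)))))

    ∑-classes-merge : ∀ ℓ u v (φ : Subset n → Carrier) → φ ⊥ ≈ 0# → ℓ u ≢ ℓ v →
      ∑-classes (merge ℓ u v) φ + (φ (class ℓ (ℓ u)) + φ (class ℓ (ℓ v))) ≈
      ∑-classes ℓ φ + φ (class ℓ (ℓ u) ∪ class ℓ (ℓ v))
    ∑-classes-merge ℓ u v φ φ⊥≈0 ne = begin
      ∑-classes ℓ′ φ + (φ (class ℓ a) + φ (class ℓ b))
        ≈⟨ +-congˡ (+-cong (∑-δ (fin n) a (λ _ → φ (class ℓ a)))
          (∑-δ (fin n) b (λ _ → φ (class ℓ b)))) ⟨
      ∑-classes ℓ′ φ + (∑ (allFin n) (λ c → when (c Fin.≟ a) (φ (class ℓ a))) +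
        ∑ (allFin n) (λ c → when (c Fin.≟ b) (φ (class ℓ b))))
        ≈⟨ trans (∑-+ (allFin n) _ _) (+-congˡ (∑-+ (allFin n) _ _)) ⟨
      ∑ (allFin n) (λ c → φ (class ℓ′ c) +
        (when (c Fin.≟ a) (φ (class ℓ a)) + when (c Fin.≟ b) (φ (class ℓ b))))
        ≈⟨ ∑-cong (allFin n) pointwise ⟩
      ∑ (allFin n) (λ c → φ (class ℓ c) + when (c Fin.≟ b) (φ (class ℓ a ∪ class ℓ b)))
        ≈⟨ trans (∑-+ (allFin n) _ _) (+-congˡ (∑-δ (fin n) b λ _ → φ (class ℓ a ∪ class ℓ b))) ⟩
      ∑-classes ℓ φ + φ (class ℓ a ∪ class ℓ b) ∎
      where
      open ≈-Reasoning
      ℓ′ = merge ℓ u v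
      a = ℓ u
      b = ℓ v

      pointwise : ∀ c → φ (class ℓ′ c) +
        (when (c Fin.≟ a) (φ (class ℓ a)) + when (c Fin.≟ b) (φ (class ℓ b))) ≈
                        φ (class ℓ c) + when (c Fin.≟ b) (φ (class ℓ a ∪ class ℓ b))
      pointwise c with c Fin.≟ a | c Fin.≟ b
      ... | yes ≡.refl | yes c≡b = ⊥-elim (ne c≡b)
      ... | yes ≡.refl | no _ =
        trans (+-congʳ (trans (reflexive (≡.cong φ (class-merge-source ℓ u v ne))) φ⊥≈0))
        (solve 1 (λ x → :0 :+ (x :+ :0) := x :+ :0) refl _)
      ... | no _ | yes ≡.refl = trans (+-congʳ (reflexive (≡.cong φ (class-merge-target ℓ u v))))
        (solve 2 (λ x y → x :+ (:0 :+ y) := y :+ x) refl _ _)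
      ... | no c≢a | no c≢b = trans
        (+-congʳ (reflexive (≡.cong φ (class-merge-other ℓ u v c≢a c≢b))))
        (solve 1 (λ x → x :+ (:0 :+ :0) := x :+ :0) refl _)

    -- For nonempty `X`, subtracting `1#` gives the rank of `X` over the partition: the number of
    -- merges that unite all the classes it meets.
    touched : Labelling n → Subset n → Carrier
    touched ℓ X = ∑-classes ℓ λ S → indicator (meets? X S)

    MeetsEnds : Labelling n → Fin n → Fin n → Subset n → Set
    MeetsEnds ℓ u v X = Meets X (class ℓ (ℓ u)) × Meets X (class ℓ (ℓ v))

    meetsEnds? : ∀ ℓ u v X → Dec (MeetsEnds ℓ u v X)
    meetsEnds? ℓ u v X = meets? X (class ℓ (ℓ u)) ×-dec meets? X (class ℓ (ℓ v))

    joins? : ∀ (ℓ : Labelling n) u v X → Dec (ℓ u ≢ ℓ v × MeetsEnds ℓ u v X)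
    joins? ℓ u v X = ¬? (ℓ u Fin.≟ ℓ v) ×-dec meetsEnds? ℓ u v X

    abstract
      drop : Labelling n → Fin n → Fin n → Subset n → Carrier
      drop ℓ u v X = indicator (joins? ℓ u v X)

      drop-yes : ∀ ℓ u v X → ℓ u ≢ ℓ v × MeetsEnds ℓ u v X → drop ℓ u v X ≈ 1#
      drop-yes ℓ u v X p = indicator-yes (joins? ℓ u v X) p

      drop-no : ∀ ℓ u v X → ¬ (ℓ u ≢ ℓ v × MeetsEnds ℓ u v X) → drop ℓ u v X ≈ 0#
      drop-no ℓ u v X ¬p = indicator-no (joins? ℓ u v X) ¬p

      drop-nonneg : ∀ ℓ u v X → 0# ≤ drop ℓ u v X
      drop-nonneg ℓ u v X = indicator-nonneg (joins? ℓ u v X)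

      drop≤1 : ∀ ℓ u v X → drop ℓ u v X ≤ 1#
      drop≤1 ℓ u v X = indicator≤1 (joins? ℓ u v X)

    merge-same : ∀ (ℓ : Labelling n) u v → ℓ u ≡ ℓ v → ∀ x → ℓ x ≡ merge ℓ u v x
    merge-same ℓ u v e x = ≡.sym
      (≡.trans (≡.cong (λ b → relabel (ℓ u) b (ℓ x)) (≡.sym e)) (relabel-same (ℓ u) (ℓ x)))

    -- Only the classes of `u` and `v` change, and inclusion-exclusion on them leaves the indicator
    -- that `X` meets both.
    touched-merge : ∀ ℓ u v X → touched ℓ X ≈ touched (merge ℓ u v) X + drop ℓ u v X
    touched-merge ℓ u v X with ℓ u Fin.≟ ℓ v
    ... | yes e = trans (∑-classes-cong (λ S → indicator (meets? X S)) (merge-same ℓ u v e))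
      (sym (trans (+-congˡ (drop-no ℓ u v X λ (ne , _) → ne e)) (+-identityʳ _)))
    ... | no ne = begin
      touched ℓ X
        ≈⟨ solve 2 (λ t m → t := t :+ m :- m) refl _ _ ⟩
      touched ℓ X + μ (class ℓ a ∪ class ℓ b) - μ (class ℓ a ∪ class ℓ b)
        ≈⟨ +-congʳ (∑-classes-merge ℓ u v μ
          (indicator-no (meets? X ⊥) (λ m → ∉⊥ (proj₂ (proj₂ (meets⁻ X ⊥ m))))) ne) ⟨
      touched ℓ′ X + (μ (class ℓ a) + μ (class ℓ b)) - μ (class ℓ a ∪ class ℓ b)
        ≈⟨ +-congʳ (+-congˡ (inclusion-exclusion (class ℓ a) (class ℓ b))) ⟩
      touched ℓ′ X + (μ (class ℓ a ∪ class ℓ b) + indicator (meetsEnds? ℓ u v X)) - μ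
        (class ℓ a ∪ class ℓ b)
        ≈⟨ solve 3 (λ t m d → t :+ (m :+ d) :- m := t :+ d) refl _ _ _ ⟩
      touched ℓ′ X + indicator (meetsEnds? ℓ u v X)
        ≈⟨ +-congˡ drop≈ ⟩
      touched ℓ′ X + drop ℓ u v X ∎
      where
      open ≈-Reasoning
      ℓ′ = merge ℓ u v
      a = ℓ u
      b = ℓ v
      μ = λ S → indicator (meets? X S)

      drop≈ : indicator (meetsEnds? ℓ u v X) ≈ drop ℓ u v X
      drop≈ = case meetsEnds? ℓ u v X of λ where
        (yes m) → trans (indicator-yes (meetsEnds? ℓ u v X) m) (sym (drop-yes ℓ u v X (ne , m)))
        (no ¬m) → trans (indicator-no (meetsEnds? ℓ u v X) ¬m)
          (sym (drop-no ℓ u v X (¬m ∘ proj₂)))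

      inclusion-exclusion : ∀ S T → μ S + μ T ≈ μ (S ∪ T) +
        indicator (meets? X S ×-dec meets? X T)
      inclusion-exclusion S T with meets? X S | meets? X T
      ... | yes s | yes _ = +-congʳ
        (sym (indicator-yes (meets? X (S ∪ T))
        (let _ , x∈X , x∈S = meets⁻ X S s in meets x∈X (x∈p∪q⁺ (inj₁ x∈S)))))
      ... | yes s | no _  = +-congʳ
        (sym (indicator-yes (meets? X (S ∪ T))
        (let _ , x∈X , x∈S = meets⁻ X S s in meets x∈X (x∈p∪q⁺ (inj₁ x∈S)))))
      ... | no _  | yes t = trans (+-comm _ _)
        (+-congʳ (sym (indicator-yes (meets? X (S ∪ T))
        (let _ , x∈X , x∈T = meets⁻ X T t in meets x∈X (x∈p∪q⁺ (inj₂ x∈T))))))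
      ... | no ¬s | no ¬t = +-congʳ
        (sym (indicator-no (meets? X (S ∪ T)) (λ m → let _ , x∈X , x∈ = meets⁻ X (S ∪ T) m in
              [ ¬s ∘ meets x∈X , ¬t ∘ meets x∈X ]′ (x∈p∪q⁻ S T x∈))))

    touched-constant : ∀ ℓ {X x} → x ∈ X → (∀ {y} → y ∈ X → ℓ y ≡ ℓ x) → touched ℓ X ≈ 1#
    touched-constant ℓ {X} {x} x∈ const = trans
      (∑-single {x = ℓ x} (Finite.unique (fin n)) (∈-elements (fin n) (ℓ x)) λ a a≢ →
        indicator-no (meets? X (class ℓ a)) (λ m → let y , y∈X , y∈a = meets⁻ X (class ℓ a) m in
          a≢ (≡.trans (≡.sym (∈-class⁻ ℓ y∈a)) (const y∈X))))
      (indicator-yes (meets? X (class ℓ (ℓ x))) (meets x∈ (∈-class⁺ ℓ ≡.refl)))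

    -- When the edges of L are processed in order, gain counts the edges that X makes
    -- superfluous: both of the components that such an edge would join meet X.
    module Kruskal (w : Fin n → Fin n → Carrier) (R : Subset n) where

      gain : Labelling n → Edges n → Subset n → Carrier
      gain ℓ []            X = 0#
      gain ℓ ((u , v) ∷ L) X = w u v * drop ℓ u v X + gain (merge ℓ u v) L X

      kept : Labelling n → Edges n → Subset n → Edges n
      kept ℓ []            X = []
      kept ℓ ((u , v) ∷ L) X with ℓ u Fin.≟ ℓ v | meetsEnds? ℓ u v X
      ... | no _ | no _ = (u , v) ∷ kept (merge ℓ u v) L X
      ... | _    | _    = kept (merge ℓ u v) L X

      kept⊆ : ∀ ℓ L X {e} → e ∈ᴸ kept ℓ L X → e ∈ᴸ L
      kept⊆ ℓ ((u , v) ∷ L) X e∈ with ℓ u Fin.≟ ℓ v | meetsEnds? ℓ u v X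
      kept⊆ ℓ ((u , v) ∷ L) X (here e≡)  | no _  | no _  = here e≡
      kept⊆ ℓ ((u , v) ∷ L) X (there e∈) | no _  | no _  = there (kept⊆ _ L X e∈)
      kept⊆ ℓ ((u , v) ∷ L) X e∈         | no _  | yes _ = there (kept⊆ _ L X e∈)
      kept⊆ ℓ ((u , v) ∷ L) X e∈         | yes _ | no _  = there (kept⊆ _ L X e∈)
      kept⊆ ℓ ((u , v) ∷ L) X e∈         | yes _ | yes _ = there (kept⊆ _ L X e∈)

      -- The classes are merged at discarded edges too. This is justified because such an edge lies
      -- within a class or joins two classes that both meet `X`, which `X` as a hyperedge connects.
      kept-sound : ∀ {_~_ : Fin n → Fin n → Set} → IsEquivalence _~_ → ∀ {ℓ} L X →
        (∀ {x y} → ℓ x ≡ ℓ y → x ~ y) → (∀ {x y} → x ∈ X → y ∈ X → x ~ y) →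
        (∀ {u v} → (u , v) ∈ᴸ kept ℓ L X → u ~ v) →
        ∀ {x y} → components ℓ L x ≡ components ℓ L y → x ~ y
      kept-sound eq [] X ℓ⇒~ X⇒~ kept⇒~ e = ℓ⇒~ e
      kept-sound {_~_} eq {ℓ} ((u , v) ∷ L) X ℓ⇒~ X⇒~ kept⇒~ e
        with ℓ u Fin.≟ ℓ v | meetsEnds? ℓ u v X
      ... | yes p | yes _ = kept-sound eq L X (merge-sound eq {ℓ = ℓ} ℓ⇒~ (ℓ⇒~ p)) X⇒~ kept⇒~ e
      ... | yes p | no _  = kept-sound eq L X (merge-sound eq {ℓ = ℓ} ℓ⇒~ (ℓ⇒~ p)) X⇒~ kept⇒~ e
      ... | no _  | no _  = kept-sound eq L X (merge-sound eq {ℓ = ℓ} ℓ⇒~ (kept⇒~ (here ≡.refl)))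
        X⇒~ (kept⇒~ ∘ there) e
      ... | no _  | yes (mu , mv) =
        kept-sound eq L X (merge-sound eq {ℓ = ℓ} ℓ⇒~ u~v) X⇒~ kept⇒~ e
        where
        module ~ = IsEquivalence eq
        u~v : u ~ v
        u~v = let x , x∈X , x∈u = meets⁻ X _ mu ; y , y∈X , y∈v = meets⁻ X _ mv in
          ~.trans (ℓ⇒~ (≡.sym (∈-class⁻ ℓ x∈u))) (~.trans (X⇒~ x∈X y∈X) (ℓ⇒~ (∈-class⁻ ℓ y∈v)))

      Within : Edges n → Set
      Within L = ∀ {u v} → (u , v) ∈ᴸ L → u ∈ R × v ∈ R

      meets-full : ∀ ℓ {u v} → u ∈ R → v ∈ R → MeetsEnds ℓ u v R
      meets-full ℓ u∈R v∈R = meets u∈R (∈-class⁺ ℓ ≡.refl) , meets v∈R (∈-class⁺ ℓ ≡.refl)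

      private
        skip : ∀ {k w g g′ δ δ′ ε} → k + g ≈ g′ → δ ≈ ε → δ′ ≈ ε → k + (w * δ + g) ≈ w * δ′ + g′
        skip ih δ≈ δ′≈ = trans (+-congˡ (+-congʳ (*-congˡ (trans δ≈ (sym δ′≈)))))
          (trans (solve 4 (λ k w d g → k :+ (w :* d :+ g) := w :* d :+ (k :+ g))
            refl _ _ _ _) (+-congˡ ih))

      -- As the ends of all edges are terminals, `gain ℓ L R` counts every edge that merges two
      -- classes. Each of these is either kept or counted in the gain of `X`.
      kept-weight : ∀ ℓ L X → Within L → ∑ (kept ℓ L X) (uncurry w) + gain ℓ L X ≈ gain ℓ L R
      kept-weight ℓ []            X _  = +-identityˡ _
      kept-weight ℓ ((u , v) ∷ L) X inR
        with kept-weight (merge ℓ u v) L X (inR ∘ there) | ℓ u Fin.≟ ℓ v | meetsEnds? ℓ u v X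
      ... | ih | yes p | yes _ =
        skip ih (drop-no ℓ u v X λ (ne , _) → ne p) (drop-no ℓ u v R λ (ne , _) → ne p)
      ... | ih | yes p | no _  =
        skip ih (drop-no ℓ u v X λ (ne , _) → ne p) (drop-no ℓ u v R λ (ne , _) → ne p)
      ... | ih | no ne | yes m =
        skip ih (drop-yes ℓ u v X (ne , m))
        (drop-yes ℓ u v R (ne , uncurry (meets-full ℓ) (inR (here ≡.refl))))
      ... | ih | no ne | no ¬m =
        trans (+-congˡ (+-congʳ (*-congˡ (drop-no ℓ u v X (¬m ∘ proj₂)))))
        (trans (solve 3 (λ k w g → w :+ k :+ (w :* :0 :+ g) := w :* :1 :+ (k :+ g)) refl _ _ _)
          (+-cong (*-congˡ (sym (drop-yes ℓ u v R
            (ne , uncurry (meets-full ℓ) (inR (here ≡.refl)))))) ih))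

      gain-nonneg : ∀ ℓ L X → (∀ {u v} → (u , v) ∈ᴸ L → 0# ≤ w u v) → 0# ≤ gain ℓ L X
      gain-nonneg ℓ []            X _   = ≤-refl
      gain-nonneg ℓ ((u , v) ∷ L) X 0≤w = +-nonneg
        (*-nonNegative (0≤w (here ≡.refl)) (drop-nonneg ℓ u v X))
        (gain-nonneg (merge ℓ u v) L X (0≤w ∘ there))

      gain≤ : ∀ ℓ L X → (∀ {u v} → (u , v) ∈ᴸ L → 0# ≤ w u v) → gain ℓ L X ≤ ∑ L (uncurry w)
      gain≤ ℓ []            X _   = ≤-refl
      gain≤ ℓ ((u , v) ∷ L) X 0≤w = +-mono-≤
        (≤-respʳ (*-identityʳ _) (*-monoˡ-≤ (0≤w (here ≡.refl)) (drop≤1 ℓ u v X)))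
        (gain≤ (merge ℓ u v) L X (0≤w ∘ there))

  -- The hypergraphic relaxation of MST-optimal instances

  open HYPFeasible

  ¬¬-Π-subsets : ∀ {n} {P : Subset n → Set} → (∀ X → ¬ ¬ P X) → ¬ ¬ (∀ X → P X)
  ¬¬-Π-subsets {zero}  h k = h [] λ p → k λ { [] → p }
  ¬¬-Π-subsets {suc n} h k = ¬¬-Π-subsets (h ∘ (outside ∷_)) λ o →
    ¬¬-Π-subsets (h ∘ (inside ∷_)) λ i →
    k λ { (outside ∷ X) → o X ; (inside ∷ X) → i X }

  module _ (I : Instance) where
    open Instance I

    connectors : Finite (Subset n × Fin n)
    connectors = subset n ×ᶠ fin n

    Connector : Subset n × Fin n → Set
    Connector (X , v) = X ⊆ R × v ∈ X

    connector? : ∀ q → Dec (Connector q)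
    connector? (X , v) = (X ⊆? R) ×-dec (v ∈? X)

    Crosses : Subset n → Subset n × Fin n → Set
    Crosses S (X , v) = Meets X S × v ∉ S

    crosses? : ∀ S q → Dec (Crosses S q)
    crosses? S (X , v) = nonempty? (X ∩ S) ×-dec ¬? (v ∈? S)

    HYPCost≈∑ : ∀ cost x → HYPCost I cost x ≈
      ∑ (elements connectors) λ (X , v) → when (connector? (X , v)) (cost X * x X v)
    HYPCost≈∑ cost x = ∑-subsets-sum≈∑ λ X v → when (connector? (X , v)) (cost X * x X v)

    cut≈∑ : ∀ S x → ∑-subsets n
      (λ X → sum λ v → when (connector? (X , v) ×-dec crosses? S (X , v)) (x X v)) ≈
      ∑ (elements connectors) λ q → when (connector? q) (uncurry x q) * indicator (crosses? S q)
    cut≈∑ S x = trans (∑-subsets-sum≈∑ λ X v →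
      when (connector? (X , v) ×-dec crosses? S (X , v)) (x X v))
      (∑-cong (elements connectors) λ q → when-×-dec (connector? q) (crosses? S q) (uncurry x q))

    module _ {r : Fin n} {x : Subset n → Fin n → Carrier} (r∈R : r ∈ R)
      (feasible : HYPFeasible I r x) where

      value : Subset n × Fin n → Carrier
      value q = when (connector? q) (uncurry x q)

      value-nonneg : ∀ q → 0# ≤ value q
      value-nonneg (X , v) = when-nonneg (connector? (X , v)) λ (X⊆R , v∈X) →
        nonneg feasible X v X⊆R v∈X

      value-*-mono : ∀ q {a b} → (Connector q → a ≤ b) → value q * a ≤ value q * b
      value-*-mono q = when-*-mono (connector? q) λ (X⊆R , v∈X) → nonneg feasible _ _ X⊆R v∈X

      ∑value : (Subset n × Fin n → Carrier) → Carrier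
      ∑value f = ∑ (elements connectors) λ q → value q * f q

      cut′ : ∀ S → Nonempty S → S ⊆ R → r ∉ S → 1# ≤ ∑value λ q → indicator (crosses? S q)
      cut′ S ne S⊆R r∉S = ≤-respʳ (cut≈∑ S x) (cut feasible S ne S⊆R r∉S)

      -- Summing the cut constraints over the classes of ℓ other than that of r.
      touched-bound : ∀ ℓ → touched ℓ R - 1# ≤ ∑value λ (X , _) → touched ℓ X - 1#
      touched-bound ℓ = ≤-by (≤-trans (∑-mono (allFin n) per-class) (≤-reflexive rearrange))
          (solve 2 (λ t s → t :- :1 :+ (:1 :+ s) := s :+ t) refl (touched ℓ R)
            (∑value λ q → outer q))
        ⟨ ≤-trans ⟩ ∑-mono (elements connectors) (λ q → value-*-mono q (per-connector q))
        where
        part : Fin n → Subset n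
        part a = R ∩ class ℓ a

        counted? : ∀ a q → Dec (a ≢ ℓ r × Crosses (part a) q)
        counted? a q = ¬? (a Fin.≟ ℓ r) ×-dec crosses? (part a) q

        outer : Subset n × Fin n → Carrier
        outer q = ∑ (allFin n) λ a → indicator (counted? a q)

        -- The class of the root has no cut constraint; its indicator becomes the `1#` subtracted on
        -- the left.
        per-class : ∀ a → indicator (meets? R (class ℓ a)) ≤
                    indicator (a Fin.≟ ℓ r) + ∑value λ q → indicator (counted? a q)
        per-class a = when-bound (meets? R (class ℓ a)) bound
          (+-nonneg (indicator-nonneg (a Fin.≟ ℓ r)) rest-nonneg)
          where
          rest-nonneg : 0# ≤ ∑value λ q → indicator (counted? a q)
          rest-nonneg = ∑-nonneg (elements connectors) λ q →
            *-nonNegative (value-nonneg q) (indicator-nonneg (counted? a q))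

          bound : Meets R (class ℓ a) → 1# ≤ indicator (a Fin.≟ ℓ r) + ∑value λ q →
            indicator (counted? a q)
          bound m = case a Fin.≟ ℓ r of λ where
            (yes a≡) → ≤-trans (≤-reflexive (sym (indicator-yes (a Fin.≟ ℓ r) a≡)))
              (x≤x+ rest-nonneg)
            (no a≢)  → ≤-trans
              (cut′ (part a) m (p∩q⊆p R (class ℓ a)) λ r∈ →
                a≢ (≡.sym (∈-class⁻ ℓ (proj₂ (x∈p∩q⁻ R _ r∈)))))
              (≤-trans (≤-reflexive (∑-cong (elements connectors) λ q → *-congˡ
                (when-cong (crosses? (part a) q) (counted? a q) (a≢ ,_) proj₂ λ _ → refl)))
                (x≤+x (indicator-nonneg (a Fin.≟ ℓ r))))

        rearrange : ∑ (allFin n)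
          (λ a → indicator (a Fin.≟ ℓ r) + ∑value λ q → indicator (counted? a q)) ≈
                    1# + ∑value outer
        rearrange = trans (∑-+ (allFin n) _ _) (+-cong (∑-δ (fin n) (ℓ r) λ _ → 1#)
          (trans (∑-swap (allFin n) (elements connectors) _)
            (∑-cong (elements connectors) λ q → ∑-*ˡ (allFin n) (value q) _)))

        -- The class containing the head `v` meets `X` but is not crossed, which yields the `1#`
        -- subtracted on the right.
        per-connector : ∀ q → Connector q → outer q ≤ touched ℓ (proj₁ q) - 1#
        per-connector (X , v) (X⊆R , v∈X) = ≤-by
          (∑-mono (allFin n) {λ a → indicator (counted? a (X , v)) + indicator (a Fin.≟ ℓ v)}
            λ a → pointwise a)
          (trans (solve 2 (λ o t → o :+ t := t :- :1 :+ (o :+ :1)) refl _ _)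
            (+-congˡ (sym (trans (∑-+ (allFin n) _ _) (+-congˡ (∑-δ (fin n) (ℓ v) λ _ → 1#))))))
          where
          pointwise : ∀ a → indicator (counted? a (X , v)) + indicator (a Fin.≟ ℓ v) ≤
                            indicator (meets? X (class ℓ a))
          pointwise a = indicator-disjoint (counted? a (X , v)) (a Fin.≟ ℓ v)
            (meets? X (class ℓ a))
            (λ (_ , m , _) → let _ , y∈X , y∈ = meets⁻ X (part a) m in
              meets y∈X (proj₂ (x∈p∩q⁻ R _ y∈)))
            (λ { ≡.refl → meets v∈X (∈-class⁺ ℓ ≡.refl) })
            (λ { (_ , _ , v∉) ≡.refl → v∉ (x∈p∩q⁺ (X⊆R v∈X , ∈-class⁺ ℓ ≡.refl)) })

      module _ (w : Fin n → Fin n → Carrier) where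
        open Kruskal w R

        -- Abel summation: gain is a combination of the functions touched - 1 at
        -- the successive labellings, whose coefficients w e - c are increments of
        -- the sorted weights.
        gain-bound : ∀ ℓ L c → AllPairs (λ e e′ → uncurry w e ≤ uncurry w e′) L →
          All.All (λ e → c ≤ uncurry w e) L →
          (∀ {u v} → u ∈ R → v ∈ R → components ℓ L u ≡ components ℓ L v) →
          gain ℓ L R - c * (touched ℓ R - 1#) ≤ ∑value λ (X , _) →
            gain ℓ L X - c * (touched ℓ X - 1#)
        -- All of `R` now lies in one class, so every `touched` in question is `1#` and both sides
        -- vanish.
        gain-bound ℓ [] c _ _ const = ≤-trans
          (≤-reflexive (vanish (touched-constant ℓ r∈R λ y∈ → const y∈ r∈R)))
          (∑-nonneg (elements connectors) λ (X , v) → ≤-respˡ (zeroʳ _)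
            (value-*-mono (X , v) λ (X⊆R , v∈X) → ≤-reflexive
              (sym (vanish (touched-constant ℓ v∈X λ y∈ → const (X⊆R y∈) (X⊆R v∈X))))))
          where
          vanish : ∀ {t} → t ≈ 1# → 0# - c * (t - 1#) ≈ 0#
          vanish t≈1 = trans (+-congˡ (-‿cong (*-congˡ (+-congʳ t≈1))))
            (solve 1 (λ c → :0 :- c :* (:1 :- :1) := :0) refl c)
        -- Raising the level from `c` to the weight `ω` of the next edge adds `ω - c` times
        -- `touched-bound`; by sortedness the remaining edges can start at level `ω`.
        gain-bound ℓ ((u , v) ∷ L) c (e≤ ∷ sorted) (c≤e All.∷ _) const =
          ≤-respˡ (step R)
            (≤-respʳ combine (+-mono-≤ (gain-bound ℓ′ L ω sorted e≤ const)
              (*-monoˡ-≤ (0≤y-x c≤e) (touched-bound ℓ))))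
          where
          open ≈-Reasoning
          ℓ′ = merge ℓ u v
          ω = w u v

          step : ∀ X → (gain ℓ′ L X - ω * (touched ℓ′ X - 1#)) + (ω - c) * (touched ℓ X - 1#) ≈
                       gain ℓ ((u , v) ∷ L) X - c * (touched ℓ X - 1#)
          step X = begin
            (gain ℓ′ L X - ω * (touched ℓ′ X - 1#)) + (ω - c) * (touched ℓ X - 1#)
              ≈⟨ solve 5 (λ g ω t′ c t → (g :- ω :* (t′ :- :1)) :+ (ω :- c) :* (t :- :1) :=
                   ω :* (t :- t′) :+ g :- c :* (t :- :1)) refl _ _ _ _ _ ⟩
            ω * (touched ℓ X - touched ℓ′ X) + gain ℓ′ L X - c * (touched ℓ X - 1#)
              ≈⟨ +-congʳ (+-congʳ (*-congˡ (trans (+-congʳ (touched-merge ℓ u v X))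
                   (solve 2 (λ t d → t :+ d :- t := d) refl _ _)))) ⟩
            gain ℓ ((u , v) ∷ L) X - c * (touched ℓ X - 1#) ∎

          combine : ∑value (λ (X , _) → gain ℓ′ L X - ω * (touched ℓ′ X - 1#)) +
                    (ω - c) * ∑value (λ (X , _) → touched ℓ X - 1#) ≈
                    ∑value λ (X , _) → gain ℓ ((u , v) ∷ L) X - c * (touched ℓ X - 1#)
          combine = begin
            _ ≈⟨ +-congˡ (∑-*ˡ (elements connectors) (ω - c) _) ⟨
            _ ≈⟨ ∑-+ (elements connectors) _ _ ⟨
            ∑ (elements connectors) (λ (X , v) →
              value (X , v) * (gain ℓ′ L X - ω * (touched ℓ′ X - 1#)) +
              (ω - c) * (value (X , v) * (touched ℓ X - 1#)))
              ≈⟨ ∑-cong (elements connectors) (λ (X , v) → trans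
                   (solve 4 (λ x a b t → x :* a :+ b :* (x :* t) :=
                     x :* (a :+ b :* t)) refl _ _ _ _)
                   (*-congˡ (step X))) ⟩
            _ ∎

      OPT≤HYPCost : ∀ {o t cost} → IsOPT I o → IsTMST I t → t ≈ o →
                    (∀ X → X ⊆ R → IsConnectionCost I X (cost X)) → o ≤ HYPCost I cost x
      OPT≤HYPCost {o} {t} {cost} opt (d , dist , (T , tree , t≈) , _) t≈o isCost = ≤-trans o≤gain
        (≤-trans (≤-respˡ (no-offset R) (≤-trans
            (gain-bound d id L 0# sorted (All.tabulate λ e∈ → d-nonneg (L-within e∈)) constant)
            (≤-reflexive (∑-cong (elements connectors) λ (X , _) → *-congˡ (no-offset X)))))
          (≤-respʳ (sym (HYPCost≈∑ cost x)) (∑-mono (elements connectors) λ (X , v) → ≤-respʳ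
            (trans (*-comm _ _) (sym (when-*ˡ (connector? (X , v)) (cost X) (x X v))))
            (value-*-mono (X , v) λ (X⊆R , _) → gain≤cost X X⊆R))))
        where
        open Kruskal d R
        sorting = sort-by (uncurry d) (edges T)
        L = proj₁ sorting
        L↭ = proj₁ (proj₂ sorting)
        sorted = proj₂ (proj₂ sorting)

        L-within : Within L
        L-within e∈ = proj₁ (tree⇒edges I tree) (∈-resp-↭ L↭ e∈)

        d-nonneg : ∀ {u v} → u ∈ R × v ∈ R → 0# ≤ d u v
        d-nonneg (u∈R , v∈R) = distance-nonneg I (dist _ _ u∈R v∈R)

        constant : ∀ {u v} → u ∈ R → v ∈ R → Connected L u v
        constant u∈R v∈R = Connected-⊆ (edges T) L (Connected-∈ ∘ ∈-resp-↭ (↭-sym L↭))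
          (proj₂ (tree⇒edges I tree) u∈R v∈R)

        ∑L≈o : ∑ L (uncurry d) ≈ o
        ∑L≈o = trans (∑-↭ (uncurry d) L↭) (trans (sym (trans t≈ (weight≈∑ d T))) t≈o)

        no-offset : ∀ X → gain id L X - 0# * (touched id X - 1#) ≈ gain id L X
        no-offset X = solve 2 (λ g t → g :- :0 :* (t :- :1) := g) refl _ _

        -- Replace the superfluous edges by edges of G that connect X.
        opt≤ : ∀ X K → E-edges I K → JoinedBy I K X →
               o ≤ ∑ K (uncurry c) + ∑ (kept id L X) (uncurry d)
        opt≤ X K K⊆E joined with expand I dist (kept id L X) (L-within ∘ kept⊆ id L X)
        ... | M , M⊆E , kept⇒M , M≈ = ≤-respʳ (trans (∑-++ K M _) (+-congˡ M≈))
          (IsOPT⇒≤ I opt (λ e∈ → [ K⊆E , M⊆E ]′ (∈-++⁻ K e∈)) λ u∈R v∈R →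
            kept-sound (Connected-equiv (K ++ M)) L X (≡.cong (component (K ++ M)))
              (λ x∈ y∈ → Connected-⊆ K (K ++ M) (Connected-∈ ∘ ∈-++⁺ˡ) (joined x∈ y∈))
              (λ e∈ → Connected-⊆ M (K ++ M) (Connected-∈ ∘ ∈-++⁺ʳ K) (kept⇒M e∈))
              (constant u∈R v∈R))

        -- With nothing contracted the kept edges connect `R` on their own, and by `kept-weight`
        -- they cost at most this gain.
        o≤gain : o ≤ gain id L R
        o≤gain = ≤-trans (opt≤ ⊥ [] (λ ()) λ u∈ _ → ⊥-elim (∉⊥ u∈))
          (≤-by (gain-nonneg id L ⊥ (d-nonneg ∘ L-within)) (trans
            (solve 2 (λ k g → :0 :+ k :+ g := k :+ g :+ :0) refl _ _)
              (+-congʳ (kept-weight id L ⊥ L-within))))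

        -- MST-optimality enters through `∑L≈o`: the gain of `R` is at most `o`, and `o` is at most
        -- the cost of connecting `X` plus that of the kept edges, which is the gain of `R` minus
        -- that of `X`.
        gain≤cost : ∀ X → X ⊆ R → gain id L X ≤ cost X
        gain≤cost X X⊆R with IsConnectionCost⇒edges I (isCost X X⊆R)
        ... | K , K⊆E , joined , cost≈ = ≤-by
          (+-mono-≤ (opt≤ X K K⊆E joined) (gain≤ id L R (d-nonneg ∘ L-within)))
          (trans (+-congˡ (+-cong (+-congʳ (sym cost≈)) ∑L≈o))
            (trans (solve 4 (λ g k c o → g :+ (c :+ k :+ o) := c :+ (o :+ (k :+ g))) refl _ _ _ _)
              (+-congˡ (+-congˡ (kept-weight id L X L-within)))))

    -- The solution with value `1#` on the connector `(R , r)` crosses every cut. It costs `cost R`,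
    -- at most `o` because an optimum Steiner tree connects `R`.
    OPT-is-HYP : ∀ {r o t} → r ∈ R → IsOPT I o → IsTMST I t → t ≈ o → ¬ ¬ IsHYP I r o
    OPT-is-HYP {r} {o} r∈R opt@((K , (K⊆E , W , R⊆W , tree) , o≈) , _) tmst t≈o k =
      ¬¬-Π-subsets (IsConnectionCost-exists I) λ costs →
        let cost   = proj₁ ∘ costs
            isCost = λ X _ → proj₂ (costs X) in
        k ( cost , isCost
          , ( x , feasible
            , antisym (OPT≤HYPCost r∈R feasible opt tmst t≈o isCost)
              (≤-respˡ (sym (objective cost))
                (≤-respʳ (sym o≈) (proj₂ (isCost R id) K
                  (K⊆E , λ u v u∈ v∈ → IsTree.connected tree u v (R⊆W u∈) (R⊆W v∈))))) )
          , λ x feas → OPT≤HYPCost r∈R feas opt tmst t≈o isCost )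
      where
      _≟ᶜ_ = Finite._≟_ connectors

      x : Subset n → Fin n → Carrier
      x X v = indicator ((X , v) ≟ᶜ (R , r))

      feasible : HYPFeasible I r x
      feasible .nonneg X v _ _ = indicator-nonneg ((X , v) ≟ᶜ (R , r))
      feasible .cut S (s , s∈S) S⊆R r∉S = ≤-respʳ (sym (cut≈∑ S x)) (≤-trans
        (≤-reflexive (sym (trans (*-cong (trans (when-yes (connector? (R , r)) (id , r∈R) _)
            (indicator-yes ((R , r) ≟ᶜ (R , r)) ≡.refl))
              (indicator-yes (crosses? S (R , r)) (meets (S⊆R s∈S) s∈S , r∉S)))
          (*-identityʳ _))))
        (term≤∑ (∈-elements connectors (R , r)) λ q → *-nonNegative
          (when-nonneg (connector? q) λ _ → indicator-nonneg (q ≟ᶜ (R , r)))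
          (indicator-nonneg (crosses? S q))))

      objective : ∀ cost → HYPCost I cost x ≈ cost R
      objective cost = trans (HYPCost≈∑ cost x) (trans
        (∑-single {x = R , r} (Finite.unique connectors) (∈-elements connectors (R , r)) λ q q≢ →
          when-zero (connector? q) λ _ →
            trans (*-congˡ (indicator-no (q ≟ᶜ (R , r)) q≢)) (zeroʳ _))
        (trans (when-yes (connector? (R , r)) (id , r∈R) _)
          (trans (*-congˡ (indicator-yes ((R , r) ≟ᶜ (R , r)) ≡.refl)) (*-identityʳ _))))

  -- The bidirected cut relaxation

  open BCRFeasible

  positive-lower-bound : ∀ (xs : List A) (f : A → Carrier) → (∀ {x} → x ∈ᴸ xs → Positive (f x)) →
                         ∃[ m ] Positive m × ∀ {x} → x ∈ᴸ xs → m ≤ f x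
  positive-lower-bound []       f pos = 1# , 1-positive , λ ()
  positive-lower-bound (x ∷ xs) f pos with positive-lower-bound xs f (pos ∘ there)
  ... | m , pm , m≤ with total m (f x)
  ...   | inj₁ m≤fx = m , pm , λ { (here ≡.refl) → m≤fx ; (there x∈) → m≤ x∈ }
  ...   | inj₂ fx≤m = f x , pos (here ≡.refl) ,
    λ { (here ≡.refl) → ≤-refl ; (there x∈) → ≤-trans fx≤m (m≤ x∈) }

  another-element : ∀ {n} {X : Subset n} {r} → 2 ℕ.≤ ∣ X ∣ → ∃[ s ] s ∈ X × s ≢ r
  another-element {n} {X} {r} 2≤ with Fin.any? (λ s → (s ∈? X) ×-dec ¬? (s Fin.≟ r))
  ... | yes found = found
  ... | no none   = ⊥-elim (ℕ.<⇒≱ 2≤ (≡.subst (∣ X ∣ ℕ.≤_) (∣⁅x⁆∣≡1 r) (p⊆q⇒∣p∣≤∣q∣ X⊆⁅r⁆)))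
    where
    X⊆⁅r⁆ : X ⊆ ⁅ r ⁆
    X⊆⁅r⁆ {s} s∈ with s Fin.≟ r
    ... | yes ≡.refl = x∈⁅x⁆ r
    ... | no s≢r     = ⊥-elim (none (s , s∈ , s≢r))

  leaving-edge : ∀ {n} (K : EdgeSet n) {S : Subset n} {s t} → Walk K s t → s ∈ S → t ∉ S →
                 ∃[ u ] ∃[ v ] Adj K u v × u ∈ S × v ∉ S
  leaving-edge K ε s∈ t∉ = ⊥-elim (t∉ s∈)
  leaving-edge K {S} (_◅_ {i = u} {j = v} a p) s∈ t∉ with v ∈? S
  ... | yes v∈ = leaving-edge K p v∈ t∉
  ... | no v∉  = u , v , a , s∈ , v∉

  module _ (I : Instance) where
    open Instance I

    adj? : ∀ ((u , v) : Fin n × Fin n) → Dec (Adj E u v)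
    adj? (u , v) = T? (adj E u v)

    minimum-cost : ∃[ m ] Positive m × ∀ {u v} → Adj E u v → m ≤ c u v
    minimum-cost =
      let m , pm , m≤ = positive-lower-bound (filter adj? (pairs n)) (uncurry c)
            λ {(u , v)} e∈ → 0<⇒Positive (c-pos u v (proj₂ (∈-filter⁻ adj? {xs = pairs n} e∈)))
      in m , pm , λ {u} {v} a → m≤ (∈-filter⁺ adj? (∈-elements (fin n ×ᶠ fin n) (u , v)) a)

    Leaves : Subset n → Fin n × Fin n → Set
    Leaves S (u , v) = u ∈ S × v ∉ S

    leaves? : ∀ S e → Dec (Leaves S e)
    leaves? S (u , v) = (u ∈? S) ×-dec ¬? (v ∈? S)

    BCRCost≈∑ : ∀ x → BCRCost I x ≈ ∑ (pairs n) λ (u , v) → when (adj? (u , v)) (c u v * x u v)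
    BCRCost≈∑ x = sum-sum≈∑ λ u v → when (adj? (u , v)) (c u v * x u v)

    BCR-cut≈∑ : ∀ S x → sum (λ u → sum λ v →
      when (adj? (u , v) ×-dec leaves? S (u , v)) (x u v)) ≈
                ∑ (pairs n) λ e → when (adj? e ×-dec leaves? S e) (uncurry x e)
    BCR-cut≈∑ S x = sum-sum≈∑ λ u v → when (adj? (u , v) ×-dec leaves? S (u , v)) (x u v)

    -- A second terminal `s` gives the cut `⁅ s ⁆`, so the entries of `x` on edges add up to at
    -- least `1#`, and each unit costs at least the cheapest edge.
    BCR-positive : ∀ {r b} → 2 ℕ.≤ ∣ R ∣ → IsBCR I r b → Positive b
    BCR-positive {r} {b} 2≤ ((x , feasible , b≈) , _) with
      minimum-cost | another-element {r = r} 2≤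
    ... | m , pm , m≤ | s , s∈R , s≢r = Positive-mono (≤-respʳ (sym b≈) m≤cost) pm
      where
      x-nonneg : ∀ {u v} → Adj E u v → 0# ≤ x u v
      x-nonneg = nonneg feasible _ _

      1≤ : 1# ≤ ∑ (pairs n) λ e → when (adj? e) (uncurry x e)
      1≤ = ≤-trans (cut feasible ⁅ s ⁆ (λ r∈ → s≢r (≡.sym (x∈⁅y⁆⇒x≡y s r∈)))
        (s , x∈p∩q⁺ (x∈⁅x⁆ s , s∈R)))
        (≤-respˡ (sym (BCR-cut≈∑ ⁅ s ⁆ x)) (∑-mono (pairs n) λ e →
          when-mono (adj? e ×-dec leaves? ⁅ s ⁆ e) (adj? e) proj₁ (λ _ → ≤-refl) x-nonneg))

      m≤cost : m ≤ BCRCost I x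
      m≤cost = ≤-trans (≤-respˡ (*-identityʳ m) (*-monoˡ-≤ (Positive⇒0≤ pm) 1≤))
        (≤-respˡ (∑-*ˡ (pairs n) m _) (≤-respʳ (sym (BCRCost≈∑ x)) (∑-mono (pairs n) λ e →
          ≤-respˡ (when-*ˡ (adj? e) m (uncurry x e))
            (when-mono (adj? e) (adj? e) id (λ a → *-monoʳ-≤ (x-nonneg a) (m≤ a))
              λ a → *-nonNegative (c-nonneg I a) (x-nonneg a)))))

    module _ {r : Fin n} where

      Separates : Subset n → Set
      Separates S = r ∉ S × Nonempty (S ∩ R)

      separates? : ∀ S → Dec (Separates S)
      separates? S = ¬? (r ∈? S) ×-dec nonempty? (S ∩ R)

      -- Duality yields an actual minimum, not just one under double negation. The vector of ones is
      -- feasible because the graph is connected, and the zero dual because costs are nonnegative;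
      -- indices that are not edges or valid cuts get zero entries.
      IsBCR-exists : ∃ (IsBCR I r)
      IsBCR-exists = BCRCost I (λ u v → x (u , v))
        , ( (λ u v → x (u , v))
          , record
            { nonneg = λ u v _ → proj₁ px (u , v)
            ; cut    = λ S r∉S ne → ≤-respˡ (indicator-yes (separates? S) (r∉S , ne))
                (≤-respʳ (trans (∑-cong (pairs n) λ e → trans
                    (*-congʳ (when-yes (separates? S) (r∉S , ne) _))
                    (trans (sym (when-*ʳ (adj? e ×-dec leaves? S e) 1# (x e)))
                      (when-congʳ (adj? e ×-dec leaves? S e) λ _ → *-identityˡ _)))
                  (sym (BCR-cut≈∑ S λ u v → x (u , v)))) (proj₂ px S))
            }
          , refl )
        , λ x′ feasible → ≤-trans (≤-trans
            (≤-reflexive (trans (BCRCost≈∑ _)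
              (∑-cong (pairs n) λ e → when-*ʳ (adj? e) (uncurry c e) (x e))))
            (≤-trans cx≤by (weak-duality {x = λ e → when (adj? e) (uncurry x′ e)}
              (primal feasible) dy)))
            (≤-reflexive (trans (∑-cong (pairs n) λ e → case adj? e of λ where
                (yes a) → trans (*-cong (when-yes (adj? e) a _) (when-yes (adj? e) a _))
                  (sym (when-yes (adj? e) a _))
                (no ¬a) → trans (*-congʳ (when-no (adj? e) ¬a _))
                  (trans (zeroˡ _) (sym (when-no (adj? e) ¬a _))))
              (sym (BCRCost≈∑ x′))))
        where
        entry : Subset n → Fin n × Fin n → Carrier
        entry S e = when (separates? S) (indicator (adj? e ×-dec leaves? S e))

        entry-nonneg : ∀ S e → 0# ≤ entry S e
        entry-nonneg S e = when-nonneg (separates? S) λ _ →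
          indicator-nonneg (adj? e ×-dec leaves? S e)

        open LinearProgram (subset n) (fin n ×ᶠ fin n) entry

        primal : ∀ {x′} → BCRFeasible I r x′ →
                 Primal (λ S → indicator (separates? S)) (λ e → when (adj? e) (uncurry x′ e))
        primal {x′} feasible = (λ e → when-nonneg (adj? e) λ a → nonneg feasible _ _ a) , λ S →
          when-bound (separates? S)
            (λ (r∉S , ne) → ≤-trans (cut feasible S r∉S ne) (≤-reflexive
              (trans (BCR-cut≈∑ S x′) (∑-cong (pairs n) λ e → trans (trans
                  (trans (when-×-dec (adj? e) (leaves? S e) _) (*-comm _ _))
                  (case adj? e of λ where
                    (yes a) → *-congʳ (when-cong (leaves? S e) (adj? e ×-dec leaves? S e) (a ,_)
                      proj₂ λ _ → refl)
                    (no ¬a) → trans (*-congˡ (when-no (adj? e) ¬a _))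
                      (trans (zeroʳ _) (sym (trans
                        (*-congˡ (when-no (adj? e) ¬a _)) (zeroʳ _))))))
                (*-congʳ (sym (when-yes (separates? S) (r∉S , ne) _)))))))
            (∑-nonneg (pairs n) λ e →
              *-nonNegative (entry-nonneg S e) (when-nonneg (adj? e) λ a → nonneg feasible _ _ a))

        ones : Primal (λ S → indicator (separates? S)) (λ _ → 1#)
        ones = (λ _ → 0≤1) , λ S → when-bound (separates? S) (λ sep → covered S sep)
          (∑-nonneg (pairs n) λ e → *-nonNegative (entry-nonneg S e) 0≤1)
          where
          covered : ∀ S → Separates S → 1# ≤ ∑ (pairs n) λ e → entry S e * 1#
          covered S sep@(r∉S , s , s∈) with leaving-edge E {S} (connected s r)
            (proj₁ (x∈p∩q⁻ S R s∈)) r∉S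
          ... | u , v , a , u∈ , v∉ = ≤-trans
            (≤-reflexive (sym (trans (*-identityʳ _) (trans (when-yes (separates? S) sep _)
              (indicator-yes (adj? (u , v) ×-dec leaves? S (u , v)) (a , u∈ , v∉))))))
            (term≤∑ (∈-elements (fin n ×ᶠ fin n) (u , v)) λ e →
              *-nonNegative (entry-nonneg S e) 0≤1)

        solution = strong-duality {y₀ = λ _ → 0#} ones ((λ _ → ≤-refl) , λ e →
          ≤-trans (≤-reflexive (∑-zero′ (subsets n) λ _ → zeroˡ _))
            (when-nonneg (adj? e) {uncurry c e} (c-nonneg I)))
        x = proj₁ solution
        px = proj₁ (proj₂ (proj₂ solution))
        dy = proj₁ (proj₂ (proj₂ (proj₂ solution)))
        cx≤by = proj₂ (proj₂ (proj₂ (proj₂ solution)))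

  -- The dual of the hypergraphic relaxation

  ⊈⇒∃ : ∀ {n} {S T : Subset n} → ¬ S ⊆ T → ∃[ a ] a ∈ S × a ∉ T
  ⊈⇒∃ {S = S} {T} S⊈T with Fin.any? (λ a → (a ∈? S) ×-dec ¬? (a ∈? T))
  ... | yes found = found
  ... | no none   = ⊥-elim (S⊈T λ {a} a∈S → case a ∈? T of λ where
          (yes a∈T) → a∈T
          (no a∉T)  → ⊥-elim (none (a , a∈S , a∉T)))

  minimum : ∀ a b → Σ[ d ∈ Carrier ] (d ≤ a × d ≤ b) × (d ≡ a ⊎ d ≡ b)
  minimum a b with total a b
  ... | inj₁ a≤b = a , (≤-refl , a≤b) , inj₁ ≡.refl
  ... | inj₂ b≤a = b , (b≤a , ≤-refl) , inj₂ ≡.refl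

  module _ {n : ℕ} where

    inside? : ∀ S ((u , v) : Fin n × Fin n) → Dec (u ∈ S × v ∈ S)
    inside? S (u , v) = (u ∈? S) ×-dec (v ∈? S)

    -- The squared cardinality, written as a count of ordered pairs so that supermodularity can be
    -- checked pair by pair.
    ∣_∣² : Subset n → Carrier
    ∣ S ∣² = ∑ (pairs n) λ e → indicator (inside? S e)

    pairs-count : Carrier
    pairs-count = ∑ (pairs n) λ _ → 1#

    ∣∣²-nonneg : ∀ S → 0# ≤ ∣ S ∣²
    ∣∣²-nonneg S = ∑-nonneg (pairs n) λ e → indicator-nonneg (inside? S e)

    ∣∣²≤pairs-count : ∀ S → ∣ S ∣² ≤ pairs-count
    ∣∣²≤pairs-count S = ∑-mono (pairs n) λ e → indicator≤1 (inside? S e)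

    -- The extra `1#` comes from a pair `(a , b)` with `a` only in `S` and `b` only in `T`: it lies
    -- inside the union but inside neither set.
    ∣∣²-supermodular : ∀ S T → ¬ S ⊆ T → ¬ T ⊆ S → ∣ S ∣² + ∣ T ∣² + 1# ≤ ∣ S ∩ T ∣² + ∣ S ∪ T ∣²
    ∣∣²-supermodular S T S⊈T T⊈S with ⊈⇒∃ S⊈T | ⊈⇒∃ T⊈S
    ... | a , a∈S , a∉T | b , b∈T , b∉S = ≤-respˡ
      (trans (∑-+ (pairs n) _ _)
        (+-cong (∑-+ (pairs n) _ _) (∑-δ (fin n ×ᶠ fin n) (a , b) λ _ → 1#)))
      (≤-respʳ (∑-+ (pairs n) _ _) (∑-mono (pairs n) pointwise))
      where
      pointwise : ∀ e → indicator (inside? S e) + indicator (inside? T e) +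
        indicator (e ≟² (a , b)) ≤
                        indicator (inside? (S ∩ T) e) + indicator (inside? (S ∪ T) e)
      pointwise e@(u , v) = case e ≟² (a , b) of λ where
          (yes ≡.refl) → ≤-respˡ (sym (+-cong (+-cong (indicator-no (inside? S e) (b∉S ∘ proj₂))
                                                      (indicator-no (inside? T e) (a∉T ∘ proj₁)))
                                              (indicator-yes (e ≟² (a , b)) ≡.refl)))
            (≤-respˡ (solve 0 (:0 :+ :1 := :0 :+ :0 :+ :1) refl)
              (+-mono-≤ (indicator-nonneg (inside? (S ∩ T) e))
              (≤-reflexive (sym (indicator-yes (inside? (S ∪ T) e)
                (x∈p∪q⁺ (inj₁ a∈S) , x∈p∪q⁺ (inj₂ b∈T)))))))
          (no e≢) → ≤-respˡ (sym (trans (+-congˡ (indicator-no (e ≟² (a , b)) e≢))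
            (+-identityʳ _))) weak
        where
        weak : indicator (inside? S e) + indicator (inside? T e) ≤
               indicator (inside? (S ∩ T) e) + indicator (inside? (S ∪ T) e)
        weak = indicator-+-mono (inside? S e) (inside? T e) (inside? (S ∩ T) e)
          (inside? (S ∪ T) e)
          (λ (us , vs) → inj₂ (x∈p∪q⁺ (inj₁ us) , x∈p∪q⁺ (inj₁ vs)))
          (λ (ut , vt) → inj₂ (x∈p∪q⁺ (inj₂ ut) , x∈p∪q⁺ (inj₂ vt)))
          (λ (us , vs) (ut , vt) →
            (x∈p∩q⁺ (us , ut) , x∈p∩q⁺ (vs , vt)) , x∈p∪q⁺ (inj₁ us) , x∈p∪q⁺ (inj₁ vs))

  module HypergraphicDual (I : Instance) {r : Fin (Instance.n I)} (r∈R : r ∈ Instance.R I) where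
    open Instance I

    Cut : Subset n → Set
    Cut S = Nonempty S × S ⊆ R × r ∉ S

    cut? : ∀ S → Dec (Cut S)
    cut? S = nonempty? S ×-dec ((S ⊆? R) ×-dec ¬? (r ∈? S))

    cuts : List (Subset n)
    cuts = filter cut? (subsets n)

    ∈-cuts : ∀ {S} → Cut S → S ∈ᴸ cuts
    ∈-cuts {S} = ∈-filter⁺ cut? (∈-elements (subset n) S)

    cuts⁻ : ∀ {S} → S ∈ᴸ cuts → Cut S
    cuts⁻ S∈ = proj₂ (∈-filter⁻ cut? {xs = subsets n} S∈)

    crossing : Subset n × Fin n → Subset n → Carrier
    crossing q S = indicator (crosses? I S q)

    crossing-nonneg : ∀ q S → 0# ≤ crossing q S
    crossing-nonneg q S = indicator-nonneg (crosses? I S q)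

    load : (Subset n → Carrier) → Subset n × Fin n → Carrier
    load y q = ∑ cuts λ S → y S * crossing q S

    DualFeasible : (Subset n → Carrier) → (Subset n → Carrier) → Set
    DualFeasible cost y = (∀ S → 0# ≤ y S) × (∀ X v → X ⊆ R → v ∈ X → load y (X , v) ≤ cost X)

    module _ {cost : Subset n → Carrier} (isCost : ∀ X → X ⊆ R → IsConnectionCost I X (cost X))
        (β : Subset n → Carrier) (1≤β : ∀ S → 1# ≤ β S) where

      -- The last property rests on `β ≥ 1`: an optimal primal solution for the right-hand side `β`
      -- is then feasible for the relaxation itself, so its cost is at least `h`.
      dual-optimum : Σ[ y ∈ (Subset n → Carrier) ] DualFeasible cost y ×
        (∀ y′ → DualFeasible cost y′ → ∑ cuts (λ S → β S * y′ S) ≤ ∑ cuts (λ S → β S * y S)) ×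
        (∀ h → (∀ x → HYPFeasible I r x → h ≤ HYPCost I cost x) → h ≤ ∑ cuts (λ S → β S * y S))
      dual-optimum = y
        , ( proj₁ dy
          , λ X v X⊆R v∈X → ≤-trans (≤-reflexive (sym (load≈ y (X , v) (X⊆R , v∈X))))
              (≤-trans (proj₂ dy (X , v))
                (≤-reflexive (when-yes (connector? I (X , v)) (X⊆R , v∈X) _))) )
        , (λ y′ feasible → ≤-respˡ (sym (value≈ y′)) (≤-respʳ (sym (value≈ y))
            (≤-trans (weak-duality px (dual y′ feasible)) cx≤by)))
        , λ h h≤ → ≤-trans (h≤ (λ X v → x (X , v)) x-feasible) (≤-respʳ (sym (value≈ y)) (≤-respˡ
            (sym (trans (HYPCost≈∑ I cost _) (∑-cong (elements (connectors I)) λ (X , v) →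
              when-*ʳ (connector? I (X , v)) (cost X) (x (X , v))))) cx≤by))
        where
        entry : Subset n → Subset n × Fin n → Carrier
        entry S q = when (cut? S) (when (connector? I q) (crossing q S))

        entry-nonneg : ∀ S q → 0# ≤ entry S q
        entry-nonneg S q = when-nonneg (cut? S) λ _ → when-nonneg (connector? I q) λ _ →
          crossing-nonneg q S

        b : Subset n → Carrier
        b S = when (cut? S) (β S)

        b-nonneg : ∀ S → 0# ≤ b S
        b-nonneg S = when-nonneg (cut? S) λ _ → ≤-trans 0≤1 (1≤β S)

        ĉ : Subset n × Fin n → Carrier
        ĉ (X , v) = when (connector? I (X , v)) (cost X)

        open LinearProgram (subset n) (connectors I) entry

        load≈ : ∀ y q → Connector I q → ∑ (subsets n) (λ S → y S * entry S q) ≈ load y q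
        load≈ y q q-conn = trans (∑-cong (subsets n) λ S → trans (sym (when-*ˡ (cut? S) (y S) _))
            (when-congʳ (cut? S) λ _ → *-congˡ (when-yes (connector? I q) q-conn _)))
          (sym (∑-filter cut? (subsets n) _))

        value≈ : ∀ y → ∑ cuts (λ S → β S * y S) ≈ ∑ (subsets n) (λ S → b S * y S)
        value≈ y = trans (∑-filter cut? (subsets n) _)
          (∑-cong (subsets n) λ S → when-*ʳ (cut? S) (β S) (y S))

        dual : ∀ y → DualFeasible cost y → Dual ĉ y
        dual y (0≤y , load≤) = 0≤y , λ q@(X , v) → case connector? I q of λ where
          (yes q-conn@(X⊆R , v∈X)) → ≤-trans (≤-reflexive (load≈ y q q-conn))
            (≤-trans (load≤ X v X⊆R v∈X)
              (≤-reflexive (sym (when-yes (connector? I q) q-conn (cost X)))))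
          (no ¬q-conn) → ≤-reflexive (trans (∑-zero′ (subsets n) λ S → trans (*-congˡ
              (when-zero (cut? S) λ _ → when-no (connector? I q) ¬q-conn _)) (zeroʳ _))
            (sym (when-no (connector? I q) ¬q-conn (cost X))))

        total-β : Carrier
        total-β = ∑ (subsets n) b

        -- The connector `(R , r)` crosses every cut, so a value of `total-β` there satisfies all
        -- constraints at once.
        constant : Primal b (λ _ → total-β)
        constant = (λ _ → ∑-nonneg (subsets n) b-nonneg) , λ S → when-bound (cut? S)
          (λ cutS@((s , s∈S) , S⊆R , r∉S) → ≤-trans
            (≤-trans (≤-reflexive (sym (when-yes (cut? S) cutS (β S))))
              (term≤∑ (∈-elements (subset n) S) b-nonneg))
            (≤-trans (≤-reflexive (sym (trans (*-congʳ (trans (when-yes (cut? S) cutS _)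
                (trans (when-yes (connector? I (R , r)) (id , r∈R) _)
                  (indicator-yes (crosses? I S (R , r)) (meets (S⊆R s∈S) s∈S , r∉S)))))
                    (*-identityˡ _))))
              (term≤∑ (∈-elements (connectors I) (R , r)) λ q →
                *-nonNegative (entry-nonneg S q) (∑-nonneg (subsets n) b-nonneg))))
          (∑-nonneg (elements (connectors I)) λ q →
            *-nonNegative (entry-nonneg S q) (∑-nonneg (subsets n) b-nonneg))

        solution = strong-duality {y₀ = λ _ → 0#} constant ((λ _ → ≤-refl) , λ (X , v) →
          ≤-trans (≤-reflexive (∑-zero′ (subsets n) λ _ → zeroˡ _))
            (when-nonneg (connector? I (X , v)) λ (X⊆R , _) →
              IsConnectionCost⇒nonneg I (isCost X X⊆R)))
        x = proj₁ solution
        y = proj₁ (proj₂ solution)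
        px = proj₁ (proj₂ (proj₂ solution))
        dy = proj₁ (proj₂ (proj₂ (proj₂ solution)))
        cx≤by = proj₂ (proj₂ (proj₂ (proj₂ solution)))

        x-feasible : HYPFeasible I r (λ X v → x (X , v))
        x-feasible .nonneg X v _ _ = proj₁ px (X , v)
        x-feasible .cut S ne S⊆R r∉S =
          ≤-trans (1≤β S) (≤-respˡ (when-yes (cut? S) (ne , S⊆R , r∉S) _)
          (≤-respʳ (trans (∑-cong (elements (connectors I)) λ q →
            trans (*-congʳ (when-yes (cut? S) (ne , S⊆R , r∉S) _))
              (trans (sym (when-*ʳ (connector? I q) _ _))
                (trans (when-congʳ (connector? I q) λ _ → *-comm _ _)
                (when-*ʳ (connector? I q) _ _))))
            (sym (cut≈∑ I S λ X v → x (X , v)))) (proj₂ px S)))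

    -- The head decides: outside `S ∩ T` it avoids one of the two sets, outside `S ∪ T` it avoids
    -- both.
    crossing-submodular : ∀ q S T → crossing q (S ∩ T) + crossing q (S ∪ T) ≤
      crossing q S + crossing q T
    crossing-submodular q@(X , v) S T =
      indicator-+-mono (crosses? I (S ∩ T) q) (crosses? I (S ∪ T) q)
        (crosses? I S q) (crosses? I T q)
        (λ (m , v∉) → case v ∈? S of λ where
          (yes v∈S) → inj₂ (∩-meetsʳ m , λ v∈T → v∉ (x∈p∩q⁺ (v∈S , v∈T)))
          (no v∉S)  → inj₁ (∩-meetsˡ m , v∉S))
        (λ (m , v∉) → let _ , x∈X , x∈ = meets⁻ X (S ∪ T) m in
          [ (λ x∈S → inj₁ (meets x∈X x∈S , v∉ ∘ x∈p∪q⁺ ∘ inj₁))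
          , (λ x∈T → inj₂ (meets x∈X x∈T , v∉ ∘ x∈p∪q⁺ ∘ inj₂)) ]′ (x∈p∪q⁻ S T x∈))
        (λ (m , _) (_ , v∉) → (∩-meetsˡ m , v∉ ∘ x∈p∪q⁺ ∘ inj₁) , ∩-meetsʳ m , v∉ ∘ x∈p∪q⁺ ∘ inj₂)
      where
      ∩-meetsˡ : Meets X (S ∩ T) → Meets X S
      ∩-meetsˡ m = let _ , x∈X , x∈ = meets⁻ X (S ∩ T) m in meets x∈X (proj₁ (x∈p∩q⁻ S T x∈))

      ∩-meetsʳ : Meets X (S ∩ T) → Meets X T
      ∩-meetsʳ m = let _ , x∈X , x∈ = meets⁻ X (S ∩ T) m in meets x∈X (proj₂ (x∈p∩q⁻ S T x∈))

    Laminar : (Subset n → Carrier) → Set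
    Laminar y = ∀ {S T} → Cut S → Cut T → Positive (y S) → Positive (y T) →
      Nonempty (S ∩ T) → S ⊆ T ⊎ T ⊆ S

    -- Uncrossing S and T keeps y feasible, and raises the objective because
    -- ∣_∣² is strictly supermodular on S and T.
    optimum-laminar : ∀ {cost y τ} → Positive τ → DualFeasible cost y →
      (∀ y′ → DualFeasible cost y′ → ∑ cuts (λ S → (1# + τ * ∣ S ∣²) * y′ S) ≤
        ∑ cuts (λ S → (1# + τ * ∣ S ∣²) * y S)) →
      Laminar y
    optimum-laminar {cost} {y} {τ} pτ (0≤y , load≤) optimal {S} {T} (neS , S⊆R , r∉S)
      (neT , T⊆R , r∉T) pS pT ne∩
      with S ⊆? T | T ⊆? S
    ... | yes S⊆T | _       = inj₁ S⊆T
    ... | no _    | yes T⊆S = inj₂ T⊆S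
    ... | no S⊈T  | no T⊈S  = ⊥-elim (improvement≰0 (≤-by (optimal y′ feasible)
            (trans (+-congˡ (∑-cong cuts λ Z → *-comm _ _))
              (trans (solve 2 (λ i s → i :+ s := :0 :+ (s :+ i)) refl (δ * shift β) _)
              (+-congˡ (trans (sym (shift-∑ β)) (∑-cong cuts λ Z → *-comm _ _)))))))
      where
      β : Subset n → Carrier
      β Z = 1# + τ * ∣ Z ∣²

      -- The largest amount that can be moved from both `S` and `T` to their intersection and union.
      δ = proj₁ (minimum (y S) (y T))
      δ≤ = proj₁ (proj₂ (minimum (y S) (y T)))

      pδ : Positive δ
      pδ = [ (λ e → Positive-mono (≤-reflexive (reflexive (≡.sym e))) pS)
           , (λ e → Positive-mono (≤-reflexive (reflexive (≡.sym e))) pT) ]′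
             (proj₂ (proj₂ (minimum (y S) (y T))))

      is : Subset n → Subset n → Carrier
      is P Z = indicator (Z ≟ˢ P)

      y′ : Subset n → Carrier
      y′ Z = y Z + δ * (is (S ∩ T) Z + is (S ∪ T) Z - (is S Z + is T Z))

      cut-∩ : Cut (S ∩ T)
      cut-∩ = ne∩ , (λ x∈ → S⊆R (p∩q⊆p S T x∈)) , r∉S ∘ p∩q⊆p S T

      cut-∪ : Cut (S ∪ T)
      cut-∪ = (proj₁ neS , x∈p∪q⁺ (inj₁ (proj₂ neS))) , (λ x∈ → [ S⊆R , T⊆R ]′ (x∈p∪q⁻ S T x∈))
            , λ r∈ → [ r∉S , r∉T ]′ (x∈p∪q⁻ S T r∈)

      shift : (Subset n → Carrier) → Carrier
      shift f = f (S ∩ T) + f (S ∪ T) - (f S + f T)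

      pick : ∀ {P} (f : Subset n → Carrier) → Cut P → ∑ cuts (λ Z → is P Z * f Z) ≈ f P
      pick {P} f cutP = trans
        (∑-single {x = P} (Unique.filter⁺ cut? (Finite.unique (subset n))) (∈-cuts cutP) λ Z Z≢P →
          trans (*-congʳ (indicator-no (Z ≟ˢ P) Z≢P)) (zeroˡ _))
        (trans (*-congʳ (indicator-yes (P ≟ˢ P) ≡.refl)) (*-identityˡ _))

      shift-∑ : ∀ f → ∑ cuts (λ Z → y′ Z * f Z) ≈ ∑ cuts (λ Z → y Z * f Z) + δ * shift f
      shift-∑ f = begin
        ∑ cuts (λ Z → y′ Z * f Z)
          ≈⟨ ∑-cong cuts (λ Z → solve 7
            (λ y δ a b c d f → (y :+ δ :* (a :+ b :- (c :+ d))) :* f :=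
               y :* f :+ δ :* (a :* f :+ b :* f :- (c :* f :+ d :* f))) refl _ _ _ _ _ _ _) ⟩
        ∑ cuts (λ Z → y Z * f Z +
          δ * (is (S ∩ T) Z * f Z + is (S ∪ T) Z * f Z - (is S Z * f Z + is T Z * f Z)))
          ≈⟨ trans (∑-+ cuts _ _) (+-congˡ (trans (∑-*ˡ cuts δ _) (*-congˡ (trans (∑-- cuts _ _)
               (+-cong (∑-+ cuts _ _) (-‿cong (∑-+ cuts _ _))))))) ⟩
        _ ≈⟨ +-congˡ (*-congˡ (+-cong (+-cong (pick f cut-∩) (pick f cut-∪))
               (-‿cong (+-cong (pick f (neS , S⊆R , r∉S)) (pick f (neT , T⊆R , r∉T)))))) ⟩
        ∑ cuts (λ Z → y Z * f Z) + δ * shift f ∎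
        where open ≈-Reasoning

      removed≤ : ∀ Z → δ * (is S Z + is T Z) ≤ y Z
      removed≤ Z = case Z ≟ˢ S ,′ Z ≟ˢ T of λ where
        (yes ≡.refl , yes ≡.refl) → ⊥-elim (S⊈T id)
        (yes ≡.refl , no Z≢T) → ≤-trans (≤-reflexive (trans (*-congˡ (trans (+-cong
          (indicator-yes (S ≟ˢ S) ≡.refl) (indicator-no (S ≟ˢ T) Z≢T)) (+-identityʳ _)))
            (*-identityʳ δ))) (proj₁ δ≤)
        (no Z≢S , yes ≡.refl) → ≤-trans (≤-reflexive (trans (*-congˡ (trans (+-cong
          (indicator-no (T ≟ˢ S) Z≢S) (indicator-yes (T ≟ˢ T) ≡.refl)) (+-identityˡ _)))
            (*-identityʳ δ))) (proj₂ δ≤)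
        (no Z≢S , no Z≢T) → ≤-trans (≤-reflexive (trans (*-congˡ (trans (+-cong
          (indicator-no (Z ≟ˢ S) Z≢S) (indicator-no (Z ≟ˢ T) Z≢T)) (+-identityʳ _))) (zeroʳ δ)))
            (0≤y Z)

      feasible : DualFeasible cost y′
      feasible = (λ Z → ≤-by
          (+-mono-≤ (removed≤ Z) (*-nonNegative (Positive⇒0≤ pδ)
            (+-nonneg (0≤is (S ∩ T) Z) (0≤is (S ∪ T) Z))))
          (solve 4 (λ y δ a c → :0 :+ (y :+ δ :* a) := y :+ δ :* (a :- c) :+ (δ :* c :+ :0))
            refl (y Z) δ _ _))
        , λ X v X⊆R v∈X → ≤-trans (≤-reflexive (shift-∑ (crossing (X , v)))) (≤-by
            (+-mono-≤ (load≤ X v X⊆R v∈X)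
              (*-monoˡ-≤ (Positive⇒0≤ pδ) (crossing-submodular (X , v) S T)))
            (solve 5 (λ l δ a c k → l :+ δ :* (a :- c) :+ (k :+ δ :* c) := k :+ (l :+ δ :* a))
              refl _ δ _ _ (cost X)))
        where
        0≤is : ∀ P Z → 0# ≤ is P Z
        0≤is P Z = indicator-nonneg (Z ≟ˢ P)

      -- The constant parts of `β` cancel, and the strictness of `∣∣²-supermodular` leaves at least
      -- `τ`.
      improvement≰0 : Positive (δ * shift β)
      improvement≰0 = *-positive pδ (Positive-mono (≤-by
        (*-monoˡ-≤ (Positive⇒0≤ pτ) (∣∣²-supermodular S T S⊈T T⊈S))
        (solve 5 (λ τ s t i u → τ :+ τ :* (i :+ u) :=
          (:1 :+ τ :* i) :+ (:1 :+ τ :* u) :- ((:1 :+ τ :* s) :+ (:1 :+ τ :* t)) :+ τ :*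
            (s :+ t :+ :1)) refl τ _ _ _ _)) pτ)

  -- Laminar dual solutions

  maximum : List A → (A → Carrier) → Carrier
  maximum []       f = 0#
  maximum (x ∷ xs) f = if does (f x ≤? maximum xs f) then maximum xs f else f x

  maximum-nonneg : ∀ (xs : List A) f → 0# ≤ maximum xs f
  maximum-nonneg []       f = ≤-refl
  maximum-nonneg (x ∷ xs) f with f x ≤? maximum xs f
  ... | yes _ = maximum-nonneg xs f
  ... | no ≰  = ≤-trans (maximum-nonneg xs f) (≰⇒≥ ≰)

  ≤-maximum : ∀ {xs : List A} f {x} → x ∈ᴸ xs → f x ≤ maximum xs f
  ≤-maximum {xs = x ∷ xs} f (here ≡.refl) with f x ≤? maximum xs f
  ... | yes le = le
  ... | no _   = ≤-refl
  ≤-maximum {xs = x ∷ xs} f (there x∈) with f x ≤? maximum xs f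
  ... | yes _ = ≤-maximum f x∈
  ... | no ≰  = ≤-trans (≤-maximum f x∈) (≰⇒≥ ≰)

  maximum-≤ : ∀ (xs : List A) f {b} → 0# ≤ b → (∀ x → f x ≤ b) → maximum xs f ≤ b
  maximum-≤ []       f 0≤b f≤ = 0≤b
  maximum-≤ (x ∷ xs) f 0≤b f≤ with f x ≤? maximum xs f
  ... | yes _ = maximum-≤ xs f 0≤b f≤
  ... | no _  = f≤ x

  maximiser : ∀ (f : A → Carrier) {xs : List A} {x₀} → x₀ ∈ᴸ xs →
              ∃[ x ] x ∈ᴸ xs × (∀ {y} → y ∈ᴸ xs → f y ≤ f x)
  maximiser f {x ∷ []}      _ = x , here ≡.refl , λ { (here ≡.refl) → ≤-refl }
  maximiser f {x ∷ xs@(_ ∷ _)} _ with maximiser f {xs} (here ≡.refl)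
  ... | y , y∈ , ≤y with total (f x) (f y)
  ...   | inj₁ x≤y = y , there y∈ , λ { (here ≡.refl) → x≤y ; (there z∈) → ≤y z∈ }
  ...   | inj₂ y≤x = x , here ≡.refl ,
    λ { (here ≡.refl) → ≤-refl ; (there z∈) → ≤-trans (≤y z∈) y≤x }

  module LaminarDual (I : Instance) {r : Fin (Instance.n I)} (r∈R : r ∈ Instance.R I)
    (y : Subset (Instance.n I) → Carrier)
      (0≤y : ∀ S → 0# ≤ y S) where
    open Instance I
    open HypergraphicDual I r∈R

    ∑y : (Subset n → Carrier) → Carrier
    ∑y f = ∑ cuts λ S → y S * f S

    ∑y-mono : ∀ {f g : Subset n → Carrier} → (∀ {S} → Cut S → f S ≤ g S) → ∑y f ≤ ∑y g
    ∑y-mono f≤g = ∑-mono∈ cuts λ S S∈ → *-monoˡ-≤ (0≤y S) (f≤g (cuts⁻ S∈))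

    ∑y-mono⁺ : ∀ {f g : Subset n → Carrier} →
      (∀ {S} → Cut S → Positive (y S) → f S ≤ g S) → ∑y f ≤ ∑y g
    ∑y-mono⁺ f≤g = ∑-mono∈ cuts λ S S∈ → case y S ≤? 0# of λ where
      (yes y≤0) → ≤-reflexive (trans (*-congʳ (antisym y≤0 (0≤y S)))
        (trans (zeroˡ _) (sym (trans (*-congʳ (antisym y≤0 (0≤y S))) (zeroˡ _)))))
      (no y>0) → *-monoˡ-≤ (0≤y S) (f≤g (cuts⁻ S∈) y>0)

    ∑y-+ : ∀ (f g : Subset n → Carrier) → ∑y (λ S → f S + g S) ≈ ∑y f + ∑y g
    ∑y-+ f g = trans (∑-cong cuts λ S → distribˡ _ _ _) (∑-+ cuts _ _)

    ∑y-nonneg : ∀ {f : Subset n → Carrier} → (∀ S → 0# ≤ f S) → 0# ≤ ∑y f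
    ∑y-nonneg 0≤f = ∑-nonneg cuts λ S → *-nonNegative (0≤y S) (0≤f S)

    -- The least cost of connecting X for which y is feasible.
    demand : Subset n → Carrier
    demand X = maximum (allFin n) λ v → when (v ∈? X) (load y (X , v))

    demand-nonneg : ∀ X → 0# ≤ demand X
    demand-nonneg X = maximum-nonneg (allFin n) _

    load≤demand : ∀ {X v} → v ∈ X → load y (X , v) ≤ demand X
    load≤demand {X} {v} v∈X = ≤-respˡ (when-yes (v ∈? X) v∈X _)
      (≤-maximum (λ v → when (v ∈? X) (load y (X , v))) (∈-allFin v))

    demand≤ : ∀ X {b} → 0# ≤ b → (∀ {v} → v ∈ X → load y (X , v) ≤ b) → demand X ≤ b
    demand≤ X 0≤b load≤ = maximum-≤ (allFin n) _ 0≤b λ v → when-bound (v ∈? X) load≤ 0≤b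

    demand-⊥ : demand ⊥ ≈ 0#
    demand-⊥ = antisym (demand≤ ⊥ ≤-refl λ v∈ → ⊥-elim (∉⊥ v∈)) (demand-nonneg ⊥)

    -- A cut that meets `X ∪ Y` but not `X` meets `Y` and avoids `z`, so it is crossed by `Y` with
    -- head `z`.
    load-∪ : ∀ {X Y z v} → z ∈ X → load y (X ∪ Y , v) ≤ load y (X , v) + load y (Y , z)
    load-∪ {X} {Y} {z} {v} z∈X = ≤-respʳ (∑y-+ _ _) (∑y-mono λ {S} _ →
      indicator-≤-+ (crosses? I S (X ∪ Y , v)) (crosses? I S (X , v))
        (crosses? I S (Y , z)) (split S))
      where
      split : ∀ S → Crosses I S (X ∪ Y , v) → Crosses I S (X , v) ⊎ Crosses I S (Y , z)
      split S (m , v∉) = case nonempty? (X ∩ S) of λ where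
        (yes mX) → inj₁ (mX , v∉)
        (no ¬mX) → let w , w∈ , w∈S = meets⁻ (X ∪ Y) S m in inj₂
          ( [ (λ w∈X → ⊥-elim (¬mX (meets w∈X w∈S))) , (λ w∈Y → meets w∈Y w∈S) ]′ (x∈p∪q⁻ X Y w∈)
          , λ z∈S → ¬mX (meets z∈X z∈S) )

    demand-∪ : ∀ {X Y z} → z ∈ X → z ∈ Y → demand (X ∪ Y) ≤ demand X + demand Y
    demand-∪ {X} {Y} z∈X z∈Y =
      demand≤ (X ∪ Y) (+-nonneg (demand-nonneg X) (demand-nonneg Y)) λ {v} v∈ →
      [ (λ v∈X → ≤-trans (load-∪ {v = v} z∈X) (+-mono-≤ (load≤demand v∈X) (load≤demand z∈Y)))
      , (λ v∈Y → ≤-trans (≤-reflexive (reflexive (≡.cong (λ Z → load y (Z , v)) (∪-comm X Y))))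
          (≤-trans (load-∪ {v = v} z∈Y)
            (≤-trans (+-mono-≤ (load≤demand v∈Y) (load≤demand z∈X))
            (≤-reflexive (+-comm _ _))))) ]′
      (x∈p∪q⁻ X Y v∈)

    pairDemand : Fin n → Fin n → Carrier
    pairDemand u v = demand (⁅ u ⁆ ∪ ⁅ v ⁆)

    pairDemand-comm : ∀ u v → pairDemand u v ≡ pairDemand v u
    pairDemand-comm u v = ≡.cong demand (∪-comm ⁅ u ⁆ ⁅ v ⁆)

    left∈ : ∀ (u v : Fin n) → u ∈ ⁅ u ⁆ ∪ ⁅ v ⁆
    left∈ u v = x∈p∪q⁺ (inj₁ (x∈⁅x⁆ u))

    right∈ : ∀ (u v : Fin n) → v ∈ ⁅ u ⁆ ∪ ⁅ v ⁆
    right∈ u v = x∈p∪q⁺ (inj₂ (x∈⁅x⁆ v))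

    pair∈ : ∀ {u v w : Fin n} → w ∈ ⁅ u ⁆ ∪ ⁅ v ⁆ → w ≡ u ⊎ w ≡ v
    pair∈ {u} {v} w∈ = ⊎.map (x∈⁅y⁆⇒x≡y u) (x∈⁅y⁆⇒x≡y v) (x∈p∪q⁻ ⁅ u ⁆ ⁅ v ⁆ w∈)

    dualValue : Carrier
    dualValue = ∑y λ _ → 1#

    -- Every cut meets `R` and avoids `r`, so all of `y` loads the connector `(R , r)`.
    dualValue≤demand : dualValue ≤ demand R
    dualValue≤demand = ≤-trans (∑y-mono λ {S} ((s , s∈S) , S⊆R , r∉S) →
        ≤-reflexive (sym (indicator-yes (crosses? I S (R , r)) (meets (S⊆R s∈S) s∈S , r∉S))))
      (load≤demand r∈R)

    -- For laminar `y` the sets form a tree with edge lengths `y S`. There this is the distance of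
    -- `u` from the root, `common` is the depth of the lowest common ancestor, and `apart u v` is
    -- the length from it down to `u`.
    depth : Fin n → Carrier
    depth u = ∑y λ S → indicator (u ∈? S)

    common apart : Fin n → Fin n → Carrier
    common u v = ∑y λ S → indicator ((u ∈? S) ×-dec (v ∈? S))
    apart u v = ∑y λ S → indicator ((u ∈? S) ×-dec ¬? (v ∈? S))

    depth-split : ∀ u v → depth u ≈ common u v + apart u v
    depth-split u v = trans (∑-cong cuts λ S → *-congˡ (split S)) (∑y-+ _ _)
      where
      split : ∀ S → indicator (u ∈? S) ≈ indicator ((u ∈? S) ×-dec (v ∈? S)) +
        indicator ((u ∈? S) ×-dec ¬? (v ∈? S))
      split S with u ∈? S | v ∈? S
      ... | yes _ | yes _ = sym (+-identityʳ _)
      ... | yes _ | no _  = sym (+-identityˡ _)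
      ... | no _  | _     = sym (+-identityˡ _)

    common-comm : ∀ u v → common u v ≈ common v u
    common-comm u v = ∑-cong cuts λ S → *-congˡ
      (when-cong ((u ∈? S) ×-dec (v ∈? S)) ((v ∈? S) ×-dec (u ∈? S)) swap swap λ _ → refl)

    -- The load with head `v` is bounded by `apart u v`, the load with head `u` by `apart v u`. The
    -- two differ by the difference of the depths, so the deeper vertex determines the maximum.
    pairDemand≤apart : ∀ {u v} → depth v ≤ depth u → pairDemand u v ≤ apart u v
    pairDemand≤apart {u} {v} v≤u =
      demand≤ (⁅ u ⁆ ∪ ⁅ v ⁆) (∑y-nonneg λ S → indicator-nonneg ((u ∈? S) ×-dec ¬? (v ∈? S)))
      λ w∈ → [ (λ { ≡.refl → ≤-trans load-u (≤-by v≤u exchange) }) ,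
        (λ { ≡.refl → load-v }) ]′ (pair∈ w∈)
      where
      load-v : load y (⁅ u ⁆ ∪ ⁅ v ⁆ , v) ≤ apart u v
      load-v = ∑y-mono λ {S} _ →
        when-mono (crosses? I S (⁅ u ⁆ ∪ ⁅ v ⁆ , v)) ((u ∈? S) ×-dec ¬? (v ∈? S))
        (λ (m , v∉) → let w , w∈ , w∈S = meets⁻ (⁅ u ⁆ ∪ ⁅ v ⁆) S m in
          [ (λ { ≡.refl → w∈S }) , (λ { ≡.refl → ⊥-elim (v∉ w∈S) }) ]′ (pair∈ w∈) , v∉)
        (λ _ → ≤-refl) (λ _ → 0≤1)

      load-u : load y (⁅ u ⁆ ∪ ⁅ v ⁆ , u) ≤ apart v u
      load-u = ∑y-mono λ {S} _ →
        when-mono (crosses? I S (⁅ u ⁆ ∪ ⁅ v ⁆ , u)) ((v ∈? S) ×-dec ¬? (u ∈? S))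
        (λ (m , u∉) → let w , w∈ , w∈S = meets⁻ (⁅ u ⁆ ∪ ⁅ v ⁆) S m in
          [ (λ { ≡.refl → ⊥-elim (u∉ w∈S) }) , (λ { ≡.refl → w∈S }) ]′ (pair∈ w∈) , u∉)
        (λ _ → ≤-refl) (λ _ → 0≤1)

      exchange : apart v u + depth u ≈ apart u v + depth v
      exchange = trans (+-congˡ (depth-split u v)) (trans
        (solve 3 (λ a k b → a :+ (k :+ b) := b :+ (k :+ a)) refl _ _ _)
        (+-congˡ (trans (+-congʳ (common-comm u v)) (sym (depth-split v u)))))

    module _ (laminar : Laminar y) where

      -- If p ∉ S, then by laminarity every set of the support that contains u and p
      -- also contains S, hence q, so common u q exceeds common u p by at least y S.
      nearest-inside : ∀ {u p q ps} → p ∈ᴸ ps → q ∈ᴸ ps →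
        (∀ {q} → q ∈ᴸ ps → common u q ≤ common u p) →
                       ∀ {S} → Cut S → Positive (y S) → u ∈ S → q ∈ S → p ∈ S
      nearest-inside {u} {p} {q} p∈ q∈ nearest {S} cutS pS u∈S q∈S with p ∈? S
      ... | yes p∈S = p∈S
      ... | no p∉S  = ⊥-elim (pS (≤-by
          (+-mono-≤ (nearest q∈) (≤-trans (+-mono-≤ (≤-refl {common u p}) y≤)
            (≤-trans (≤-reflexive (sym (∑y-+ _ _))) (∑y-mono⁺ pointwise))))
          (solve 3 (λ y a b → y :+ (a :+ b) := :0 :+ (b :+ (a :+ y))) refl (y S) _ _)))
        where
        y≤ : y S ≤ ∑y λ T → indicator (T ≟ˢ S)
        y≤ = ≤-trans (≤-reflexive
          (sym (trans (*-congˡ (indicator-yes (S ≟ˢ S) ≡.refl)) (*-identityʳ _))))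
          (term≤∑ {f = λ T → y T * indicator (T ≟ˢ S)} (∈-cuts cutS) λ T →
            *-nonNegative (0≤y T) (indicator-nonneg (T ≟ˢ S)))

        pointwise : ∀ {T} → Cut T → Positive (y T) →
          indicator ((u ∈? T) ×-dec (p ∈? T)) + indicator (T ≟ˢ S) ≤
            indicator ((u ∈? T) ×-dec (q ∈? T))
        pointwise {T} cutT pT =
          indicator-disjoint ((u ∈? T) ×-dec (p ∈? T)) (T ≟ˢ S) ((u ∈? T) ×-dec (q ∈? T))
            (λ (u∈T , p∈T) → u∈T , [ (λ T⊆S → ⊥-elim (p∉S (T⊆S p∈T))) , (λ S⊆T → S⊆T q∈S) ]′
              (laminar cutT cutS pT pS (u , x∈p∩q⁺ (u∈T , u∈S))))
            (λ { ≡.refl → u∈S , q∈S })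
            (λ { (_ , p∈S) ≡.refl → p∉S p∈S })

      Touches : List (Fin n) → Subset n → Set
      Touches ps S = Any.Any (_∈ S) ps

      touches? : ∀ ps S → Dec (Touches ps S)
      touches? ps S = Any.any? (_∈? S) ps

      untouched : List (Fin n) → Carrier
      untouched ps = ∑y λ S → indicator (¬? (touches? ps S))

      -- By `nearest-inside`, a set containing `u` but not `p` contains no vertex of `ps`. Hence the
      -- cost of attaching `u` is paid for by sets that `u` is the first to touch.
      apart+untouched≤ : ∀ {u p ps} → p ∈ᴸ ps → (∀ {q} → q ∈ᴸ ps → common u q ≤ common u p) →
                         apart u p + untouched (u ∷ ps) ≤ untouched ps
      apart+untouched≤ {u} {p} {ps} p∈ nearest = ≤-respˡ (∑y-+ _ _) (∑y-mono⁺ pointwise)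
        where
        pointwise : ∀ {S} → Cut S → Positive (y S) →
          indicator ((u ∈? S) ×-dec ¬? (p ∈? S)) + indicator (¬? (touches? (u ∷ ps) S)) ≤
            indicator (¬? (touches? ps S))
        pointwise {S} cutS pS =
          indicator-disjoint ((u ∈? S) ×-dec ¬? (p ∈? S)) (¬? (touches? (u ∷ ps) S))
            (¬? (touches? ps S))
            (λ (u∈S , p∉S) t → let q , q∈ , q∈S = find t in
              p∉S (nearest-inside p∈ q∈ nearest cutS pS u∈S q∈S))
            (λ ¬t → ¬t ∘ there)
            (λ (u∈S , _) ¬t → ¬t (here u∈S))

      -- Prim-like construction: in order of increasing depth, attach every vertex
      -- to the nearest vertex attached before.
      attach : ∀ ps us {q} → q ∈ᴸ ps → (∀ {u} → u ∈ᴸ ps → u ∈ R) → (∀ {u} → u ∈ᴸ us → u ∈ R) →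
        (∀ {p u} → p ∈ᴸ ps → u ∈ᴸ us → depth p ≤ depth u) →
          AllPairs (λ u v → depth u ≤ depth v) us →
        ∃[ L ] (∀ {u v} → (u , v) ∈ᴸ L → u ∈ R × v ∈ R) ×
          (∀ {u} → u ∈ᴸ us → ∃[ p ] p ∈ᴸ ps × Connected L u p) ×
          ∑ L (uncurry pairDemand) ≤ untouched ps
      attach ps [] _ _ _ _ _ = [] , (λ ()) , (λ ()) , ∑y-nonneg λ S →
        indicator-nonneg (¬? (touches? ps S))
      attach ps (u ∷ us) q∈ ps⊆R us⊆R ps≤us (u≤ ∷ sorted)
        with maximiser (common u) q∈
           | attach (u ∷ ps) us (there q∈)
               (λ { (here ≡.refl) → us⊆R (here ≡.refl) ; (there p∈) → ps⊆R p∈ }) (us⊆R ∘ there)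
               (λ { (here ≡.refl) v∈ → All.lookup u≤ v∈ ; (there p∈) v∈ →
                 ps≤us p∈ (there v∈) }) sorted
      ... | p , p∈ , nearest | L , L⊆R , joined , L≤ =
        (u , p) ∷ L
        , (λ { (here ≡.refl) → us⊆R (here ≡.refl) , ps⊆R p∈ ; (there e∈) → L⊆R e∈ })
        , (λ { (here ≡.refl) → p , p∈ , u~p ; (there v∈) → extend (joined v∈) })
        , ≤-trans (+-mono-≤ (pairDemand≤apart {u} {p} (ps≤us p∈ (here ≡.refl))) L≤)
          (apart+untouched≤ {u} p∈ nearest)
        where
        L⁺ = (u , p) ∷ L

        u~p : Connected L⁺ u p
        u~p = Connected-∈ {L = L⁺} (here ≡.refl)

        weaken : ∀ {a b} → Connected L a b → Connected L⁺ a b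
        weaken = Connected-⊆ L L⁺ (λ e∈ → Connected-∈ {L = L⁺} (there e∈))

        extend : ∀ {v} → ∃[ q ] q ∈ᴸ u ∷ ps × Connected L v q → ∃[ q ] q ∈ᴸ ps × Connected L⁺ v q
        extend (_ , here ≡.refl , v~u) = p , p∈ , ≡.trans (weaken v~u) u~p
        extend (q , there q∈ , v~q)    = q , q∈ , weaken v~q

      terminals : List (Fin n)
      terminals = filter (_∈? R) (allFin n)

      cheap-spanning-edges : ∃[ L ] Spans R L × ∑ L (uncurry pairDemand) ≤ dualValue
      cheap-spanning-edges with sort-by depth terminals
      -- The list `us` contains `r` as well; since no cut contains `r`, attaching it is free.
      ... | us , us↭ , sorted with attach (r ∷ []) us (here ≡.refl) (λ { (here ≡.refl) → r∈R })
                                     (λ u∈ → proj₂ (∈-filter⁻ (_∈? R) {xs = allFin n}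
                                       (∈-resp-↭ us↭ u∈)))
                                     (λ { {u = u} (here ≡.refl) _ → depth-r≤ {u} }) sorted
        where
        depth-r≤ : ∀ {u} → depth r ≤ depth u
        depth-r≤ {u} = ∑y-mono λ {S} (_ , _ , r∉S) →
          ≤-trans (≤-reflexive (indicator-no (r ∈? S) r∉S)) (indicator-nonneg (u ∈? S))
      ...   | L , L⊆R , joined , L≤ = L , (L⊆R , λ u∈ v∈ → ≡.trans (to-r u∈) (≡.sym (to-r v∈)))
        , ≤-trans L≤ (∑y-mono λ {S} _ → indicator≤1 (¬? (touches? (r ∷ []) S)))
        where
        to-r : ∀ {u} → u ∈ R → Connected L u r
        to-r {u} u∈ with joined (∈-resp-↭ (↭-sym us↭) (∈-filter⁺ (_∈? R) (∈-allFin u) u∈))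
        ... | _ , here ≡.refl , u~r = u~r

  -- Completing an instance

  -- Scaling the costs by κ and making every terminal pair adjacent, at the cost
  -- that a laminar dual solution y of the hypergraphic relaxation allows.
  module CompletedInstance (I : Instance) {r : Fin (Instance.n I)} (r∈R : r ∈ Instance.R I)
    (y : Subset (Instance.n I) → Carrier)
      {κ : Carrier} (κ-positive : Positive κ)
      {cost : Subset (Instance.n I) → Carrier}
        (isCost : ∀ X → X ⊆ Instance.R I → IsConnectionCost I X (cost X))
      (dual : HypergraphicDual.DualFeasible I r∈R (λ X → κ * cost X) y)
      (laminar : HypergraphicDual.Laminar I r∈R y)
      (separating : ∀ {u} → u ∈ Instance.R I → u ≢ r → Positive (y ⁅ u ⁆)) where
    open Instance I
    open HypergraphicDual I r∈R
    open LaminarDual I r∈R y (proj₁ dual)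

    BothTerminals : Fin n × Fin n → Set
    BothTerminals (u , v) = u ∈ R × v ∈ R

    both? : ∀ e → Dec (BothTerminals e)
    both? (u , v) = (u ∈? R) ×-dec (v ∈? R)

    adj⁺? : ∀ u v → Dec (Adj E u v ⊎ (u ≢ v × BothTerminals (u , v)))
    adj⁺? u v = T? (adj E u v) ⊎-dec (¬? (u Fin.≟ v) ×-dec both? (u , v))

    E⁺ : EdgeSet n
    E⁺ = record
      { adj    = λ u v → ⌊ adj⁺? u v ⌋
      ; sym    = λ u v a → fromWitness
        (⊎.map (EdgeSet.sym E u v) (×.map (_∘ ≡.sym) swap) (toWitness a))
      ; irrefl = λ v a → [ EdgeSet.irrefl E v , (λ (v≢v , _) → v≢v ≡.refl) ]′ (toWitness a)
      }

    -- Terminal pairs that were already adjacent are repriced too; by `c⁺≤` this never raises the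
    -- cost above the scaled one.
    c⁺ : Fin n → Fin n → Carrier
    c⁺ u v = if does (both? (u , v)) then pairDemand u v else κ * c u v

    c⁺-both : ∀ {u v} → BothTerminals (u , v) → c⁺ u v ≡ pairDemand u v
    c⁺-both {u} {v} both = ≡.cong (if_then pairDemand u v else κ * c u v)
      (dec-true (both? (u , v)) both)

    c⁺-old : ∀ {u v} → ¬ BothTerminals (u , v) → c⁺ u v ≡ κ * c u v
    c⁺-old {u} {v} ¬both = ≡.cong (if_then pairDemand u v else κ * c u v)
      (dec-false (both? (u , v)) ¬both)

    κ-nonneg : 0# ≤ κ
    κ-nonneg = Positive⇒0≤ κ-positive

    old-adj : ∀ {u v} → Adj E⁺ u v → ¬ BothTerminals (u , v) → Adj E u v
    old-adj a ¬both = [ id , (λ (_ , both) → ⊥-elim (¬both both)) ]′ (toWitness a)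

    -- One of the two ends is not `r`; its singleton is a cut of positive weight, crossed when the
    -- other end is the head.
    pairDemand-positive : ∀ {u v} → u ≢ v → BothTerminals (u , v) → Positive (pairDemand u v)
    pairDemand-positive {u} {v} u≢v (u∈R , v∈R) = case u Fin.≟ r of λ where
        (no u≢r)     → positive u∈R u≢r (left∈ u v) (right∈ u v) (u≢v ∘ ≡.sym)
        (yes ≡.refl) → positive v∈R (u≢v ∘ ≡.sym) (right∈ u v) (left∈ u v) u≢v
      where
      positive : ∀ {a b} → a ∈ R → a ≢ r → a ∈ ⁅ u ⁆ ∪ ⁅ v ⁆ → b ∈ ⁅ u ⁆ ∪ ⁅ v ⁆ → b ≢ a →
        Positive (pairDemand u v)
      positive {a} {b} a∈R a≢r a∈ b∈ b≢a = Positive-mono (≤-trans (≤-trans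
          (≤-reflexive (sym (trans (*-congˡ (when-yes (crosses? I ⁅ a ⁆ (⁅ u ⁆ ∪ ⁅ v ⁆ , b))
            (meets a∈ (x∈⁅x⁆ a) , b≢a ∘ x∈⁅y⁆⇒x≡y a) 1#)) (*-identityʳ _))))
          (term≤∑ (∈-cuts ((a , x∈⁅x⁆ a) , (λ x∈ → ≡.subst (_∈ R) (≡.sym (x∈⁅y⁆⇒x≡y a x∈)) a∈R) ,
            a≢r ∘ ≡.sym ∘ x∈⁅y⁆⇒x≡y a))
            λ S → *-nonNegative (proj₁ dual S) (crossing-nonneg (⁅ u ⁆ ∪ ⁅ v ⁆ , b) S)))
        (load≤demand b∈)) (separating a∈R a≢r)

    demand≤cost : ∀ {X} → X ⊆ R → demand X ≤ κ * cost X
    demand≤cost {X} X⊆R = demand≤ X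
      (*-nonNegative κ-nonneg (IsConnectionCost⇒nonneg I (isCost X X⊆R)))
      λ v∈X → proj₂ dual X _ X⊆R v∈X

    c⁺≤ : ∀ {u v} → Adj E u v → c⁺ u v ≤ κ * c u v
    c⁺≤ {u} {v} a = case both? (u , v) of λ where
      (no ¬both) → ≤-reflexive (reflexive (c⁺-old ¬both))
      (yes both@(u∈R , v∈R)) →
        let X⊆R : ⁅ u ⁆ ∪ ⁅ v ⁆ ⊆ R
            X⊆R x∈ = [ (λ { ≡.refl → u∈R }) , (λ { ≡.refl → v∈R }) ]′ (pair∈ x∈)
            to-v : ∀ {x} → x ∈ ⁅ u ⁆ ∪ ⁅ v ⁆ → Connected ((u , v) ∷ []) x v
            to-v x∈ = [ (λ { ≡.refl → Connected-∈ {L = (u , v) ∷ []} (here ≡.refl) }) ,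
              (λ { ≡.refl → ≡.refl }) ]′ (pair∈ x∈)
        in ≤-respˡ (reflexive (≡.sym (c⁺-both both))) (≤-trans (demand≤cost X⊆R) (*-monoˡ-≤ κ-nonneg
          (≤-respʳ (+-identityʳ _) (IsConnectionCost⇒≤ I {L = (u , v) ∷ []} (isCost _ X⊆R)
            (λ { (here ≡.refl) → a }) λ x∈ z∈ → ≡.trans (to-v x∈) (≡.sym (to-v z∈))))))

    completed : Instance
    completed = record
      { n          = n
      ; E          = E⁺
      ; connected  = λ u v → gmap id (λ a → fromWitness (inj₁ a)) (connected u v)
      ; c          = c⁺
      ; c-sym      = λ u v a → case both? (u , v) of λ where
          (yes both) → reflexive (≡.trans (c⁺-both both)
            (≡.trans (pairDemand-comm u v) (≡.sym (c⁺-both (swap both)))))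
          (no ¬both) → trans (reflexive (c⁺-old ¬both))
            (trans (*-congˡ (c-sym u v (old-adj a ¬both)))
            (sym (reflexive (c⁺-old (¬both ∘ swap)))))
      ; c-pos      = λ u v a → Positive⇒0< (case both? (u , v) of λ where
          (yes both) → Positive-mono (≤-reflexive (reflexive (≡.sym (c⁺-both both))))
            (pairDemand-positive (λ { ≡.refl → EdgeSet.irrefl E⁺ u a }) both)
          (no ¬both) → Positive-mono (≤-reflexive (reflexive (≡.sym (c⁺-old ¬both))))
            (*-positive κ-positive (0<⇒Positive (c-pos u v (old-adj a ¬both)))))
      ; R          = R
      ; R-nonempty = R-nonempty
      }

    terminalDemand : Subset n → Carrier
    terminalDemand S = demand (R ∩ S)

    -- A potential for bounding Steiner trees from below: each terminal edge raises it by at most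
    -- its cost, and once all terminals share a class it is at least `demand R`.
    demands : Labelling n → Carrier
    demands ℓ = ∑-classes ℓ terminalDemand

    -- The merged terminal set is covered by the two old ones with `⁅ u ⁆ ∪ ⁅ v ⁆` as a link between
    -- them; consecutive sets overlap, so `demand-∪` applies twice.
    demands-merge : ∀ ℓ {u v} → BothTerminals (u , v) → demands (merge ℓ u v) ≤
      demands ℓ + pairDemand u v
    demands-merge ℓ {u} {v} (u∈R , v∈R) = case ℓ u Fin.≟ ℓ v of λ where
        (yes e) → ≤-trans (≤-reflexive
          (sym (∑-classes-cong {ℓ = ℓ} {ℓ′ = merge ℓ u v} terminalDemand (merge-same ℓ u v e))))
          (x≤x+ (demand-nonneg (⁅ u ⁆ ∪ ⁅ v ⁆)))
        (no ne) → ≤-by joined≤ (trans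
          (solve 4 (λ d a p b → d :+ (a :+ p :+ b) := d :+ (a :+ b) :+ p) refl _ _ _ _)
          (trans (+-congʳ (∑-classes-merge ℓ u v terminalDemand
              (trans (reflexive (≡.cong demand (∩-zeroʳ R))) demand-⊥) ne))
            (solve 3 (λ d j p → d :+ j :+ p := d :+ p :+ j) refl _ _ _)))
      where
      U = class ℓ (ℓ u)
      V = class ℓ (ℓ v)

      u∈U : u ∈ R ∩ U
      u∈U = x∈p∩q⁺ (u∈R , ∈-class⁺ ℓ ≡.refl)

      v∈V : v ∈ R ∩ V
      v∈V = x∈p∩q⁺ (v∈R , ∈-class⁺ ℓ ≡.refl)

      union : R ∩ (U ∪ V) ≡ ((R ∩ U) ∪ (⁅ u ⁆ ∪ ⁅ v ⁆)) ∪ (R ∩ V)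
      union = ⊆-antisym
        (λ x∈ → let x∈R , x∈∪ = x∈p∩q⁻ R (U ∪ V) x∈ in
          [ (λ x∈U → x∈p∪q⁺ (inj₁ (x∈p∪q⁺ (inj₁ (x∈p∩q⁺ (x∈R , x∈U)))))) ,
            (λ x∈V → x∈p∪q⁺ (inj₂ (x∈p∩q⁺ (x∈R , x∈V)))) ]′
            (x∈p∪q⁻ U V x∈∪))
        (λ x∈ → [ (λ x∈l → [ fromU ,
          (λ x∈uv → [ (λ { ≡.refl → fromU u∈U }) , (λ { ≡.refl → fromV v∈V }) ]′ (pair∈ x∈uv)) ]′
            (x∈p∪q⁻ (R ∩ U) _ x∈l)) , fromV ]′ (x∈p∪q⁻ _ (R ∩ V) x∈))
        where
        fromU : ∀ {x} → x ∈ R ∩ U → x ∈ R ∩ (U ∪ V)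
        fromU x∈ = let x∈R , x∈U = x∈p∩q⁻ R U x∈ in x∈p∩q⁺ (x∈R , x∈p∪q⁺ (inj₁ x∈U))
        fromV : ∀ {x} → x ∈ R ∩ V → x ∈ R ∩ (U ∪ V)
        fromV x∈ = let x∈R , x∈V = x∈p∩q⁻ R V x∈ in x∈p∩q⁺ (x∈R , x∈p∪q⁺ (inj₂ x∈V))

      joined≤ : terminalDemand (U ∪ V) ≤ terminalDemand U + pairDemand u v + terminalDemand V
      joined≤ = ≤-trans (≤-reflexive (reflexive (≡.cong demand union)))
        (≤-trans (demand-∪ {X = (R ∩ U) ∪ (⁅ u ⁆ ∪ ⁅ v ⁆)} (x∈p∪q⁺ (inj₂ (right∈ u v))) v∈V)
          (+-monoˡ-≤ _ (demand-∪ {X = R ∩ U} u∈U (left∈ u v))))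

    demands-components : ∀ ℓ L → (∀ {e} → e ∈ᴸ L → BothTerminals e) →
                         demands (components ℓ L) ≤ demands ℓ + ∑ L (uncurry pairDemand)
    demands-components ℓ []            _    = ≤-reflexive (sym (+-identityʳ _))
    demands-components ℓ ((u , v) ∷ L) both =
      ≤-trans (demands-components (merge ℓ u v) L (both ∘ there))
      (≤-by (demands-merge ℓ (both (here ≡.refl)))
        (solve 4 (λ d s d₀ p → d :+ s :+ (d₀ :+ p) := d₀ :+ (p :+ s) :+ d) refl _ _ _ _))

    -- The edges of one component connect its terminals in the original instance, so they cost at
    -- least `κ` times the connection cost, which bounds the demand.
    demands-old : ∀ L → (∀ {u v} → (u , v) ∈ᴸ L → Adj E u v × ¬ BothTerminals (u , v)) →
                  demands (component L) ≤ ∑ L (uncurry c⁺)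
    demands-old L old = ≤-trans (∑-mono (allFin n) per-class) (≤-reflexive regroup)
      where
      part = λ a → class-edges L a

      regroup : ∑ (allFin n) (λ a → ∑ (part a) (uncurry c⁺)) ≈ ∑ L (uncurry c⁺)
      regroup = trans (∑-cong (allFin n) λ a →
        ∑-filter (λ (u , _) → component L u Fin.≟ a) L (uncurry c⁺))
        (trans (∑-swap (allFin n) L _) (∑-cong L λ e → trans
          (∑-cong (allFin n) λ a →
            when-cong (component L (proj₁ e) Fin.≟ a) (a Fin.≟ component L (proj₁ e)) ≡.sym
            ≡.sym λ _ → refl)
          (∑-δ (fin n) (component L (proj₁ e)) λ _ → uncurry c⁺ e)))

      per-class : ∀ a → terminalDemand (class (component L) a) ≤ ∑ (part a) (uncurry c⁺)
      per-class a = ≤-trans (demand≤cost X⊆R) (≤-trans (*-monoˡ-≤ κ-nonneg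
          (IsConnectionCost⇒≤ I (isCost X X⊆R) (proj₁ ∘ old ∘ part⊆) λ u∈ v∈ →
            class-connected L a (labelled u∈) (labelled v∈)))
        (≤-reflexive (trans (sym (∑-*ˡ (part a) κ _)) (∑-cong∈ (part a) λ e e∈ →
          sym (reflexive (c⁺-old (proj₂ (old (part⊆ e∈)))))))))
        where
        X = R ∩ class (component L) a

        X⊆R : X ⊆ R
        X⊆R = p∩q⊆p R (class (component L) a)

        labelled : ∀ {u} → u ∈ X → component L u ≡ a
        labelled u∈ = ∈-class⁻ (component L) (proj₂ (x∈p∩q⁻ R _ u∈))

        part⊆ : ∀ {e} → e ∈ᴸ part a → e ∈ᴸ L
        part⊆ e∈ = proj₁ (∈-filter⁻ (λ (u , _) → component L u Fin.≟ a) e∈)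

    -- The old edges come first, since they are compared with connection costs a whole component at
    -- a time; the terminal edges then join these components one by one.
    demand≤tree : ∀ {K} → SteinerTreeEdges completed K → demand R ≤ weight c⁺ K
    demand≤tree {K} (K⊆E⁺ , W , R⊆W , tree) = ≤-trans demand≤demands (≤-trans
        (demands-components (component old) new (λ e∈ → proj₂ (∈-filter⁻ both? {xs = L} e∈)))
        (≤-trans (+-mono-≤ (demands-old old λ e∈ →
          let e∈L , ¬both = ∈-filter⁻ (¬? ∘ both?) {xs = L} e∈ in
              old-adj (K⊆E⁺ _ _ (∈-edges⁻ K e∈L)) ¬both , ¬both)
            (≤-reflexive (∑-cong∈ new λ e e∈ →
              reflexive (≡.sym (c⁺-both (proj₂ (∈-filter⁻ both? {xs = L} e∈)))))))
          (≤-reflexive (trans (+-comm _ _)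
            (trans (∑-filter-split both? L (uncurry c⁺)) (sym (weight≈∑ c⁺ K)))))))
      where
      L = edges K
      old = filter (¬? ∘ both?) L
      new = filter both? L
      ℓ = components (component old) new

      joined : ∀ {u v} → (u , v) ∈ᴸ L → ℓ u ≡ ℓ v
      joined {u} {v} e∈ = case both? (u , v) of λ where
        (yes both) → components-joins (component old) (∈-filter⁺ both? e∈ both)
        (no ¬both) → components-mono (component old) new
          (Connected-∈ {L = old} (∈-filter⁺ (¬? ∘ both?) e∈ ¬both))

      constant : ∀ {u v} → u ∈ R → v ∈ R → ℓ u ≡ ℓ v
      constant u∈ v∈ = Connected-sound {_~_ = λ u v → ℓ u ≡ ℓ v}
        (record { refl = ≡.refl ; sym = ≡.sym ; trans = ≡.trans }) L joined
        (walk⇒Connected K L (Connected-adj K) (IsTree.connected tree _ _ (R⊆W u∈) (R⊆W v∈)))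

      demand≤demands : demand R ≤ demands ℓ
      demand≤demands = ≤-trans (≤-reflexive (reflexive (≡.cong demand (⊆-antisym
          (λ x∈ → x∈p∩q⁺ (x∈ , ∈-class⁺ ℓ (constant x∈ r∈R))) (p∩q⊆p R _)))))
        (term≤∑ {f = λ a → terminalDemand (class ℓ a)} (∈-elements (fin n) (ℓ r)) λ a →
          demand-nonneg (R ∩ class ℓ a))

    dualValue≤OPT : ∀ {o} → IsOPT completed o → dualValue ≤ o
    dualValue≤OPT ((K , tree , o≈) , _) =
      ≤-trans dualValue≤demand (≤-respʳ (sym o≈) (demand≤tree tree))

    TMST≤dualValue : ∀ {t} → IsTMST completed t → t ≤ dualValue
    TMST≤dualValue {t} (d , dist , min) = ≤-trans
        (tree-minimum≤ {W = R} {r = r} {d = d} {t = t} {w = pairDemand} {L = L} min r∈R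
          (proj₁ (proj₂ cheap)) pair-ok distance≤)
        (proj₂ (proj₂ cheap))
      where
      cheap = cheap-spanning-edges laminar
      L = proj₁ cheap

      pair-ok : ∀ {u v} → (u , v) ∈ᴸ L → 0# ≤ pairDemand u v × pairDemand u v ≈ pairDemand v u
      pair-ok {u} {v} _ = demand-nonneg (⁅ u ⁆ ∪ ⁅ v ⁆) , reflexive (pairDemand-comm u v)

      distance≤ : ∀ {u v} → u ∈ R → v ∈ R → u ≢ v → d u v ≤ pairDemand u v
      distance≤ {u} {v} u∈ v∈ u≢v = ≤-trans
        (distance≤edge completed {u} {v} (dist u v u∈ v∈) (fromWitness (inj₂ (u≢v , u∈ , v∈))))
        (≤-reflexive (reflexive (c⁺-both (u∈ , v∈))))

    -- The chain `dualValue` ≤ OPT ≤ TMST ≤ `dualValue` collapses.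
    completed-MSTOptimal : ¬ ¬ (MSTOptimal completed × ∃[ o ] IsOPT completed o × dualValue ≤ o)
    completed-MSTOptimal k = IsOPT-exists completed λ (o , opt) →
      IsTMST-exists completed λ (t , tmst) →
      k ( (t , o , tmst , opt , antisym (≤-trans (TMST≤dualValue tmst) (dualValue≤OPT opt))
        (OPT≤TMST completed opt tmst))
        , o , opt , dualValue≤OPT opt )

    -- A solution for the original graph, extended by zero to the new edges, satisfies the same
    -- cuts, and no old edge costs more than `κ` times its former cost.
    completed-BCR≤ : ∀ {b b⁺} → IsBCR I r b → IsBCR completed r b⁺ → b⁺ ≤ κ * b
    completed-BCR≤ {b} ((x , feasible , b≈) , _) (_ , b⁺≤) = ≤-trans (b⁺≤ x⁺ feasible⁺) (≤-trans
        (≤-reflexive (BCRCost≈∑ completed x⁺))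
        (≤-trans (∑-mono (pairs n) edge≤)
          (≤-reflexive (trans (∑-*ˡ (pairs n) κ _)
            (*-congˡ (trans (sym (BCRCost≈∑ I x)) (sym b≈)))))))
      where
      x⁺ : Fin n → Fin n → Carrier
      x⁺ u v = when (adj? I (u , v)) (x u v)

      x⁺-nonneg : ∀ u v → 0# ≤ x⁺ u v
      x⁺-nonneg u v = when-nonneg (adj? I (u , v)) (nonneg feasible u v)

      feasible⁺ : BCRFeasible completed r x⁺
      feasible⁺ .nonneg u v _ = x⁺-nonneg u v
      feasible⁺ .cut S r∉S ne =
        ≤-respʳ (sym (BCR-cut≈∑ completed S x⁺)) (≤-trans (cut feasible S r∉S ne)
        (≤-respˡ (sym (BCR-cut≈∑ I S x)) (∑-mono (pairs n) λ (u , v) →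
          when-mono (adj? I (u , v) ×-dec leaves? I S (u , v))
            (adj? completed (u , v) ×-dec leaves? completed S (u , v))
            (λ (a , l) → fromWitness (inj₁ a) , l)
            (λ (a , _) → ≤-reflexive (sym (when-yes (adj? I (u , v)) a _)))
            λ _ → x⁺-nonneg u v)))

      edge≤ : ∀ ((u , v) : Fin n × Fin n) →
              when (adj? completed (u , v)) (c⁺ u v * x⁺ u v) ≤
                κ * when (adj? I (u , v)) (c u v * x u v)
      edge≤ (u , v) = case adj? I (u , v) of λ where
        (yes a) → ≤-trans (≤-reflexive
          (trans (when-yes (adj? completed (u , v)) (fromWitness (inj₁ a)) _)
              (*-congˡ (when-yes (adj? I (u , v)) a _))))
            (≤-trans (*-monoʳ-≤ (nonneg feasible u v a) (c⁺≤ a))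
              (≤-reflexive (trans (*-assoc _ _ _)
              (*-congˡ (sym (when-yes (adj? I (u , v)) a _))))))
        (no ¬a) → ≤-reflexive (trans
          (when-zero (adj? completed (u , v)) λ _ →
            trans (*-congˡ (when-no (adj? I (u , v)) ¬a _)) (zeroʳ _))
          (sym (trans (*-congˡ (when-no (adj? I (u , v)) ¬a _)) (zeroʳ κ))))

  -- Comparing the suprema

  open AddSup _≤_ using (_≤⁺_; [_]; _≤⊤⁺; [≤]-injective; ≤⁺-dec)

  small-factor : ∀ {γ N} → Positive γ → 0# ≤ N → ∃[ τ ] Positive τ × τ * N ≤ γ
  -- Dividing by `1# + N` instead of `N` covers the case that `N` is zero.
  small-factor {γ} {N} pγ 0≤N = γ * (1# + N) ⁻¹ , pτ , ≤-trans
      (*-monoˡ-≤ (Positive⇒0≤ pτ) (x≤+x 0≤1))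
      (≤-reflexive (trans (*-assoc _ _ _)
        (trans (*-congˡ (trans (*-comm _ _) (*-inverseʳ _ (Positive⇒≉0 p1+N)))) (*-identityʳ γ))))
    where
    p1+N = +-positive 1-positive 0≤N
    pτ = *-positive pγ (⁻¹-positive p1+N)

  -- The quadratic term in the objective β makes the optimal dual solution laminar,
  -- and the weight η on the singletons makes the costs between terminals positive.
  module Perturbation (I : Instance) {r : Fin (Instance.n I)} (r∈R : r ∈ Instance.R I)
      {cost : Subset (Instance.n I) → Carrier}
        (isCost : ∀ X → X ⊆ Instance.R I → IsConnectionCost I X (cost X))
      {γ : Carrier} (γ-positive : Positive γ) where
    open Instance I
    open HypergraphicDual I r∈R

    terms : Carrier
    terms = ∑ (allFin n) λ _ → 1#

    -- With `τ` times the number of pairs at most `γ`, the coefficients `β` stay between `1#` and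
    -- `κ`.
    τ-choice = small-factor {N = pairs-count {n}} γ-positive (∑-nonneg (pairs n) λ _ → 0≤1)
    τ = proj₁ τ-choice

    m = proj₁ (minimum-cost I)
    m≤c : ∀ {u v} → EdgeSet.Adj E u v → m ≤ c u v
    m≤c = proj₂ (proj₂ (minimum-cost I))

    -- The singletons add at most `η` times the number of vertices to a load, which is to be at most
    -- `γ * m`, a `γ` fraction of the cheapest edge.
    η-choice = small-factor {N = terms} (*-positive γ-positive (proj₁ (proj₂ (minimum-cost I))))
      (∑-nonneg (allFin n) λ _ → 0≤1)
    η = proj₁ η-choice
    η-positive = proj₁ (proj₂ η-choice)

    β : Subset n → Carrier
    β S = 1# + τ * ∣ S ∣²

    optimum = dual-optimum isCost β λ S →
      x≤x+ (*-nonNegative (Positive⇒0≤ (proj₁ (proj₂ τ-choice))) (∣∣²-nonneg S))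
    y = proj₁ optimum

    y-feasible : DualFeasible cost y
    y-feasible = proj₁ (proj₂ optimum)

    Singleton : Subset n → Set
    Singleton S = ∃[ u ] S ≡ ⁅ u ⁆

    singleton? : ∀ S → Dec (Singleton S)
    singleton? S = Fin.any? λ u → S ≟ˢ ⁅ u ⁆

    y⁺ : Subset n → Carrier
    y⁺ S = y S + η * indicator (singleton? S)

    y≤y⁺ : ∀ S → y S ≤ y⁺ S
    y≤y⁺ S = x≤x+ (*-nonNegative (Positive⇒0≤ η-positive) (indicator-nonneg (singleton? S)))

    singletons≤ : ∀ q → ∑ cuts (λ S → indicator (singleton? S) * crossing q S) ≤ terms
    singletons≤ q = ≤-trans (≤-reflexive (∑-filter cut? (subsets n) _)) (≤-trans
      (∑-mono (subsets n) {g = λ S → ∑ (allFin n) λ u → indicator (S ≟ˢ ⁅ u ⁆)} λ S → ≤-trans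
        (when-≤ (cut? S) (*-nonNegative (indicator-nonneg (singleton? S)) (crossing-nonneg q S)))
        (≤-trans (*-monoˡ-≤ (indicator-nonneg (singleton? S)) (indicator≤1 (crosses? I S q)))
          (≤-trans (≤-reflexive (*-identityʳ _)) (when-bound (singleton? S)
            (λ (u , S≡) → ≤-trans (≤-reflexive (sym (indicator-yes (S ≟ˢ ⁅ u ⁆) S≡)))
              (term≤∑ {f = λ u → indicator (S ≟ˢ ⁅ u ⁆)} (∈-elements (fin n) u) λ u →
                indicator-nonneg (S ≟ˢ ⁅ u ⁆)))
            (∑-nonneg (allFin n) λ u → indicator-nonneg (S ≟ˢ ⁅ u ⁆))))))
      (≤-reflexive (trans (∑-swap (subsets n) (allFin n) _)
        (∑-cong (allFin n) λ u → ∑-δ (subset n) ⁅ u ⁆ λ _ → 1#))))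

    minimum-cost≤ : ∀ {X u v} → X ⊆ R → u ∈ X → v ∈ X → u ≢ v → m ≤ cost X
    minimum-cost≤ {X} X⊆R u∈ v∈ u≢v with IsConnectionCost⇒edges I (isCost X X⊆R)
    ... | []          , _   , joined , _  = ⊥-elim (u≢v (joined u∈ v∈))
    ... | (a , b) ∷ L , L⊆E , _      , k≈ = ≤-respʳ (sym k≈) (≤-trans (m≤c (L⊆E (here ≡.refl)))
      (x≤x+ (∑-edges-nonneg L (c-nonneg I ∘ L⊆E ∘ there))))

    κ = 1# + γ

    y⁺-feasible : DualFeasible (λ X → κ * cost X) y⁺
    y⁺-feasible = (λ S → ≤-trans (proj₁ y-feasible S) (y≤y⁺ S)) , λ X v X⊆R v∈X → ≤-trans
        (≤-reflexive (trans (∑-cong cuts λ S → trans (distribʳ _ _ _) (+-congˡ (*-assoc _ _ _)))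
          (trans (∑-+ cuts _ _) (+-congˡ (∑-*ˡ cuts η _)))))
        (≤-trans (+-mono-≤ (proj₂ y-feasible X v X⊆R v∈X) (extra X v X⊆R v∈X))
          (≤-reflexive (solve 2 (λ k γ → k :+ γ :* k := (:1 :+ γ) :* k) refl _ γ)))
      where
      extra : ∀ X v → X ⊆ R → v ∈ X →
        η * ∑ cuts (λ S → indicator (singleton? S) * crossing (X , v) S) ≤ γ * cost X
      extra X v X⊆R v∈X = case Fin.any? (λ u → (u ∈? X) ×-dec ¬? (u Fin.≟ v)) of λ where
        (yes (u , u∈X , u≢v)) → ≤-trans (*-monoˡ-≤ (Positive⇒0≤ η-positive) (singletons≤ (X , v)))
          (≤-trans (proj₂ (proj₂ η-choice))
            (*-monoˡ-≤ (Positive⇒0≤ γ-positive) (minimum-cost≤ X⊆R u∈X v∈X u≢v)))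
        -- Connecting a single terminal may cost nothing, so nothing may be added to its load;
        -- indeed no singleton meets `X` while avoiding `v`.
        (no none) → ≤-trans
          (≤-reflexive (trans (*-congˡ
            (∑-zero′ cuts λ S → trans (sym (when-×-dec (singleton? S) (crosses? I S (X , v)) 1#))
            (indicator-no (singleton? S ×-dec crosses? I S (X , v)) (λ { ((w , ≡.refl) , m , v∉) →
              let x , x∈X , x∈w = meets⁻ X ⁅ w ⁆ m in
              none (x , x∈X , λ { ≡.refl → v∉ x∈w }) })))) (zeroʳ η)))
          (*-nonNegative (Positive⇒0≤ γ-positive) (IsConnectionCost⇒nonneg I (isCost X X⊆R)))

    -- A singleton is contained in every set that it meets, and on all other sets `y⁺` agrees with
    -- the laminar `y`.
    y⁺-laminar : Laminar y⁺
    y⁺-laminar {S} {T} cutS cutT pS pT ne = by-cases (singleton? S) (singleton? T)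
      where
      common = x∈p∩q⁻ S T (proj₂ ne)

      unchanged : ∀ S → ¬ Singleton S → Positive (y⁺ S) → Positive (y S)
      unchanged S ¬s = Positive-mono
        (≤-reflexive (trans (+-congˡ (trans (*-congˡ (indicator-no (singleton? S) ¬s)) (zeroʳ η)))
        (+-identityʳ _)))

      ⁅⁆⊆ : ∀ {u x} {Z : Subset n} → x ∈ ⁅ u ⁆ → x ∈ Z → ⁅ u ⁆ ⊆ Z
      ⁅⁆⊆ {u} {x} {Z} x∈u x∈Z z∈ =
        ≡.subst (_∈ Z) (≡.trans (x∈⁅y⁆⇒x≡y u x∈u) (≡.sym (x∈⁅y⁆⇒x≡y u z∈))) x∈Z

      by-cases : Dec (Singleton S) → Dec (Singleton T) → S ⊆ T ⊎ T ⊆ S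
      by-cases (yes (u , ≡.refl)) _                  = inj₁ (⁅⁆⊆ (proj₁ common) (proj₂ common))
      by-cases (no _)             (yes (u , ≡.refl)) = inj₂ (⁅⁆⊆ (proj₂ common) (proj₁ common))
      by-cases (no ¬s)            (no ¬t)            =
        optimum-laminar (proj₁ (proj₂ τ-choice)) y-feasible (proj₁ (proj₂ (proj₂ optimum)))
          cutS cutT (unchanged S ¬s pS) (unchanged T ¬t pT) ne

    y⁺-separating : ∀ {u} → u ∈ R → u ≢ r → Positive (y⁺ ⁅ u ⁆)
    y⁺-separating {u} _ _ = Positive-mono (≤-trans
      (≤-reflexive (sym (trans (*-congˡ (indicator-yes (singleton? ⁅ u ⁆) (u , ≡.refl)))
        (*-identityʳ η))))
      (x≤+x (proj₁ y-feasible ⁅ u ⁆))) η-positive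

    module Completed = CompletedInstance I r∈R y⁺
      (+-positive 1-positive (Positive⇒0≤ γ-positive)) isCost
      y⁺-feasible y⁺-laminar (λ {u} → y⁺-separating {u})
    open LaminarDual I r∈R y⁺ (proj₁ y⁺-feasible) using (dualValue)

    HYP≤dualValue : ∀ {h} → (∀ x → HYPFeasible I r x → h ≤ HYPCost I cost x) → h ≤ κ * dualValue
    HYP≤dualValue {h} h≤ = ≤-trans (proj₂ (proj₂ (proj₂ optimum)) h h≤) (≤-trans
      (∑-mono cuts λ S → ≤-trans (*-monoʳ-≤ (proj₁ y-feasible S) (β≤κ S))
        (*-monoˡ-≤ (Positive⇒0≤ (+-positive 1-positive (Positive⇒0≤ γ-positive)))
          (≤-trans (y≤y⁺ S) (≤-reflexive (sym (*-identityʳ _))))))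
      (≤-reflexive (∑-*ˡ cuts κ _)))
      where
      β≤κ : ∀ S → β S ≤ κ
      β≤κ S = +-monoʳ-≤ 1# (≤-trans
        (*-monoˡ-≤ (Positive⇒0≤ (proj₁ (proj₂ τ-choice))) (∣∣²≤pairs-count S))
        (proj₂ (proj₂ τ-choice)))

    dualValue-nonneg : 0# ≤ dualValue
    dualValue-nonneg = ∑-nonneg cuts λ S → *-nonNegative (proj₁ y⁺-feasible S) 0≤1

  quotient-≤ : ∀ {a b c d} → Positive b → Positive d → a * d ≤ c * b → a * b ⁻¹ ≤ c * d ⁻¹
  quotient-≤ {a} {b} {c} {d} pb pd le = *-cancelˡ-≤ (*-positive pb pd) (≤-trans
    (≤-reflexive (trans (solve 4 (λ b d a i → b :* d :* (a :* i) := i :* (b :* (a :* d))) refl b d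
      a (b ⁻¹)) (⁻¹-cancelˡ _ pb)))
    (≤-trans le (≤-reflexive
      (sym (trans (solve 4 (λ b d c i → b :* d :* (c :* i) := i :* (d :* (c :* b))) refl b d c
      (d ⁻¹)) (⁻¹-cancelˡ _ pd))))))

  -- One factor `1# + γ` comes from bounding `h` by the dual value of `y⁺`, the other from the
  -- scaled costs in the BCR of the completed instance.
  OPT/BCR-approximates : ∀ (I : Instance) {r} → 2 ℕ.≤ ∣ Instance.R I ∣ → r ∈ Instance.R I →
    ∀ {cost} → (∀ X → X ⊆ Instance.R I → IsConnectionCost I X (cost X)) →
    ∀ {h b} → (∀ x → HYPFeasible I r x → h ≤ HYPCost I cost x) → IsBCR I r b →
    ∀ {γ} → Positive γ → ¬ ¬ (∃[ q ] OPT/BCR q × h * b ⁻¹ ≤ (1# + γ) * (1# + γ) * q)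
  OPT/BCR-approximates I {r} 2≤R r∈R {cost} isCost {h} {b} h≤ bcr {γ} γ-positive k =
    completed-MSTOptimal λ (mst , o , opt , value≤o) →
      let b⁺ , bcr⁺ = IsBCR-exists completed {r}
          pb = BCR-positive I 2≤R bcr
          pb⁺ = BCR-positive completed 2≤R bcr⁺
          0≤κ = Positive⇒0≤ (+-positive 1-positive (Positive⇒0≤ γ-positive))
          h≤κo = ≤-trans (HYP≤dualValue h≤) (*-monoˡ-≤ 0≤κ value≤o)
          0≤o = ≤-trans dualValue-nonneg value≤o
      in k (o * b⁺ ⁻¹ , (completed , 2≤R , mst , r , r∈R , o , b⁺ , opt , bcr⁺ , refl) ,
        ≤-respʳ (*-assoc _ _ _) (quotient-≤ pb pb⁺ (≤-trans (*-monoʳ-≤ (Positive⇒0≤ pb⁺) h≤κo)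
          (≤-trans (*-monoˡ-≤ (*-nonNegative 0≤κ 0≤o) (completed-BCR≤ bcr bcr⁺))
            (≤-reflexive (solve 3 (λ κ o b → κ :* o :* (κ :* b) :=
              κ :* κ :* o :* b) refl _ o b))))))
    where
    open Perturbation I r∈R isCost γ-positive
    open Completed

  -- For `γ ≤ 1` the bound gives `q - u` ≤ `3γu`. If `q` exceeded `u`, some positive `γ` would also
  -- satisfy `γ(1 + 3u)` ≤ `q - u`, which forces `γ ≤ 0`.
  squared-limit : ∀ {q u} → 0# ≤ u → (∀ {γ} → Positive γ → q ≤ (1# + γ) * (1# + γ) * u) → q ≤ u
  squared-limit {q} {u} 0≤u bound = ≤-stable λ q≰u →
    let pgap : Positive (q - u)
        pgap le = q≰u (≤-by le (solve 2 (λ q u → q :+ :0 := u :+ (q :- u)) refl q u))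
        0≤3u = +-nonneg (+-nonneg 0≤u 0≤u) 0≤u
        γ₀ , pγ₀ , γ₀≤ = small-factor {N = 1# + (u + u + u)} pgap (+-nonneg 0≤1 0≤3u)
        γ , (γ≤γ₀ , γ≤1) , γ≡ = minimum γ₀ 1#
        pγ : Positive γ
        pγ = [ (λ e → Positive-mono (≤-reflexive (reflexive (≡.sym e))) pγ₀)
             , (λ e → Positive-mono (≤-reflexive (reflexive (≡.sym e))) 1-positive) ]′ γ≡
        0≤γu = *-nonNegative (Positive⇒0≤ pγ) 0≤u
    in pγ (≤-by
        (+-mono-≤ (+-mono-≤ (bound pγ) (*-monoʳ-≤ 0≤γu γ≤1))
          (≤-trans (*-monoʳ-≤ (+-nonneg 0≤1 0≤3u) γ≤γ₀) γ₀≤))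
        (solve 3 (λ γ q u → γ :+ ((:1 :+ γ) :* (:1 :+ γ) :* u :+ :1 :* (γ :* u) :+ (q :- u)) :=
          :0 :+ (q :+ γ :* (γ :* u) :+ γ :* (:1 :+ (u :+ u :+ u)))) refl γ q u))

  -- The bounded increasing map q ↦ q / (1 + q) reduces the extended supremum
  -- to completeness.
  IsSup-exists : ∀ (P : Carrier → Set) → (∀ {q} → P q → 0# ≤ q) → ¬ ¬ ∃ P → ∃ (IsSup P)
  IsSup-exists P 0≤P nonempty =
    extended (complete Compressed (0# , inj₁ refl) (1# , compressed≤1))
    where
    -- The element `0#` makes the set inhabited, as `P` is inhabited only under double negation; it
    -- lies below all compressed values and so leaves the supremum unchanged.
    Compressed : Carrier → Set
    Compressed z = z ≈ 0# ⊎ ∃[ q ] P q × z * (1# + q) ≈ q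

    1+-positive : ∀ {u} → 0# ≤ u → Positive (1# + u)
    1+-positive = +-positive 1-positive

    compressed≤1 : ∀ z → Compressed z → z ≤ 1#
    compressed≤1 z (inj₁ z≈0) = ≤-respˡ (sym z≈0) 0≤1
    compressed≤1 z (inj₂ (q , Pq , z≈)) = *-cancelˡ-≤ (1+-positive (0≤P Pq)) (≤-trans
      (≤-reflexive (trans (*-comm _ _) z≈))
        (≤-trans (x≤+x 0≤1) (≤-reflexive (sym (*-identityʳ _)))))

    Bound : Carrier → Set
    Bound u = ∀ x → P x → [ x ] ≤⁺ [ u ]

    Bound-nonneg : ∀ {u} → Bound u → 0# ≤ u
    Bound-nonneg bound = ≤-stable λ k → nonempty λ (q , Pq) →
      k (≤-trans (0≤P Pq) ([≤]-injective (bound q Pq)))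

    compressed≤ : ∀ {u} → Bound u → ∀ z → Compressed z → z ≤ u * (1# + u) ⁻¹
    compressed≤ {u} bound z Cz = *-cancelˡ-≤ p1+u (≤-respʳ
      (sym (trans (solve 2 (λ u i → (:1 :+ u) :* (u :* i) := i :* ((:1 :+ u) :* u)) refl u _)
        (⁻¹-cancelˡ u p1+u))) (scaled Cz))
      where
      0≤u = Bound-nonneg bound
      p1+u = 1+-positive 0≤u

      scaled : Compressed z → (1# + u) * z ≤ u
      scaled (inj₁ z≈0) = ≤-respˡ (sym (trans (*-congˡ z≈0) (zeroʳ _))) 0≤u
      scaled (inj₂ (q , Pq , z≈)) = *-cancelˡ-≤ (1+-positive (0≤P Pq)) (≤-respˡ
        (sym (trans (solve 3 (λ q u z → (:1 :+ q) :* ((:1 :+ u) :* z) :=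
          (:1 :+ u) :* (z :* (:1 :+ q))) refl q u z) (*-congˡ z≈)))
        (≤-by ([≤]-injective (bound q Pq))
          (solve 2 (λ q u → (:1 :+ u) :* q :+ u := (:1 :+ q) :* u :+ q) refl q u)))

    extended : _ → ∃ (IsSup P)
    extended (σ , ≤σ , σ≤) = case 1# ≤? σ of λ where
        -- Then `P` is unbounded: a bound `u` would give `σ ≤ u / (1 + u)`, which is less than one.
        (yes 1≤σ) → ⊤⁺ , (λ _ _ → _ ≤⊤⁺) , λ where
          ⊤⁺    _     → _ ≤⊤⁺
          [ u ] bound → ⊥-elim (1-positive (≤-by
            (≤-trans (*-monoʳ-≤ (Positive⇒0≤ (1+-positive (Bound-nonneg bound))) 1≤σ) (σ*≤ bound))
            (solve 1 (λ u → :1 :+ u := :0 :+ :1 :* (:1 :+ u)) refl u)))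
        (no 1≰σ) → [ σ * (1# - σ) ⁻¹ ] , (λ q Pq → [ upper (1-σ-positive 1≰σ) q Pq ]) , λ where
          ⊤⁺    _     → _ ≤⊤⁺
          [ u ] bound → [ least (1-σ-positive 1≰σ) bound ]
      where
      σ*≤ : ∀ {u} → Bound u → σ * (1# + u) ≤ u
      σ*≤ {u} bound = ≤-trans (*-monoʳ-≤ (Positive⇒0≤ p1+u) (σ≤ _ (compressed≤ bound)))
        (≤-reflexive (⁻¹-cancelʳ u p1+u))
        where
        p1+u = 1+-positive (Bound-nonneg bound)

      1-σ-positive : ¬ 1# ≤ σ → Positive (1# - σ)
      1-σ-positive 1≰σ le = 1≰σ (≤-by le (solve 1 (λ σ → :1 :+ :0 := σ :+ (:1 :- σ)) refl σ))

      cancel : Positive (1# - σ) → (1# - σ) * (σ * (1# - σ) ⁻¹) ≈ σ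
      cancel pd = trans (solve 3 (λ d σ i → d :* (σ :* i) := i :* (d :* σ)) refl _ σ _)
        (⁻¹-cancelˡ σ pd)

      upper : Positive (1# - σ) → ∀ q → P q → q ≤ σ * (1# - σ) ⁻¹
      upper pd q Pq = *-cancelˡ-≤ pd (≤-respʳ (sym (cancel pd)) (≤-by
        (*-monoʳ-≤ (Positive⇒0≤ p1+q) (≤σ (q * (1# + q) ⁻¹) (inj₂ (q , Pq , z≈))))
        (trans (solve 2 (λ q σ → (:1 :- σ) :* q :+ σ :* (:1 :+ q) := σ :+ q) refl q σ)
          (+-congˡ (sym z≈)))))
        where
        p1+q = 1+-positive (0≤P Pq)
        z≈ = ⁻¹-cancelʳ q p1+q

      least : Positive (1# - σ) → ∀ {u} → Bound u → σ * (1# - σ) ⁻¹ ≤ u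
      least pd {u} bound = *-cancelˡ-≤ pd (≤-respˡ (sym (cancel pd)) (≤-by (σ*≤ bound)
        (solve 2 (λ σ u → σ :+ u := (:1 :- σ) :* u :+ σ :* (:1 :+ u)) refl σ u)))

  edge-instance : Instance
  edge-instance = record
    { n          = 2
    ; E          = E
    ; connected  = λ u v → case u Fin.≟ v of λ where
        (yes ≡.refl) → ε
        (no u≢v)     → fromWitness u≢v ◅ ε
    ; c          = λ _ _ → 1#
    ; c-sym      = λ _ _ _ → refl
    ; c-pos      = λ _ _ _ → Positive⇒0< 1-positive
    ; R          = Subset.⊤
    ; R-nonempty = Fin.zero , ∈⊤
    }
    where
    E : EdgeSet 2
    E = record
      { adj    = λ u v → ⌊ ¬? (u Fin.≟ v) ⌋
      ; sym    = λ u v a → fromWitness (toWitness a ∘ ≡.sym)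
      ; irrefl = λ v a → toWitness a ≡.refl
      }

  OPT/BCR-nonneg : ∀ {q} → OPT/BCR q → 0# ≤ q
  OPT/BCR-nonneg (I , 2≤R , _ , r , _ , o , b , ((K , (K⊆E , _) , o≈) , _) , bcr , q≈) =
    ≤-respʳ (sym q≈) (*-nonNegative
    (≤-respʳ (sym (trans o≈ (weight≈∑ (Instance.c I) K)))
      (∑-edges-nonneg (edges K) λ e∈ → c-nonneg I (K⊆E _ _ (∈-edges⁻ K e∈))))
    (Positive⇒0≤ (⁻¹-positive (BCR-positive I 2≤R bcr))))

  -- The reals are extended by a top only, so an empty set of ratios would have no supremum.
  -- Completing the one-edge instance, with the trivial bound `h = 0#`, supplies an MST-optimal
  -- instance.
  OPT/BCR-nonempty : ¬ ¬ ∃ OPT/BCR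
  OPT/BCR-nonempty k = ¬¬-Π-subsets (IsConnectionCost-exists edge-instance) λ costs →
    OPT/BCR-approximates edge-instance (ℕ.s≤s (ℕ.s≤s ℕ.z≤n)) ∈⊤ {proj₁ ∘ costs}
      (λ X _ → proj₂ (costs X))
      {h = 0#} (λ x feasible → ≤-respʳ (sym (HYPCost≈∑ edge-instance (proj₁ ∘ costs) x))
        (∑-nonneg (elements (connectors edge-instance)) λ (X , v) →
          when-nonneg (connector? edge-instance (X , v))
          λ (X⊆R , v∈X) → *-nonNegative (IsConnectionCost⇒nonneg edge-instance (proj₂ (costs X)))
            (HYPFeasible.nonneg feasible X v X⊆R v∈X)))
      (proj₂ (IsBCR-exists edge-instance {Fin.zero})) 1-positive
      λ (q , ratio , _) → k (q , ratio)

  HYP/BCR-bounded : ∀ {u} → (∀ q → OPT/BCR q → q ≤ u) → ∀ {q} → HYP/BCR q → q ≤ u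
  HYP/BCR-bounded {u} bound (I , 2≤R , r , r∈R , h , b , (cost , isCost , _ , h≤) , bcr , q≈) =
    ≤-respˡ (sym q≈) (squared-limit
      (≤-stable λ k → OPT/BCR-nonempty λ (q , ratio) →
        k (≤-trans (OPT/BCR-nonneg ratio) (bound q ratio)))
      λ {γ} pγ → ≤-stable λ k →
        OPT/BCR-approximates I 2≤R r∈R isCost h≤ bcr pγ λ (q′ , ratio , le) →
        let 0≤κ = Positive⇒0≤ (+-positive 1-positive (Positive⇒0≤ pγ)) in
        k (≤-trans le (*-monoˡ-≤ (*-nonNegative 0≤κ 0≤κ) (bound q′ ratio))))

  OPT/BCR⇒HYP/BCR : ∀ {q} → OPT/BCR q → ¬ ¬ HYP/BCR q
  OPT/BCR⇒HYP/BCR (I , 2≤R , (t , o′ , tmst , opt′ , t≈o′) , r , r∈R , o , b , opt , bcr , q≈) k =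
    OPT-is-HYP I r∈R opt tmst
      -- The optimum `o′` recorded in MST-optimality and the optimum `o` of the ratio are minima of
      -- the same problem, hence equal.
      (trans t≈o′ (antisym (proj₂ opt′ _ (proj₁ (proj₂ (proj₁ opt))) ⟨ ≤-trans ⟩ ≤-reflexive
      (sym (proj₂ (proj₂ (proj₁ opt)))))
        (proj₂ opt _ (proj₁ (proj₂ (proj₁ opt′))) ⟨ ≤-trans ⟩ ≤-reflexive
          (sym (proj₂ (proj₂ (proj₁ opt′)))))))
      λ hyp → k (I , 2≤R , r , r∈R , o , b , hyp , bcr , q≈)

  suprema-equal : ∃[ s ] IsSup HYP/BCR s × IsSup OPT/BCR s
  suprema-equal = combine (IsSup-exists OPT/BCR OPT/BCR-nonneg OPT/BCR-nonempty)
    where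
    HYP-upper : ∀ s → (∀ q → OPT/BCR q → [ q ] ≤⁺ s) → ∀ q → HYP/BCR q → [ q ] ≤⁺ s
    HYP-upper ⊤⁺    _     _ _     = _ ≤⊤⁺
    HYP-upper [ s ] upper _ ratio = [ HYP/BCR-bounded (λ q r → [≤]-injective (upper q r)) ratio ]

    stable : ∀ {q} u → ¬ ¬ ([ q ] ≤⁺ u) → [ q ] ≤⁺ u
    stable {q} u = decidable-stable (≤⁺-dec _≤?_ [ q ] u)

    combine : ∃ (IsSup OPT/BCR) → ∃[ s ] IsSup HYP/BCR s × IsSup OPT/BCR s
    combine (s , upper , least) =
      s , (HYP-upper s upper , λ u bound → least u λ q ratio → stable u λ k →
        OPT/BCR⇒HYP/BCR ratio λ ratio′ → k (bound q ratio′)) , upper , least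

theorem1p5 : (ℝ : CompleteOrderedField) → let open SteinerTree ℝ in
    ∃[ s ] IsSup HYP/BCR s × IsSup OPT/BCR s
theorem1p5 ℝ = suprema-equal ℝ
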